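{- Let $n\ge1$. For every simplified grove $G$ of size $n$ there is a finite sequence of simplified groves $G=G_0,G_1,\dots,G_k$ of size $n$ such that each $G_{t+1}$ is obtained from $G_t$ by a spin and $G_k$ is the target grove of size $n$.
   Context: Let $V_n=\{(i,j)\in\mathbb{Z}^2 : |i|+|j|\le n,\ j\le 0,\ i+j\equiv n \pmod 2\}$. Two points of $V_n$ are joined by a lattice edge if they differ by $(\pm 2,0)$ or by $(\pm1,\pm1)$. A simplified grove of size $n$ is a graph $G$ with vertex set $V_n$ whose edges are lattice edges, such that (acyclicity) $G$ has no cycle, and (connectivity) each connected component of $G$ contains exactly one of the following sets of boundary vertices and each of these sets is contained in some component: the singletons $\{(-n,0)\},\{(n,0)\},\{(0,-n)\}$; the west pairs $\{(-i,0),(\frac{ -n-i}{2},\frac{ -n+i}{2})\}$ for $0<i<n$, $i\equiv n \pmod 2$; the east pairs $\{(i,0),(\frac{n+i}{2},\frac{ -n+i}{2})\}$ for $0<i<n$, $i\equiv n\pmod 2$; the south pairs $\{(-n+i,-i),(n-i,-i)\}$ for $\frac n2<i<n$; and, if $n$ is even, the middle triplet $\{(0,0),(-\frac n2,-\frac n2),(\frac n2,-\frac n2)\}$. The target grove of size $n$ is the simplified grove of size $n$ whose edges are exactly: (i) for each $0\le i<n$ with $i\equiv n\pmod 2$, with $d=(n-i)/2$, the edges $\{(-i+t,-t),(-i+t+1,-t-1)\}$ for $0\le t<d$ and $\{(-i+d-2s,-d),(-i+d-2s-2,-d)\}$ for $0\le s<d$; (ii) for each $0<i<n$ with $i\equiv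 n\pmod 2$, with $d=(n-i)/2$, the edges $\{(i+t,-t),(i+t+1,-t-1)\}$ for $0\le t<d$; (iii) for each $\frac n2<i<n$, the edges $\{(-n+i+2s,-i),(-n+i+2s+2,-i)\}$ for $0\le s<n-i$. Spins: for a vertex $p=(x,y)$, list its six potential neighbours in the cyclic order $UL=(x-1,y+1)$, $UR=(x+1,y+1)$, $R=(x+2,y)$, $DR=(x+1,y-1)$, $DL=(x-1,y-1)$, $L=(x-2,y)$ (then back to $UL$). A simplified grove $G'$ is obtained from a simplified grove $G$ by a spin with pivot $p$ if there are $u,v\in V_n$ which are consecutive in this cyclic order around $p$, with $\{p,u\}$ an edge of $G$ and $\{p,v\}$ not an edge of $G$, such that $G'$ is obtained from $G$ by deleting the edge $\{p,u\}$ and adding the edge $\{p,v\}$. -}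

module Defs where

open import Data.Nat as ℕ using (ℕ; _<_)
open import Data.Integer as ℤ using (ℤ; +_; -_; _+_; _-_; ∣_∣)
open import Data.Integer.Divisibility as ℤD using ()
open import Data.Bool using (Bool; true)
open import Data.Product using (Σ; ∃; ∃-syntax; _×_; _,_)
open import Data.Sum using (_⊎_)
open import Data.Unit using (⊤)
open import Data.List using (List; []; _∷_; [_]; _++_; length)
open import Data.List.Membership.Propositional using (_∈_)
open import Data.List.Relation.Unary.Unique.Propositional using (Unique)
open import Relation.Binary.PropositionalEquality using (_≡_)
open import Relation.Binary.Construct.Closure.ReflexiveTransitive using (Star)
open import Relation.Nullary using (¬_)
open import Function.Bundles using (_⇔_)

Point : Set
Point = ℤ × ℤ

pt : ℤ → ℤ → Point
pt x y = x , y

InV : ℕ → Point → Set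
InV n (i , j) = (∣ i ∣ ℕ.+ ∣ j ∣ ℕ.≤ n) × (j ℤ.≤ + 0) × ((+ 2) ℤD.∣ (i + j - + n))

data LatticeStep : ℤ → ℤ → Set where
  r  : LatticeStep (+ 2) (+ 0)
  l  : LatticeStep (- + 2) (+ 0)
  ur : LatticeStep (+ 1) (+ 1)
  ul : LatticeStep (- + 1) (+ 1)
  dr : LatticeStep (+ 1) (- + 1)
  dl : LatticeStep (- + 1) (- + 1)

LatticeEdge : ℕ → Point → Point → Set
LatticeEdge n (a₁ , a₂) (b₁ , b₂) =
  InV n (a₁ , a₂) × InV n (b₁ , b₂) × LatticeStep (b₁ - a₁) (b₂ - a₂)

-- A graph on V_n is given by its (symmetric) edge indicator
Graph : Set
Graph = Point → Point → Bool

Edge : Graph → Point → Point → Set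
Edge G a b = G a b ≡ true

Chain : Graph → List Point → Set
Chain G [] = ⊤
Chain G (x ∷ []) = ⊤
Chain G (x ∷ y ∷ rest) = Edge G x y × Chain G (y ∷ rest)

HasCycle : Graph → Set
HasCycle G = ∃[ x ] ∃[ vs ] (2 ℕ.≤ length vs) × Unique (x ∷ vs) × Chain G (x ∷ vs ++ [ x ])

Connected : Graph → Point → Point → Set
Connected G = Star (Edge G)

data BoundarySet (n : ℕ) : List Point → Set where
  westCorner  : BoundarySet n [ pt (- + n) (+ 0) ]
  eastCorner  : BoundarySet n [ pt (+ n) (+ 0) ]
  southCorner : BoundarySet n [ pt (+ 0) (- + n) ]
  -- west pair for 0 < i < n, n = i + 2d : {(-i,0), ((-n-i)/2, (-n+i)/2)} = {(-i,0), (-i-d,-d)}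
  westPair : (i d : ℕ) → 1 ℕ.≤ i → 1 ℕ.≤ d → i ℕ.+ 2 ℕ.* d ≡ n →
    BoundarySet n (pt (- + i) (+ 0) ∷ pt (- + (i ℕ.+ d)) (- + d) ∷ [])
  -- east pair for 0 < i < n, n = i + 2d : {(i,0), ((n+i)/2, (-n+i)/2)} = {(i,0), (i+d,-d)}
  eastPair : (i d : ℕ) → 1 ℕ.≤ i → 1 ℕ.≤ d → i ℕ.+ 2 ℕ.* d ≡ n →
    BoundarySet n (pt (+ i) (+ 0) ∷ pt (+ (i ℕ.+ d)) (- + d) ∷ [])
  southPair : (i : ℕ) → n < 2 ℕ.* i → i < n →
    BoundarySet n (pt (+ i - + n) (- + i) ∷ pt (+ n - + i) (- + i) ∷ [])
  middleTriplet : (m : ℕ) → n ≡ 2 ℕ.* m →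
    BoundarySet n (pt (+ 0) (+ 0) ∷ pt (- + m) (- + m) ∷ pt (+ m) (- + m) ∷ [])

record IsSimplifiedGrove (n : ℕ) (G : Graph) : Set where
  field
    symmetric : ∀ a b → G a b ≡ G b a
    lattice   : ∀ a b → Edge G a b → LatticeEdge n a b
    acyclic   : ¬ HasCycle G
    setConnected : ∀ S → BoundarySet n S → ∀ x y → x ∈ S → y ∈ S → Connected G x y
    setsSeparated : ∀ S T → BoundarySet n S → BoundarySet n T →
      ∀ x y → x ∈ S → y ∈ T → Connected G x y → S ≡ T
    covered : ∀ v → InV n v → ∃[ S ] BoundarySet n S × (∃[ x ] x ∈ S × Connected G v x)

data TargetEdge′ (n : ℕ) : Point → Point → Set where
  diagW : (i d t : ℕ) → 1 ℕ.≤ d → i ℕ.+ 2 ℕ.* d ≡ n → t < d →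
    TargetEdge′ n (pt (+ t - + i) (- + t)) (pt (+ (t ℕ.+ 1) - + i) (- + (t ℕ.+ 1)))
  horW : (i d s : ℕ) → 1 ℕ.≤ d → i ℕ.+ 2 ℕ.* d ≡ n → s < d →
    TargetEdge′ n (pt (+ d - + i - + (2 ℕ.* s)) (- + d))
                  (pt (+ d - + i - + (2 ℕ.* s) - + 2) (- + d))
  diagE : (i d t : ℕ) → 1 ℕ.≤ i → 1 ℕ.≤ d → i ℕ.+ 2 ℕ.* d ≡ n → t < d →
    TargetEdge′ n (pt (+ (i ℕ.+ t)) (- + t)) (pt (+ (i ℕ.+ t ℕ.+ 1)) (- + (t ℕ.+ 1)))
  horS : (i s : ℕ) → n < 2 ℕ.* i → i < n → s < n ℕ.∸ i →
    TargetEdge′ n (pt (+ i - + n + + (2 ℕ.* s)) (- + i))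
                  (pt (+ i - + n + + (2 ℕ.* s) + + 2) (- + i))

TargetEdge : ℕ → Point → Point → Set
TargetEdge n a b = TargetEdge′ n a b ⊎ TargetEdge′ n b a

IsTargetGrove : ℕ → Graph → Set
IsTargetGrove n G = ∀ a b → Edge G a b ⇔ TargetEdge n a b

data Dir : Set where
  UL UR R DR DL L : Dir

offset : Dir → Point
offset UL = pt (- + 1) (+ 1)
offset UR = pt (+ 1) (+ 1)
offset R  = pt (+ 2) (+ 0)
offset DR = pt (+ 1) (- + 1)
offset DL = pt (- + 1) (- + 1)
offset L  = pt (- + 2) (+ 0)

_⊕_ : Point → Point → Point
(a , b) ⊕ (c , d) = (a + c , b + d)

data NextDir : Dir → Dir → Set where
  UL→UR : NextDir UL UR
  UR→R  : NextDir UR R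
  R→DR  : NextDir R DR
  DR→DL : NextDir DR DL
  DL→L  : NextDir DL L
  L→UL  : NextDir L UL

Consecutive : Point → Point → Point → Set
Consecutive p u v = ∃[ d ] ∃[ e ] (NextDir d e ⊎ NextDir e d) × u ≡ p ⊕ offset d × v ≡ p ⊕ offset e

SamePair : Point → Point → Point → Point → Set
SamePair a b c d = (a ≡ c × b ≡ d) ⊎ (a ≡ d × b ≡ c)

SpinOf : ℕ → Graph → Graph → Set
SpinOf n G G′ = ∃[ p ] ∃[ u ] ∃[ v ]
  InV n p × InV n u × InV n v × Consecutive p u v ×
  Edge G p u × ¬ Edge G p v ×
  (∀ a b → Edge G′ a b ⇔ ((Edge G a b × ¬ SamePair a b p u) ⊎ SamePair a b p v))

SpinStep : ℕ → Graph → Graph → Set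
SpinStep n G G′ = IsSimplifiedGrove n G × IsSimplifiedGrove n G′ × SpinOf n G G′

{-# OPTIONS --safe #-}
module Submission where

-- Induction from size n to size n + 2 by star–triangle transformations. In barycentric
-- coordinates a grove S of size n + 2 has no edge along the sides, so all its edges lie in the
-- triangles `opp c`, c a vertex of size n. Replacing the forest inside each of these triangles
-- by a star with centre c gives a forest h on a hexagonal graph; replacing the stars around
-- the interior vertices of S by trees on triangles gives a grove g of size n, whose vertices are
-- the centres. No planarity is needed, because only two kinds of spins are used: exchanging an
-- edge of a triangle for the third one when two edges are present, and turning an interior leaf.
-- Each such spin of g lifts to a sequence of such spins of S, different S over the same g are
-- connected by such spins, and the target of size n + 2 lies over the target of size n.

-- No edge runs along a side because distinct vertices of one side are never connected. The two
-- kinds of spins are harmless for reasons valid in any graph: while the third edge of a triangle is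
-- present the other two are interchangeable, and a leaf lies on no path between other vertices.
-- That the leaf is interior keeps the boundary sets fixed. Neither transformation is one-to-one,
-- and this is the obstacle. Three marked vertices of a triangle admit three trees, and a triangle
-- without edges says only that some single vertex is marked, not which. Over a fixed `g`, the
-- choice of a tree in `S` is corrected by a triangle exchange, and the choice of the only centre
-- joined to an interior vertex by turning a leaf. The same freedom is used on purpose in lifting a
-- spin: it clears the surroundings of a leaf of `g`, or selects the spoke that is missing from the
-- hexagon into which a triangle `opp c` of `g` unfolds.

open import Defs hiding (r; l; ur; ul; dr; dl; UL; UR; R; DR; DL; L)
open import Data.Bool using (Bool; true; false; if_then_else_; _∧_; _∨_; not)
import Data.Bool.Properties as Bool
open import Data.Empty using (⊥; ⊥-elim)
open import Data.Integer as ℤ using (ℤ; +_; -_; _+_; _-_; ∣_∣; -[1+_])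
import Data.Integer.Divisibility as ℤD
open import Data.Integer.Divisibility.Signed using (_∣_; ∣ᵤ⇒∣; ∣⇒∣ᵤ; ∣m∣n⇒∣m-n; ∣m⇒∣-m; ∣m⇒∣m*n; ∣-refl)
import Data.Integer.Properties as ℤ
open import Data.Integer.Solver using (module +-*-Solver)
open import Data.List using (List; []; _∷_; [_]; _++_; map; upTo; cartesianProductWith)
open import Data.List.Membership.Propositional using (_∈_; find; lose)
open import Data.List.Membership.Propositional.Properties using (∈-cartesianProductWith⁺; ∈-upTo⁺; ∈-map⁻)
open import Data.List.Relation.Unary.All as All using (All; []; _∷_)
open import Data.List.Relation.Unary.All.Properties using (¬Any⇒All¬)
open import Data.List.Relation.Unary.AllPairs using ([]; _∷_)
open import Data.List.Relation.Unary.Any using (Any; here; there; any?)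
open import Data.List.Relation.Unary.Unique.Propositional using (Unique)
open import Data.Nat as ℕ using (ℕ; zero; suc; pred; _≤_; s≤s; z≤n; _<ᵇ_)
import Data.Nat.Divisibility as ℕD
open import Data.Nat.Properties using (suc-injective; ≤-total)
import Data.Nat.Properties as ℕ
import Data.Nat.Solver as ℕ
open import Data.Product using (Σ; ∃-syntax; _×_; _,_; proj₁; proj₂)
open import Data.Product.Properties using (≡-dec)
open import Data.Sum using (_⊎_; inj₁; inj₂; [_,_]′; swap)
open import Data.Unit using (tt)
open import Function.Bundles using (_⇔_; mk⇔; Equivalence)
open import Relation.Binary.Construct.Closure.ReflexiveTransitive using (Star; ε; _◅_; _◅◅_; gmap; reverse)
open import Relation.Binary.Definitions using (DecidableEquality)
open import Relation.Binary.PropositionalEquality using (_≡_; _≢_; refl; sym; trans; cong; cong₂; subst; subst₂)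
open import Relation.Nullary using (¬_; Dec; yes; no; does)
open import Relation.Nullary.Decidable using (map′; _×-dec_; _⊎-dec_; dec-true)

-- Forests in multigraphs, with connectivity through a set of edge indices

module MultiGraph {V I : Set} (src tgt : I → V) (_≟_ : DecidableEquality I) where

  Joins : I → V → V → Set
  Joins i u v = (u ≡ src i × v ≡ tgt i) ⊎ (u ≡ tgt i × v ≡ src i)

  Adj : (I → Set) → V → V → Set
  Adj P u v = ∃[ i ] P i × Joins i u v

  Conn : (I → Set) → V → V → Set
  Conn P = Star (Adj P)

  Without : (I → Set) → I → I → Set
  Without P i j = P j × j ≢ i

  Forest : (I → Set) → Set
  Forest P = ∀ i → P i → ¬ Conn (Without P i) (src i) (tgt i)

  joins-sym : ∀ {i u v} → Joins i u v → Joins i v u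
  joins-sym (inj₁ (p , q)) = inj₂ (q , p)
  joins-sym (inj₂ (p , q)) = inj₁ (q , p)

  conn-sym : ∀ {P u v} → Conn P u v → Conn P v u
  conn-sym = reverse λ (i , p , e) → i , p , joins-sym e

  conn-edge : ∀ {P u v} i → P i → Joins i u v → Conn P u v
  conn-edge i p e = (i , p , e) ◅ ε

  conn-bind : ∀ {P Q : I → Set} → (∀ i → P i → Conn Q (src i) (tgt i)) →
              ∀ {u v} → Conn P u v → Conn Q u v
  conn-bind f ε = ε
  conn-bind f ((i , p , inj₁ (refl , refl)) ◅ w) = f i p ◅◅ conn-bind f w
  conn-bind f ((i , p , inj₂ (refl , refl)) ◅ w) = conn-sym (f i p) ◅◅ conn-bind f w

  conn-mono : ∀ {P Q : I → Set} → (∀ i → P i → Q i) → ∀ {u v} → Conn P u v → Conn Q u v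
  conn-mono f = conn-bind λ i p → conn-edge i (f i p) (inj₁ (refl , refl))

  bridge : ∀ {P} → Forest P → ∀ {i u v} → P i → Joins i u v → ¬ Conn (Without P i) u v
  bridge F p (inj₁ (refl , refl)) w = F _ p w
  bridge F p (inj₂ (refl , refl)) w = F _ p (conn-sym w)

  -- Only the first and the last passage of the walk through `i` matter. In opposite directions they
  -- cancel, because both outer parts then end at the same endpoint of `i`; in the same direction
  -- they merge into one passage.
  detour : ∀ {P} i {u v} → Conn P u v → let Q = Without P i in
           Conn Q u v ⊎ (Conn Q u (src i) × Conn Q (tgt i) v) ⊎ (Conn Q u (tgt i) × Conn Q (src i) v)
  detour i ε = inj₁ ε
  detour i ((j , p , e) ◅ w) with j ≟ i | detour i w
  detour i ((j , p , e) ◅ w) | no j≢i | inj₁ a = inj₁ ((j , (p , j≢i) , e) ◅ a)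
  detour i ((j , p , e) ◅ w) | no j≢i | inj₂ (inj₁ (a , b)) = inj₂ (inj₁ ((j , (p , j≢i) , e) ◅ a , b))
  detour i ((j , p , e) ◅ w) | no j≢i | inj₂ (inj₂ (a , b)) = inj₂ (inj₂ ((j , (p , j≢i) , e) ◅ a , b))
  detour i ((j , p , inj₁ (refl , refl)) ◅ w) | yes refl | inj₁ a = inj₂ (inj₁ (ε , a))
  detour i ((j , p , inj₁ (refl , refl)) ◅ w) | yes refl | inj₂ (inj₁ (a , b)) = inj₂ (inj₁ (ε , b))
  detour i ((j , p , inj₁ (refl , refl)) ◅ w) | yes refl | inj₂ (inj₂ (a , b)) = inj₁ b
  detour i ((j , p , inj₂ (refl , refl)) ◅ w) | yes refl | inj₁ a = inj₂ (inj₂ (ε , a))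
  detour i ((j , p , inj₂ (refl , refl)) ◅ w) | yes refl | inj₂ (inj₁ (a , b)) = inj₁ b
  detour i ((j , p , inj₂ (refl , refl)) ◅ w) | yes refl | inj₂ (inj₂ (a , b)) = inj₂ (inj₂ (ε , b))

  forest-sub : ∀ {P Q : I → Set} → (∀ j → Q j → P j) → Forest P → Forest Q
  forest-sub f F i q w = F i (f i q) (conn-mono (λ j (r , ne) → f j r , ne) w)

  -- A cycle through `i` that also used `y` would, after deleting `y`, be a connection in `P`
  -- between the ends of `y`, with `i` as one of its edges.
  forest-insert : ∀ {P Q : I → Set} y → Forest P → ¬ Conn P (src y) (tgt y) →
                  (∀ j → Q j → P j ⊎ j ≡ y) → Forest Q
  forest-insert {P} {Q} y F ¬c f i q w with i ≟ y
  ... | yes refl = ¬c (conn-mono (λ j (r , ne) → [ (λ p → p) , (λ e → ⊥-elim (ne e)) ]′ (f j r)) w)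
  ... | no i≢y = go (detour y w)
    where
    Pi : P i
    Pi = [ (λ p → p) , (λ e → ⊥-elim (i≢y e)) ]′ (f i q)
    weaken : ∀ {u v} → Conn (Without (Without Q i) y) u v → Conn (Without P i) u v
    weaken = conn-mono λ j ((r , ne) , ne′) → [ (λ p → p) , (λ e → ⊥-elim (ne′ e)) ]′ (f j r) , ne
    weaken′ : ∀ {u v} → Conn (Without (Without Q i) y) u v → Conn P u v
    weaken′ c = conn-mono (λ _ → proj₁) (weaken c)
    go : _ → ⊥
    go (inj₁ a) = F i Pi (weaken a)
    go (inj₂ (inj₁ (a , b))) =
      ¬c (conn-sym (weaken′ a) ◅◅ conn-edge i Pi (inj₁ (refl , refl)) ◅◅ conn-sym (weaken′ b))
    go (inj₂ (inj₂ (a , b))) =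
      ¬c (weaken′ b ◅◅ conn-edge i Pi (inj₂ (refl , refl)) ◅◅ weaken′ a)

  conn-first : ∀ {P u v} → Conn P u v → u ≢ v → ∃[ i ] P i × ∃[ w ] Joins i u w
  conn-first ε ne = ⊥-elim (ne refl)
  conn-first ((i , p , e) ◅ _) _ = i , p , _ , e

  Isolated : (I → Set) → V → Set
  Isolated P p = ∀ i → P i → ∀ q → ¬ Joins i p q

  record Exchange (P P′ : I → Set) (x y : I) (p u v : V) : Set where
    field
      has-x  : P x
      has-y  : P′ y
      x-ends : Joins x p u
      y-ends : Joins y p v
      keep   : ∀ j → P j → j ≢ x → P′ j
      back   : ∀ j → P′ j → (P j × j ≢ x) ⊎ j ≡ y
      not-y  : ¬ P y

  module _ {P P′ : I → Set} {x y : I} {p u v : V} (E : Exchange P P′ x y p u v) where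
    open Exchange E

    exchange-forest : Forest P → ¬ Conn (Without P x) p v → Forest P′
    exchange-forest F ¬c =
      forest-insert y (forest-sub (λ _ → proj₁) F) (λ c → ¬c (end y-ends c)) back
      where
      end : ∀ {a b} → Joins y a b → Conn (Without P x) (src y) (tgt y) → Conn (Without P x) a b
      end (inj₁ (refl , refl)) c = c
      end (inj₂ (refl , refl)) c = conn-sym c

    exchange-inverse : Exchange P′ P y x p v u
    exchange-inverse = record
      { has-x = has-y ; has-y = has-x ; x-ends = y-ends ; y-ends = x-ends
      ; keep = λ j q ne → [ proj₁ , (λ e → ⊥-elim (ne e)) ]′ (back j q)
      ; back = λ j q → back′ j q (j ≟ x)
      ; not-y = λ q → [ (λ r → proj₂ r refl) , (λ { refl → not-y has-x }) ]′ (back x q) }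
      where
      back′ : ∀ j → P j → Dec (j ≡ x) → (P′ j × j ≢ y) ⊎ j ≡ x
      back′ j q (yes e) = inj₂ e
      back′ j q (no ne) = inj₁ (keep j q ne , λ { refl → not-y q })

    -- The lost edge from `p` to `u` is replaced by the new edge from `p` to `v` followed by the
    -- assumed connection.
    exchange-swap-conn : Conn P′ u v → ∀ {a b} → Conn P a b → Conn P′ a b
    exchange-swap-conn c = conn-bind λ j q → edge j q (j ≟ x)
      where
      edge : ∀ j → P j → Dec (j ≡ x) → Conn P′ (src j) (tgt j)
      edge j q (no ne) = conn-edge j (keep j q ne) (inj₁ (refl , refl))
      edge j q (yes refl) = flip x-ends (conn-edge y has-y y-ends ◅◅ conn-sym c)
        where
        flip : ∀ {a b} → Joins x a b → Conn P′ a b → Conn P′ (src x) (tgt x)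
        flip (inj₁ (refl , refl)) w = w
        flip (inj₂ (refl , refl)) w = conn-sym w

    -- A walk between other vertices that used `x` would have to reach or leave `p` by an edge
    -- different from `x`, and there is none.
    exchange-leaf-conn : Isolated (Without P x) p →
                         ∀ {a b} → a ≢ p → b ≢ p → Conn P a b → Conn P′ a b
    exchange-leaf-conn iso {a} {b} a≢p b≢p w = go x-ends (detour x w)
      where
      stuck : ∀ {a q} → a ≢ p → q ≡ p → ¬ Conn (Without P x) a q
      stuck ne refl c with conn-first (conn-sym c) (λ e → ne (sym e))
      ... | i , r , q , e = iso i r q e
      relax : ∀ {a b} → Conn (Without P x) a b → Conn P′ a b
      relax = conn-mono λ j (q , ne) → keep j q ne
      go : ∀ {u} → Joins x p u → _ → Conn P′ a b
      go _ (inj₁ c) = relax c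
      go (inj₁ (e , _)) (inj₂ (inj₁ (c , _))) = ⊥-elim (stuck a≢p (sym e) c)
      go (inj₁ (e , _)) (inj₂ (inj₂ (_ , c))) = ⊥-elim (stuck b≢p (sym e) (conn-sym c))
      go (inj₂ (e , _)) (inj₂ (inj₁ (_ , c))) = ⊥-elim (stuck b≢p (sym e) (conn-sym c))
      go (inj₂ (e , _)) (inj₂ (inj₂ (c , _))) = ⊥-elim (stuck a≢p (sym e) c)

-- Vertices, edges and moves in barycentric coordinates

data Corner : Set where
  west east south : Corner

corners : ∀ {P : Corner → Set} → P west → P east → P south → ∀ k → P k
corners p q r west = p
corners p q r east = q
corners p q r south = r

-- toW, toE and toS are the distances from the sides facing the western, eastern and southern
-- corner; the cells of size n are the vertices of the region of size n.
record Cell : Set where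
  constructor ⟨_,_,_⟩
  field
    toW toE toS : ℕ
open Cell

coord : Corner → Cell → ℕ
coord west  = toW
coord east  = toE
coord south = toS

size : Cell → ℕ
size ⟨ a , b , c ⟩ = a ℕ.+ b ℕ.+ c

inc : Corner → Cell → Cell
inc west  ⟨ a , b , c ⟩ = ⟨ suc a , b , c ⟩
inc east  ⟨ a , b , c ⟩ = ⟨ a , suc b , c ⟩
inc south ⟨ a , b , c ⟩ = ⟨ a , b , suc c ⟩

full : Cell → Cell
full ⟨ a , b , c ⟩ = ⟨ suc a , suc b , suc c ⟩

-- Naming the corners in an arbitrary order lets each geometric argument be carried out once instead
-- of six times.
data Perm : Corner → Corner → Corner → Set where
  wes : Perm west east south
  wse : Perm west south east
  ews : Perm east west south
  esw : Perm east south west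
  swe : Perm south west east
  sew : Perm south east west

swap₁₂ : ∀ {i j k} → Perm i j k → Perm j i k
swap₁₂ wes = ews
swap₁₂ wse = swe
swap₁₂ ews = wes
swap₁₂ esw = sew
swap₁₂ swe = wse
swap₁₂ sew = esw

rotate : ∀ {i j k} → Perm i j k → Perm j k i
rotate wes = esw
rotate wse = sew
rotate ews = wse
rotate esw = swe
rotate swe = wes
rotate sew = ews

swap₂₃ : ∀ {i j k} → Perm i j k → Perm i k j
swap₂₃ π = rotate (swap₁₂ π)

swap₁₃ : ∀ {i j k} → Perm i j k → Perm k j i
swap₁₃ π = swap₁₂ (rotate π)

perm-≢ : ∀ {i j k} → Perm i j k → i ≢ j
perm-≢ wes ()
perm-≢ wse ()
perm-≢ ews ()
perm-≢ esw ()
perm-≢ swe ()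
perm-≢ sew ()

completeTo : ∀ k → ∃[ i ] ∃[ j ] Perm i j k
completeTo west  = _ , _ , esw
completeTo east  = _ , _ , wse
completeTo south = _ , _ , wes

complete : ∀ {i j} → i ≢ j → ∃[ k ] Perm i j k
complete {west}  {west}  ne = ⊥-elim (ne refl)
complete {west}  {east}  ne = _ , wes
complete {west}  {south} ne = _ , wse
complete {east}  {west}  ne = _ , ews
complete {east}  {east}  ne = ⊥-elim (ne refl)
complete {east}  {south} ne = _ , esw
complete {south} {west}  ne = _ , swe
complete {south} {east}  ne = _ , sew
complete {south} {south} ne = ⊥-elim (ne refl)

data OneOf (i j k : Corner) : Corner → Set where
  fst : OneOf i j k i
  snd : OneOf i j k j
  thd : OneOf i j k k

oneOf : ∀ {i j k} → Perm i j k → ∀ l → OneOf i j k l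
oneOf wes west = fst
oneOf wes east = snd
oneOf wes south = thd
oneOf wse west = fst
oneOf wse south = snd
oneOf wse east = thd
oneOf ews east = fst
oneOf ews west = snd
oneOf ews south = thd
oneOf esw east = fst
oneOf esw south = snd
oneOf esw west = thd
oneOf swe south = fst
oneOf swe west = snd
oneOf swe east = thd
oneOf sew south = fst
oneOf sew east = snd
oneOf sew west = thd

_≟ᶜ_ : DecidableEquality Corner
west ≟ᶜ west = yes refl
west ≟ᶜ east = no λ ()
west ≟ᶜ south = no λ ()
east ≟ᶜ west = no λ ()
east ≟ᶜ east = yes refl
east ≟ᶜ south = no λ ()
south ≟ᶜ west = no λ ()
south ≟ᶜ east = no λ ()
south ≟ᶜ south = yes refl

_≟ᶠ_ : DecidableEquality Cell
⟨ a , b , c ⟩ ≟ᶠ ⟨ a′ , b′ , c′ ⟩ =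
  map′ (λ { (refl , refl , refl) → refl }) (λ { refl → refl , refl , refl })
       ((a ℕ.≟ a′) ×-dec (b ℕ.≟ b′) ×-dec (c ℕ.≟ c′))

inc-injective : ∀ k {x y} → inc k x ≡ inc k y → x ≡ y
inc-injective west refl = refl
inc-injective east refl = refl
inc-injective south refl = refl

inc-comm : ∀ i j x → inc i (inc j x) ≡ inc j (inc i x)
inc-comm west west x = refl
inc-comm west east x = refl
inc-comm west south x = refl
inc-comm east west x = refl
inc-comm east east x = refl
inc-comm east south x = refl
inc-comm south west x = refl
inc-comm south east x = refl
inc-comm south south x = refl

inc-≢ : ∀ {i j k x} → Perm i j k → inc i x ≢ inc j x
inc-≢ wes ()
inc-≢ wse ()
inc-≢ ews ()
inc-≢ esw ()
inc-≢ swe ()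
inc-≢ sew ()

size-inc : ∀ k x → size (inc k x) ≡ suc (size x)
size-inc west x = refl
size-inc east ⟨ a , b , c ⟩ = cong (ℕ._+ c) (ℕ.+-suc a b)
size-inc south ⟨ a , b , c ⟩ = ℕ.+-suc (a ℕ.+ b) c

dec-view : ∀ k x → coord k x ≢ 0 → ∃[ y ] x ≡ inc k y
dec-view west  ⟨ zero , _ , _ ⟩ ne = ⊥-elim (ne refl)
dec-view west  ⟨ suc a , b , c ⟩ ne = ⟨ a , b , c ⟩ , refl
dec-view east  ⟨ _ , zero , _ ⟩ ne = ⊥-elim (ne refl)
dec-view east  ⟨ a , suc b , c ⟩ ne = ⟨ a , b , c ⟩ , refl
dec-view south ⟨ _ , _ , zero ⟩ ne = ⊥-elim (ne refl)
dec-view south ⟨ a , b , suc c ⟩ ne = ⟨ a , b , c ⟩ , refl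

coord-inc-≢0 : ∀ k x → coord k (inc k x) ≢ 0
coord-inc-≢0 west x ()
coord-inc-≢0 east x ()
coord-inc-≢0 south x ()

coord-inc : ∀ {i j k} → Perm i j k → ∀ x → coord i (inc j x) ≡ coord i x
coord-inc wes x = refl
coord-inc wse x = refl
coord-inc ews x = refl
coord-inc esw x = refl
coord-inc swe x = refl
coord-inc sew x = refl

-- (t , k) is the edge joining inc i t and inc j t, where i and j are the other two corners.
Slot : Set
Slot = Cell × Corner

_≟_ : DecidableEquality Slot
_≟_ = ≡-dec _≟ᶠ_ _≟ᶜ_

State : Set
State = Slot → Bool

source sink : Slot → Cell
source (t , west)  = inc east t
source (t , east)  = inc south t
source (t , south) = inc west t
sink (t , west)  = inc south t
sink (t , east)  = inc west t
sink (t , south) = inc east t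

open MultiGraph source sink _≟_ public

joins-perm : ∀ {i j k} → Perm i j k → ∀ t → Joins (t , k) (inc i t) (inc j t)
joins-perm wes t = inj₁ (refl , refl)
joins-perm wse t = inj₂ (refl , refl)
joins-perm ews t = inj₂ (refl , refl)
joins-perm esw t = inj₁ (refl , refl)
joins-perm swe t = inj₁ (refl , refl)
joins-perm sew t = inj₂ (refl , refl)

joins-inv : ∀ {t k u v} → Joins (t , k) u v → ∃[ i ] ∃[ j ] Perm i j k × u ≡ inc i t × v ≡ inc j t
joins-inv {k = west}  (inj₁ (p , q)) = _ , _ , esw , p , q
joins-inv {k = west}  (inj₂ (p , q)) = _ , _ , sew , p , q
joins-inv {k = east}  (inj₁ (p , q)) = _ , _ , swe , p , q
joins-inv {k = east}  (inj₂ (p , q)) = _ , _ , wse , p , q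
joins-inv {k = south} (inj₁ (p , q)) = _ , _ , wes , p , q
joins-inv {k = south} (inj₂ (p , q)) = _ , _ , ews , p , q

On : ℕ → State → Slot → Set
On n S (t , k) = suc (size t) ≡ n × S (t , k) ≡ true

-- `big t` is a triangle oriented like the whole region, `opp c` one of the opposite orientation;
-- edge k of a triangle is the one facing vertex k.
data Triangle : Set where
  big opp : Cell → Triangle

level : Triangle → ℕ
level (big t) = suc (size t)
level (opp c) = suc (suc (size c))

edge : Triangle → Corner → Slot
edge (big t) k = t , k
edge (opp c) k = inc k c , k

oppVertex : Corner → Cell → Cell
oppVertex west  ⟨ a , b , c ⟩ = ⟨ a , suc b , suc c ⟩
oppVertex east  ⟨ a , b , c ⟩ = ⟨ suc a , b , suc c ⟩
oppVertex south ⟨ a , b , c ⟩ = ⟨ suc a , suc b , c ⟩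

vertex : Triangle → Corner → Cell
vertex (big t) k = inc k t
vertex (opp c) k = oppVertex k c

oppVertex-perm : ∀ {i j k} → Perm i j k → ∀ c → oppVertex k c ≡ inc i (inc j c)
oppVertex-perm wes c = refl
oppVertex-perm wse c = refl
oppVertex-perm ews c = refl
oppVertex-perm esw c = refl
oppVertex-perm swe c = refl
oppVertex-perm sew c = refl

oppVertex-inc : ∀ k t → oppVertex k (inc k t) ≡ full t
oppVertex-inc west t = refl
oppVertex-inc east t = refl
oppVertex-inc south t = refl

inc-oppVertex : ∀ k c → inc k (oppVertex k c) ≡ full c
inc-oppVertex west c = refl
inc-oppVertex east c = refl
inc-oppVertex south c = refl

oppVertex-injective : ∀ k {c c′} → oppVertex k c ≡ oppVertex k c′ → c ≡ c′
oppVertex-injective west refl = refl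
oppVertex-injective east refl = refl
oppVertex-injective south refl = refl

edge-joins : ∀ τ {i j k} → Perm i j k → Joins (edge τ k) (vertex τ i) (vertex τ j)
edge-joins (big t) π = joins-perm π t
edge-joins (opp c) wes = inj₂ (refl , refl)
edge-joins (opp c) wse = inj₁ (refl , refl)
edge-joins (opp c) ews = inj₁ (refl , refl)
edge-joins (opp c) esw = inj₂ (refl , refl)
edge-joins (opp c) swe = inj₂ (refl , refl)
edge-joins (opp c) sew = inj₁ (refl , refl)

edge-level : ∀ τ k → suc (size (proj₁ (edge τ k))) ≡ level τ
edge-level (big t) k = refl
edge-level (opp c) k = cong suc (size-inc k c)

edge-≢ : ∀ τ {i j k} → Perm i j k → edge τ i ≢ edge τ j
edge-≢ (big t) π e = perm-≢ π (cong proj₂ e)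
edge-≢ (opp c) π e = perm-≢ π (cong proj₂ e)

edge-on : ∀ {n S} τ k → level τ ≡ n → S (edge τ k) ≡ true → On n S (edge τ k)
edge-on τ k l s = trans (edge-level τ k) l , s

on≢off : ∀ {a : Bool} → a ≡ true → ¬ a ≡ false
on≢off refl ()

record Moved (S S′ : State) (x y : Slot) : Set where
  field
    off  : S′ x ≡ false
    on   : S′ y ≡ true
    rest : ∀ z → z ≢ x → z ≢ y → S′ z ≡ S z

set : State → Slot → Bool → State
set S x b z = if does (z ≟ x) then b else S z

set-at : ∀ S x b → set S x b x ≡ b
set-at S x b with x ≟ x
... | yes _ = refl
... | no ne = ⊥-elim (ne refl)

set-off : ∀ S x b {z} → z ≢ x → set S x b z ≡ S z
set-off S x b {z} ne with z ≟ x
... | yes e = ⊥-elim (ne e)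
... | no _ = refl

abstract
  move : ∀ S {x y} → x ≢ y → ∃[ S′ ] Moved S S′ x y
  move S {x} {y} ne = set S₁ y true , record
    { off = trans (set-off S₁ y true ne) (set-at S x false)
    ; on = set-at S₁ y true
    ; rest = λ z ≢x ≢y → trans (set-off S₁ y true ≢y) (set-off S x false ≢x) }
    where
    S₁ : State
    S₁ = set S x false

Interior : Cell → Set
Interior p = ∀ k → coord k p ≢ 0

Free : State → Cell → Slot → Set
Free S p x = ∀ z → S z ≡ true → ∀ q → Joins z p q → z ≡ x

-- The pivot is vertex j. Either the third edge of the triangle is present, or the pivot is an
-- interior leaf; both make the move harmless for connectivity and acyclicity.
data Step (n : ℕ) (S S′ : State) : Set where
  step : ∀ τ {i j k} → Perm i j k → level τ ≡ n →
         S (edge τ i) ≡ true → S (edge τ k) ≡ false → Moved S S′ (edge τ i) (edge τ k) →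
         S (edge τ j) ≡ true ⊎ (Interior (vertex τ j) × Free S (vertex τ j) (edge τ i)) →
         Step n S S′

-- The arguments are the coordinates belonging to `i`, `j` and `k`. Thus `cell π m 0 d` and
-- `cell π m d 0` are mirror images in the median from corner `i`.
cell : ∀ {i j k} → Perm i j k → ℕ → ℕ → ℕ → Cell
cell wes a b c = ⟨ a , b , c ⟩
cell wse a c b = ⟨ a , b , c ⟩
cell ews b a c = ⟨ a , b , c ⟩
cell esw b c a = ⟨ a , b , c ⟩
cell swe c a b = ⟨ a , b , c ⟩
cell sew c b a = ⟨ a , b , c ⟩

-- Every boundary set meets at least two sides, so any two sets meet a common side; separation is
-- therefore asked only of vertices on the same side. In `paired`, `d = 0` is a corner and `d = m`
-- gives the middle triplet. Unlike `IsSimplifiedGrove`, where the boundary sets collide for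
-- `n = 0`, these conditions make sense in size 0, which the induction reaches.
record Grove (n : ℕ) (S : State) : Set where
  field
    forest : Forest (On n S)
    paired : ∀ {i j k} (π : Perm i j k) m d → d ≤ m → d ℕ.+ m ≡ n →
             Conn (On n S) (cell π m 0 d) (cell π m d 0)
    separated : ∀ k x y → size x ≡ n → size y ≡ n → coord k x ≡ 0 → coord k y ≡ 0 →
                Conn (On n S) x y → x ≡ y
    covers : ∀ x → size x ≡ n → ∃[ y ] ∃[ k ] size y ≡ n × coord k y ≡ 0 × Conn (On n S) x y

-- `Moving` is empty for a triangle exchange and consists of the pivot for a leaf turn. This common
-- form serves twice, for groves of states and for simplified groves in the plane. The field
-- `anchor` lets a turned leaf inherit its covering boundary vertex from its new neighbour.
record SameConn (n : ℕ) (S S′ : State) (Moving : Cell → Set) : Set where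
  field
    forest′ : Forest (On n S) → Forest (On n S′)
    to      : ∀ {a b} → ¬ Moving a → ¬ Moving b → Conn (On n S) a b → Conn (On n S′) a b
    from    : ∀ {a b} → ¬ Moving a → ¬ Moving b → Conn (On n S′) a b → Conn (On n S) a b
    moving? : ∀ a → Dec (Moving a)
    interior : ∀ {a} → Moving a → Interior a
    anchor  : ∀ {a} → Moving a → ∃[ b ] ¬ Moving b × size b ≡ n × Conn (On n S′) a b

vertex-≢ : ∀ τ {i j k} → Perm i j k → vertex τ i ≢ vertex τ j
vertex-≢ (big t) π = inc-≢ π
vertex-≢ (opp c) wes ()
vertex-≢ (opp c) wse ()
vertex-≢ (opp c) ews ()
vertex-≢ (opp c) esw ()
vertex-≢ (opp c) swe ()
vertex-≢ (opp c) sew ()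

vertex-size : ∀ τ k → size (vertex τ k) ≡ level τ
vertex-size (big t) k = size-inc k t
vertex-size (opp c) west = trans (size-inc east (inc south c)) (cong suc (size-inc south c))
vertex-size (opp c) east = trans (size-inc west (inc south c)) (cong suc (size-inc south c))
vertex-size (opp c) south = trans (size-inc west (inc east c)) (cong suc (size-inc east c))

module _ {n S S′} τ {i j k} (π : Perm i j k) (lv : level τ ≡ n)
         (on-i : S (edge τ i) ≡ true) (off-k : S (edge τ k) ≡ false)
         (M : Moved S S′ (edge τ i) (edge τ k)) where
  open Moved M

  step-exchange : Exchange (On n S) (On n S′) (edge τ i) (edge τ k) (vertex τ j) (vertex τ k) (vertex τ i)
  step-exchange = record
    { has-x = edge-on {S = S} τ i lv on-i
    ; has-y = edge-on {S = S′} τ k lv on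
    ; x-ends = edge-joins τ (rotate π)
    ; y-ends = edge-joins τ (swap₁₂ π)
    ; keep = keep
    ; back = back
    ; not-y = λ (_ , o) → on≢off o off-k }
    where
    keep : ∀ z → On n S z → z ≢ edge τ i → On n S′ z
    keep z (l , o) ne = l , trans (rest z ne λ { refl → on≢off o off-k }) o
    back : ∀ z → On n S′ z → (On n S z × z ≢ edge τ i) ⊎ z ≡ edge τ k
    back z (l , o) with z ≟ edge τ k
    ... | yes e = inj₂ e
    ... | no ne = inj₁ ((l , trans (sym (rest z ≢x ne)) o) , ≢x)
      where
      ≢x : z ≢ edge τ i
      ≢x refl = on≢off o off

step-conn : ∀ {n S S′} → Step n S S′ → ∃[ Moving ] SameConn n S S′ Moving
step-conn {n} {S} {S′} (step τ {i} {j} {k} π lv on-i off-k M (inj₁ on-j)) = (λ _ → ⊥) , record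
  -- A connection from vertex `j` to vertex `i` without edge `i`, prolonged by edge `j` to vertex
  -- `k`, would close a cycle with edge `i`.
  { forest′ = λ F → exchange-forest E F λ c →
      bridge F (edge-on {S = S} τ i lv on-i) (edge-joins τ (rotate π)) (c ◅◅ conn-edge (edge τ j)
        (edge-on {S = S} τ j lv on-j , edge-≢ τ (swap₁₂ π)) (edge-joins τ (swap₂₃ π)))
  ; to = λ _ _ → exchange-swap-conn E (conn-edge (edge τ j) (edge-on {S = S′} τ j lv on-j′) (edge-joins τ (rotate (rotate π))))
  ; from = λ _ _ → exchange-swap-conn (exchange-inverse E) (conn-edge (edge τ j) (edge-on {S = S} τ j lv on-j) (edge-joins τ (swap₂₃ π)))
  ; moving? = λ _ → no λ ()
  ; interior = λ ()
  ; anchor = λ () }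
  where
  E = step-exchange {n} {S} {S′} τ π lv on-i off-k M
  on-j′ : S′ (edge τ j) ≡ true
  on-j′ = trans (Moved.rest M _ (edge-≢ τ (swap₁₂ π)) (edge-≢ τ (rotate π))) on-j
step-conn {n} {S} {S′} (step τ {i} {j} {k} π lv on-i off-k M (inj₂ (int , free))) = (_≡ vertex τ j) , record
  { forest′ = λ F → exchange-forest E F λ c → stuck c
  ; to = exchange-leaf-conn E iso
  ; from = exchange-leaf-conn (exchange-inverse E) iso′
  ; moving? = λ a → a ≟ᶠ vertex τ j
  ; interior = λ { refl → int }
  ; anchor = λ { refl → vertex τ i , vertex-≢ τ π , trans (vertex-size τ i) lv ,
      conn-edge (edge τ k) (Exchange.has-y E) (Exchange.y-ends E) } }
  where
  E = step-exchange {n} {S} {S′} τ π lv on-i off-k M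
  iso : Isolated (Without (On n S) (edge τ i)) (vertex τ j)
  iso z ((_ , o) , ne) q e = ne (free z o q e)
  iso′ : Isolated (Without (On n S′) (edge τ k)) (vertex τ j)
  iso′ z (o , ne) q e with Exchange.back E z o
  ... | inj₁ (o′ , ne′) = iso z (o′ , ne′) q e
  ... | inj₂ e′ = ne e′
  stuck : ¬ Conn (Without (On n S) (edge τ i)) (vertex τ j) (vertex τ i)
  stuck c with conn-first c (vertex-≢ τ (swap₁₂ π))
  ... | z , o , q , e = iso z o q e

cell-coord : ∀ {i j k} (π : Perm i j k) a b c → coord j (cell π a b c) ≡ b × coord k (cell π a b c) ≡ c
cell-coord wes a b c = refl , refl
cell-coord wse a b c = refl , refl
cell-coord ews a b c = refl , refl
cell-coord esw a b c = refl , refl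
cell-coord swe a b c = refl , refl
cell-coord sew a b c = refl , refl

step-grove : ∀ {n S S′} → Step n S S′ → Grove n S → Grove n S′
step-grove {n} {S} {S′} st G with step-conn st
... | Moving , same = record
  { forest = forest′ forest
  ; paired = λ {_} {j} {k} π m d d≤m e →
      to (bd j (proj₁ (cell-coord π m 0 d))) (bd k (proj₂ (cell-coord π m d 0))) (paired π m d d≤m e)
  ; separated = λ k x y sx sy cx cy c → separated k x y sx sy cx cy (from (bd k cx) (bd k cy) c)
  ; covers = covers′ }
  where
  open SameConn same
  open Grove G
  bd : ∀ k {x} → coord k x ≡ 0 → ¬ Moving x
  bd k e m = interior m k e
  still : ∀ x → size x ≡ n → ¬ Moving x → ∃[ y ] ∃[ k ] size y ≡ n × coord k y ≡ 0 × Conn (On n S′) x y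
  still x sx nm with covers x sx
  ... | y , k , sy , cy , c = y , k , sy , cy , to nm (bd k cy) c
  covers′ : ∀ x → size x ≡ n → ∃[ y ] ∃[ k ] size y ≡ n × coord k y ≡ 0 × Conn (On n S′) x y
  covers′ x sx with moving? x
  ... | no nm = still x sx nm
  ... | yes m with anchor m
  ...   | b , nm , sb , c with still b sb nm
  ...     | y , k , sy , cy , c′ = y , k , sy , cy , c ◅◅ c′

steps-grove : ∀ {n S S′} → Star (Step n) S S′ → Grove n S → Grove n S′
steps-grove ε G = G
steps-grove (st ◅ sts) G = steps-grove sts (step-grove st G)

-- Triangle–star transformations

-- `Loc a₁ a₂ a₃ b₁ b₂ b₃`: the edges aᵢ of a triangle (aᵢ faces vertex i) form a spanning tree
-- of the nonempty set of vertices marked by b.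
data Loc : (a₁ a₂ a₃ b₁ b₂ b₃ : Bool) → Set where
  one₁ : Loc false false false true  false false
  one₂ : Loc false false false false true  false
  one₃ : Loc false false false false false true
  two₁ : Loc true  false false false true  true
  two₂ : Loc false true  false true  false true
  two₃ : Loc false false true  true  true  false
  all₁ : Loc false true  true  true  true  true
  all₂ : Loc true  false true  true  true  true
  all₃ : Loc true  true  false true  true  true

LocAt : (a b : Corner → Bool) → Set
LocAt a b = Loc (a west) (a east) (a south) (b west) (b east) (b south)

loc-swap : ∀ {a₁ a₂ a₃ b₁ b₂ b₃} → Loc a₁ a₂ a₃ b₁ b₂ b₃ → Loc a₂ a₁ a₃ b₂ b₁ b₃
loc-swap one₁ = one₂
loc-swap one₂ = one₁
loc-swap one₃ = one₃
loc-swap two₁ = two₂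
loc-swap two₂ = two₁
loc-swap two₃ = two₃
loc-swap all₁ = all₂
loc-swap all₂ = all₁
loc-swap all₃ = all₃

loc-rotate : ∀ {a₁ a₂ a₃ b₁ b₂ b₃} → Loc a₁ a₂ a₃ b₁ b₂ b₃ → Loc a₂ a₃ a₁ b₂ b₃ b₁
loc-rotate one₁ = one₃
loc-rotate one₂ = one₁
loc-rotate one₃ = one₂
loc-rotate two₁ = two₃
loc-rotate two₂ = two₁
loc-rotate two₃ = two₂
loc-rotate all₁ = all₃
loc-rotate all₂ = all₁
loc-rotate all₃ = all₂

-- The table `Loc` is invariant under relabelling the three vertices. The lemmas about it below
-- treat one labelling each, and `loc-view` and `loc-pack` translate.
loc-view : ∀ {a b i j k} → Perm i j k → LocAt a b → Loc (a i) (a j) (a k) (b i) (b j) (b k)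
loc-view wes l = l
loc-view wse l = loc-rotate (loc-swap l)
loc-view ews l = loc-swap l
loc-view esw l = loc-rotate l
loc-view swe l = loc-rotate (loc-rotate l)
loc-view sew l = loc-swap (loc-rotate l)

loc-pack : ∀ {a b i j k} → Perm i j k → Loc (a i) (a j) (a k) (b i) (b j) (b k) → LocAt a b
loc-pack wes l = l
loc-pack wse l = loc-rotate (loc-swap l)
loc-pack ews l = loc-swap l
loc-pack esw l = loc-rotate (loc-rotate l)
loc-pack swe l = loc-rotate l
loc-pack sew l = loc-swap (loc-rotate l)

loc-≡ : ∀ {a₁ a₂ a₃ b₁ b₂ b₃ a₁′ a₂′ a₃′ b₁′ b₂′ b₃′} →
        a₁′ ≡ a₁ → a₂′ ≡ a₂ → a₃′ ≡ a₃ → b₁′ ≡ b₁ → b₂′ ≡ b₂ → b₃′ ≡ b₃ →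
        Loc a₁ a₂ a₃ b₁ b₂ b₃ → Loc a₁′ a₂′ a₃′ b₁′ b₂′ b₃′
loc-≡ refl refl refl refl refl refl l = l

locAt-≡ : ∀ {a b a′ b′} → (∀ k → a′ k ≡ a k) → (∀ k → b′ k ≡ b k) → LocAt a b → LocAt a′ b′
locAt-≡ p q = loc-≡ (p west) (p east) (p south) (q west) (q east) (q south)

loc-ends : ∀ {a₁ a₂ a₃ b₁ b₂ b₃} → Loc a₁ a₂ a₃ b₁ b₂ b₃ → a₃ ≡ true → b₁ ≡ true × b₂ ≡ true
loc-ends two₃ refl = refl , refl
loc-ends all₁ refl = refl , refl
loc-ends all₂ refl = refl , refl

loc-noEdge : ∀ {a₁ a₂ a₃ b₁ b₂ b₃} → Loc a₁ a₂ a₃ b₁ b₂ b₃ → b₁ ≡ false → a₂ ≡ false × a₃ ≡ false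
loc-noEdge one₂ refl = refl , refl
loc-noEdge one₃ refl = refl , refl
loc-noEdge two₁ refl = refl , refl

loc-linked : ∀ {a₁ a₂ a₃ b₁ b₂ b₃} → Loc a₁ a₂ a₃ b₁ b₂ b₃ → b₁ ≡ true → b₂ ≡ true →
             a₃ ≡ true ⊎ (a₁ ≡ true × a₂ ≡ true)
loc-linked two₃ refl refl = inj₁ refl
loc-linked all₁ refl refl = inj₁ refl
loc-linked all₂ refl refl = inj₁ refl
loc-linked all₃ refl refl = inj₂ (refl , refl)

-- Edge 3 without edge 2 makes vertex 1 a leaf hanging from vertex 2, the shape in which `loc-prune`
-- can cut it off.
loc-leafTree : ∀ {a₁ a₂ a₃ b₁ b₂ b₃} → Loc a₁ a₂ a₃ b₁ b₂ b₃ → b₁ ≡ true → b₂ ≡ true →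
               ∃[ a ] Loc a false true b₁ b₂ b₃
loc-leafTree two₃ refl refl = _ , two₃
loc-leafTree all₁ refl refl = _ , all₂
loc-leafTree all₂ refl refl = _ , all₂
loc-leafTree all₃ refl refl = _ , all₂

loc-prune : ∀ {a₁ a₂ a₃ b₁ b₂ b₃} → Loc a₁ a₂ a₃ b₁ b₂ b₃ → a₃ ≡ true → a₂ ≡ false →
            Loc a₁ false false false b₂ b₃
loc-prune two₃ refl refl = one₂
loc-prune all₂ refl refl = two₁

loc-graft : ∀ {a₁ a₂ a₃ b₁ b₂ b₃} → Loc a₁ a₂ a₃ b₁ b₂ b₃ → b₁ ≡ false → b₂ ≡ true →
            Loc a₁ a₂ true true b₂ b₃
loc-graft one₂ refl refl = two₃
loc-graft two₁ refl refl = all₂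

loc-other : ∀ {a₁ a₂ a₃ b₁ b₂ b₃} → Loc a₁ a₂ a₃ b₁ b₂ b₃ → b₁ ≡ false → b₂ ≡ true ⊎ b₃ ≡ true
loc-other one₂ refl = inj₁ refl
loc-other one₃ refl = inj₂ refl
loc-other two₁ refl = inj₁ refl

allBut : Corner → Corner → Bool
allBut west  west  = false
allBut east  east  = false
allBut south south = false
allBut _     _     = true

allBut-off : ∀ k → allBut k k ≡ false
allBut-off west = refl
allBut-off east = refl
allBut-off south = refl

allBut-on : ∀ {i j k} → Perm i j k → allBut i j ≡ true
allBut-on wes = refl
allBut-on wse = refl
allBut-on ews = refl
allBut-on esw = refl
allBut-on swe = refl
allBut-on sew = refl

Is : (a₁ a₂ a₃ : Bool) → Corner → Set
Is a₁ a₂ a₃ k = a₁ ≡ allBut k west × a₂ ≡ allBut k east × a₃ ≡ allBut k south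

-- On fewer than three marked vertices the tree is unique. Any two of the three trees on a full
-- triangle share an edge, so a single exchange with that edge present turns one into the other.
loc-compare : ∀ {a₁ a₂ a₃ a₁′ a₂′ a₃′ b₁ b₂ b₃} → Loc a₁ a₂ a₃ b₁ b₂ b₃ → Loc a₁′ a₂′ a₃′ b₁ b₂ b₃ →
              (a₁ ≡ a₁′ × a₂ ≡ a₂′ × a₃ ≡ a₃′) ⊎
              (∃[ i ] ∃[ j ] ∃[ k ] Perm i j k × Is a₁ a₂ a₃ k × Is a₁′ a₂′ a₃′ i)
loc-compare one₁ one₁ = inj₁ (refl , refl , refl)
loc-compare one₂ one₂ = inj₁ (refl , refl , refl)
loc-compare one₃ one₃ = inj₁ (refl , refl , refl)
loc-compare two₁ two₁ = inj₁ (refl , refl , refl)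
loc-compare two₂ two₂ = inj₁ (refl , refl , refl)
loc-compare two₃ two₃ = inj₁ (refl , refl , refl)
loc-compare all₁ all₁ = inj₁ (refl , refl , refl)
loc-compare all₂ all₂ = inj₁ (refl , refl , refl)
loc-compare all₃ all₃ = inj₁ (refl , refl , refl)
loc-compare all₁ all₂ = inj₂ (_ , _ , _ , esw , (refl , refl , refl) , refl , refl , refl)
loc-compare all₁ all₃ = inj₂ (_ , _ , _ , sew , (refl , refl , refl) , refl , refl , refl)
loc-compare all₂ all₁ = inj₂ (_ , _ , _ , wse , (refl , refl , refl) , refl , refl , refl)
loc-compare all₂ all₃ = inj₂ (_ , _ , _ , swe , (refl , refl , refl) , refl , refl , refl)
loc-compare all₃ all₁ = inj₂ (_ , _ , _ , wes , (refl , refl , refl) , refl , refl , refl)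
loc-compare all₃ all₂ = inj₂ (_ , _ , _ , ews , (refl , refl , refl) , refl , refl , refl)

-- h (c , k) tells whether the star with centre c contains vertex k of the triangle opp c.
record Upper (m : ℕ) (S h : State) : Set where
  field
    loc   : ∀ c → size c ≡ m → LocAt (λ k → S (edge (opp c) k)) (λ k → h (c , k))
    sides : ∀ t k → suc (size t) ≡ suc (suc m) → coord k t ≡ 0 → S (t , k) ≡ false

  locIn : ∀ {c i j k} → size c ≡ m → Perm i j k →
          Loc (S (edge (opp c) i)) (S (edge (opp c) j)) (S (edge (opp c) k)) (h (c , i)) (h (c , j)) (h (c , k))
  locIn {c} s π = loc-view {a = λ k → S (edge (opp c) k)} {b = λ k → h (c , k)} π (loc c s)

-- The same stars seen from the interior vertex full t, whose three centres inc k t are the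
-- vertices of the triangle big t of size m.
record Lower (m : ℕ) (h g : State) : Set where
  field
    loc   : ∀ t → suc (size t) ≡ m → LocAt (λ k → g (t , k)) (λ k → h (inc k t , k))
    sides : ∀ c k → size c ≡ m → coord k c ≡ 0 → h (c , k) ≡ true

  locIn : ∀ {t i j k} → suc (size t) ≡ m → Perm i j k →
          Loc (g (t , i)) (g (t , j)) (g (t , k)) (h (inc i t , i)) (h (inc j t , j)) (h (inc k t , k))
  locIn {t} s π = loc-view {a = λ k → g (t , k)} {b = λ k → h (inc k t , k)} π (loc t s)

opp-edge-≢ : ∀ {c c′} → c ≢ c′ → ∀ k l → edge (opp c) k ≢ edge (opp c′) l
opp-edge-≢ ne k l e with cong proj₂ e
... | refl = ne (inc-injective k (cong proj₁ e))

center-≢ : ∀ {c c′ : Cell} → c ≢ c′ → ∀ (k l : Corner) → (c , k) ≢ (c′ , l)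
center-≢ ne k l refl = ne refl

-- The bits of `h` are grouped in two ways: by centre, where they are indexed by `edge (big c)`, and
-- by interior black vertex, where `(inc k t , k)` is `edge (opp t) k`. Abstracting from the
-- grouping allows one argument for both transformations.
Separates : (Cell → Corner → Slot) → Set
Separates A = (∀ {c c′} → c ≢ c′ → ∀ k l → A c k ≢ A c′ l) × (∀ {c k l} → k ≢ l → A c k ≢ A c l)

opp-separates : Separates (λ c → edge (opp c))
opp-separates = opp-edge-≢ , λ ne e → ne (cong proj₂ e)

big-separates : Separates (λ c → edge (big c))
big-separates = center-≢ , λ ne e → ne (cong proj₂ e)

-- A leaf of the local tree at c is cut off there and attached to the local tree at c′.
module PruneGraft
  {A B : Cell → Corner → Slot} (sepA : Separates A) (sepB : Separates B) {Good : Cell → Set}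
  {X X′ Y Y′ : State} {c c′ i j k i′ j′ k′}
  (locs : ∀ x → Good x → LocAt (λ l → X (A x l)) (λ l → Y (B x l)))
  (c≢c′ : c ≢ c′) (gc : Good c) (gc′ : Good c′) (π : Perm i j k) (π′ : Perm i′ j′ k′)
  (on-k : X (A c k) ≡ true) (off-j : X (A c j) ≡ false)
  (off-i′ : Y (B c′ i′) ≡ false) (on-j′ : Y (B c′ j′) ≡ true)
  (M : Moved X X′ (A c k) (A c′ k′)) (N : Moved Y Y′ (B c i) (B c′ i′)) where
  private
    module M = Moved M
    module N = Moved N

    view : ∀ {x i j k} → Good x → Perm i j k →
           Loc (X (A x i)) (X (A x j)) (X (A x k)) (Y (B x i)) (Y (B x j)) (Y (B x k))
    view {x} gx ρ = loc-view {a = λ l → X (A x l)} {b = λ l → Y (B x l)} ρ (locs x gx)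

    at-c : LocAt (λ l → X′ (A c l)) (λ l → Y′ (B c l))
    at-c = loc-pack {a = λ l → X′ (A c l)} {b = λ l → Y′ (B c l)} π
      (loc-≡ (M.rest _ (proj₂ sepA (perm-≢ (swap₂₃ π))) (proj₁ sepA c≢c′ i k′))
             (trans (M.rest _ (proj₂ sepA (perm-≢ (rotate π))) (proj₁ sepA c≢c′ j k′)) off-j)
             M.off
             N.off
             (N.rest _ (proj₂ sepB (perm-≢ (swap₁₂ π))) (proj₁ sepB c≢c′ j i′))
             (N.rest _ (proj₂ sepB (perm-≢ (rotate (rotate π)))) (proj₁ sepB c≢c′ k i′))
             (loc-prune (view gc π) on-k off-j))

    c′≢c : c′ ≢ c
    c′≢c e = c≢c′ (sym e)

    at-c′ : LocAt (λ l → X′ (A c′ l)) (λ l → Y′ (B c′ l))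
    at-c′ = loc-pack {a = λ l → X′ (A c′ l)} {b = λ l → Y′ (B c′ l)} π′
      (loc-≡ (M.rest _ (proj₁ sepA c′≢c i′ k) (proj₂ sepA (perm-≢ (swap₂₃ π′))))
             (M.rest _ (proj₁ sepA c′≢c j′ k) (proj₂ sepA (perm-≢ (rotate π′))))
             M.on
             N.on
             (N.rest _ (proj₁ sepB c′≢c j′ i) (proj₂ sepB (perm-≢ (swap₁₂ π′))))
             (N.rest _ (proj₁ sepB c′≢c k′ i) (proj₂ sepB (perm-≢ (rotate (rotate π′)))))
             (loc-graft (view gc′ π′) off-i′ on-j′))

  prune-graft : ∀ x → Good x → LocAt (λ l → X′ (A x l)) (λ l → Y′ (B x l))
  prune-graft x gx with x ≟ᶠ c | x ≟ᶠ c′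
  ... | yes refl | _ = at-c
  ... | no _ | yes refl = at-c′
  ... | no x≢c | no x≢c′ = locAt-≡
    (λ l → M.rest _ (proj₁ sepA x≢c l k) (proj₁ sepA x≢c′ l k′))
    (λ l → N.rest _ (proj₁ sepB x≢c l i) (proj₁ sepB x≢c′ l i′)) (locs x gx)

upper-move : ∀ {m S S′ h h′ c c′ i j k i′ j′ k′} →
  c ≢ c′ → size c ≡ m → size c′ ≡ m → Perm i j k → Perm i′ j′ k′ → Upper m S h →
  S (edge (opp c) k) ≡ true → S (edge (opp c) j) ≡ false →
  h (c′ , i′) ≡ false → h (c′ , j′) ≡ true →
  Moved S S′ (edge (opp c) k) (edge (opp c′) k′) → Moved h h′ (c , i) (c′ , i′) → Upper m S′ h′
upper-move {m} {S} {S′} {c = c} {c′} {k = k} {k′ = k′} c≢c′ sc sc′ π π′ U on-k off-j off-i′ on-j′ M N = record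
  { loc = PruneGraft.prune-graft opp-separates big-separates loc c≢c′ sc sc′ π π′ on-k off-j off-i′ on-j′ M N
  ; sides = sides′ }
  where
  open Upper U
  sides′ : ∀ t l → suc (size t) ≡ suc (suc m) → coord l t ≡ 0 → S′ (t , l) ≡ false
  sides′ t l st e with (t , l) ≟ edge (opp c) k
  ... | yes refl = Moved.off M
  ... | no ne = trans (Moved.rest M _ ne λ { refl → coord-inc-≢0 k′ c′ e }) (sides t l st e)

-- A bit seen from an interior black vertex has the form `(inc k t , k)`, whose `k`-coordinate is
-- positive, so it is never a spoke to a side vertex.
lower-sides : ∀ {m h h′ t t′ k k′} → Moved h h′ (edge (opp t) k) (edge (opp t′) k′) →
              (∀ c l → size c ≡ m → coord l c ≡ 0 → h (c , l) ≡ true) →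
              ∀ c l → size c ≡ m → coord l c ≡ 0 → h′ (c , l) ≡ true
lower-sides {t = t} {t′} {k} {k′} N sides c l sc e with (c , l) ≟ edge (opp t′) k′
... | yes refl = Moved.on N
... | no ne = trans (Moved.rest N _ (λ { refl → coord-inc-≢0 k t e }) ne) (sides c l sc e)

lower-move : ∀ {m h h′ g g′ t t′ i j k i′ j′ k′} →
  t ≢ t′ → suc (size t) ≡ m → suc (size t′) ≡ m → Perm i j k → Perm i′ j′ k′ → Lower m h g →
  g (t , k) ≡ true → g (t , j) ≡ false →
  h (inc i′ t′ , i′) ≡ false → h (inc j′ t′ , j′) ≡ true →
  Moved g g′ (t , k) (t′ , k′) → Moved h h′ (inc i t , i) (inc i′ t′ , i′) → Lower m h′ g′
lower-move {t = t} {t′} {i} {i′ = i′} t≢t′ st st′ π π′ L on-k off-j off-i′ on-j′ M N = record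
  { loc = PruneGraft.prune-graft big-separates opp-separates loc t≢t′ st st′ π π′ on-k off-j off-i′ on-j′ M N
  ; sides = lower-sides {t = t} {t′} {i} {i′} N sides }
  where
  open Lower L

lower-change : ∀ {m h h′ g g′ t i j k a₁ a₂ a₃ b₁ b₂ b₃} → Perm i j k → Lower m h g →
  (∀ c l → size c ≡ m → coord l c ≡ 0 → h′ (c , l) ≡ true) →
  (∀ x → x ≢ t → ∀ l → g′ (x , l) ≡ g (x , l) × h′ (inc l x , l) ≡ h (inc l x , l)) →
  (g′ (t , i) ≡ a₁ × g′ (t , j) ≡ a₂ × g′ (t , k) ≡ a₃) →
  (h′ (inc i t , i) ≡ b₁ × h′ (inc j t , j) ≡ b₂ × h′ (inc k t , k) ≡ b₃) →
  Loc a₁ a₂ a₃ b₁ b₂ b₃ → Lower m h′ g′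
lower-change {m} {h} {h′} {g} {g′} {t} π L sides′ same (p , q , r) (u , v , w) new = record { loc = locs ; sides = sides′ }
  where
  open Lower L
  locs : ∀ x → suc (size x) ≡ m → LocAt (λ l → g′ (x , l)) (λ l → h′ (inc l x , l))
  locs x sx with x ≟ᶠ t
  ... | yes refl = loc-pack {a = λ l → g′ (x , l)} {b = λ l → h′ (inc l x , l)} π (loc-≡ p q r u v w new)
  ... | no ne = locAt-≡ (λ l → proj₁ (same x ne l)) (λ l → proj₂ (same x ne l)) (loc x sx)

-- At most one exchange is needed, by `loc-compare`, and it leaves the star of `c` unchanged.
retree : ∀ {m S h c i j k a₁ a₂ a₃} → Upper m S h → size c ≡ m → (π : Perm i j k) →
         Loc a₁ a₂ a₃ (h (c , i)) (h (c , j)) (h (c , k)) →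
         ∃[ S′ ] Star (Step (suc (suc m))) S S′ × Upper m S′ h ×
                 (S′ (edge (opp c) i) ≡ a₁ × S′ (edge (opp c) j) ≡ a₂ × S′ (edge (opp c) k) ≡ a₃) ×
                 (∀ z → (∀ l → z ≢ edge (opp c) l) → S′ z ≡ S z)
retree {m} {S} {h} {c} {i} {j} {k} {a₁} {a₂} {a₃} U sc π want = go (loc-compare (loc c sc) wanted)
  where
  open Upper U
  pick : ∀ {l} → OneOf i j k l → Bool
  pick fst = a₁
  pick snd = a₂
  pick thd = a₃
  a : Corner → Bool
  a l = pick (oneOf π l)
  a-at : ∀ {i j k} (π : Perm i j k) → oneOf π i ≡ fst × oneOf π j ≡ snd × oneOf π k ≡ thd
  a-at wes = refl , refl , refl
  a-at wse = refl , refl , refl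
  a-at ews = refl , refl , refl
  a-at esw = refl , refl , refl
  a-at swe = refl , refl , refl
  a-at sew = refl , refl , refl
  a-i : a i ≡ a₁
  a-i = cong pick (proj₁ (a-at π))
  a-j : a j ≡ a₂
  a-j = cong pick (proj₁ (proj₂ (a-at π)))
  a-k : a k ≡ a₃
  a-k = cong pick (proj₂ (proj₂ (a-at π)))
  wanted : LocAt a (λ l → h (c , l))
  wanted = loc-pack {a = a} {b = λ l → h (c , l)} π (loc-≡ a-i a-j a-k refl refl refl want)
  Result = ∃[ S′ ] Star (Step (suc (suc m))) S S′ × Upper m S′ h ×
                   (S′ (edge (opp c) i) ≡ a₁ × S′ (edge (opp c) j) ≡ a₂ × S′ (edge (opp c) k) ≡ a₃) ×
                   (∀ z → (∀ l → z ≢ edge (opp c) l) → S′ z ≡ S z)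
  go : _ → Result
  go (inj₁ (p , q , r)) = S , ε , U , (trans (same i) a-i , trans (same j) a-j , trans (same k) a-k) , λ _ _ → refl
    where
    same : ∀ l → S (edge (opp c) l) ≡ a l
    same = corners p q r
  go (inj₂ (x , y , w , ρ , (p , q , r) , (p′ , q′ , r′))) =
    S′ , st ◅ ε , record { loc = locs ; sides = sides′ } ,
    (trans (new i) a-i , trans (new j) a-j , trans (new k) a-k) ,
    λ z ne → M.rest z (ne x) (ne w)
    where
    old : ∀ l → S (edge (opp c) l) ≡ allBut w l
    old = corners p q r
    now : ∀ l → a l ≡ allBut x l
    now = corners p′ q′ r′
    mv = move S (edge-≢ (opp c) (swap₂₃ ρ))
    S′ = proj₁ mv
    module M = Moved (proj₂ mv)
    -- The present tree lacks edge `w`, the wanted one lacks edge `x`, and both contain edge `y`.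
    st : Step (suc (suc m)) S S′
    st = step (opp c) ρ (cong (λ s → suc (suc s)) sc) (trans (old x) (allBut-on (rotate (rotate ρ))))
           (trans (old w) (allBut-off w)) (proj₂ mv) (inj₁ (trans (old y) (allBut-on (swap₁₃ ρ))))
    new : ∀ l → S′ (edge (opp c) l) ≡ a l
    new l with oneOf ρ l
    ... | fst = trans M.off (trans (sym (allBut-off x)) (sym (now x)))
    ... | snd = trans (M.rest _ (edge-≢ (opp c) (swap₁₂ ρ)) (edge-≢ (opp c) (rotate ρ)))
                  (trans (old y) (trans (allBut-on (swap₁₃ ρ)) (sym (trans (now y) (allBut-on ρ)))))
    ... | thd = trans M.on (trans (sym (allBut-on (swap₂₃ ρ))) (sym (now w)))
    locs : ∀ u → size u ≡ m → LocAt (λ l → S′ (edge (opp u) l)) (λ l → h (u , l))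
    locs u su with u ≟ᶠ c
    ... | yes refl = locAt-≡ new (λ l → refl {x = h (c , l)}) wanted
    ... | no ne = locAt-≡ (λ l → M.rest _ (opp-edge-≢ ne l x) (opp-edge-≢ ne l w)) (λ l → refl {x = h (u , l)}) (loc u su)
    sides′ : ∀ t l → suc (size t) ≡ suc (suc m) → coord l t ≡ 0 → S′ (t , l) ≡ false
    sides′ t l stz e = trans (M.rest _ (λ { refl → coord-inc-≢0 x c e }) (λ { refl → coord-inc-≢0 w c e })) (sides t l stz e)

-- Moving a leaf around an interior vertex

record LeafAt (S : State) (p : Cell) (x : Slot) : Set where
  constructor leafAt
  field
    on       : S x ≡ true
    interior : Interior p
    free     : Free S p x

leaf-off : ∀ {S p x} → LeafAt S p x → ∀ {y q} → Joins y p q → y ≢ x → S y ≡ false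
leaf-off {S} L {y} e ne with S y in eq
... | false = refl
... | true = ⊥-elim (ne (LeafAt.free L y eq _ e))

data Rotation (n : ℕ) (p : Cell) : Slot → Slot → Set where
  turn : ∀ τ {i j k x y} → Perm i j k → level τ ≡ n → p ≡ vertex τ j → x ≡ edge τ i → y ≡ edge τ k → Rotation n p x y

-- A walk around a vertex may return to its starting edge, hence the condition in `off`, which
-- `Moved` does not have.
record Shifted (S S′ : State) (x y : Slot) : Set where
  field
    on   : S′ y ≡ true
    off  : x ≢ y → S′ x ≡ false
    rest : ∀ z → z ≢ x → z ≢ y → S′ z ≡ S z

-- The pivot is a leaf again after every turn, so turns can be chained. Edges passed on the way end
-- as they began, since all other edges at the leaf are absent.
leaf-walk : ∀ {n S p x y} → Star (Rotation n p) x y → LeafAt S p x →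
            ∃[ S′ ] Star (Step n) S S′ × Shifted S S′ x y
leaf-walk {S = S} ε L = S , ε , record { on = LeafAt.on L ; off = λ ne → ⊥-elim (ne refl) ; rest = λ _ _ _ → refl }
leaf-walk {n} {S} {p} {x} {y} (_◅_ {j = w} (turn τ {i} {j} {k} π lv refl refl refl) rots) L =
  S₂ , step τ π lv L.on off-k (proj₂ mv) (inj₂ (L.interior , L.free)) ◅ sts , record
    { on = Sh.on
    ; off = λ x≢y → off′ x≢y
    ; rest = rest′ }
  where
  module L = LeafAt L
  w≢x : w ≢ x
  w≢x = edge-≢ τ (rotate (rotate π))
  x≢w : x ≢ w
  x≢w e = w≢x (sym e)
  off-k : S w ≡ false
  off-k = leaf-off L (edge-joins τ (swap₁₂ π)) w≢x
  mv = move S x≢w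
  S₁ = proj₁ mv
  module M = Moved (proj₂ mv)
  L₁ : LeafAt S₁ p w
  L₁ = leafAt M.on L.interior free₁
    where
    free₁ : Free S₁ p w
    free₁ z o q e with z ≟ w
    ... | yes z≡w = z≡w
    ... | no z≢w with z ≟ x
    ...   | yes refl = ⊥-elim (on≢off o M.off)
    ...   | no z≢x = ⊥-elim (z≢x (L.free z (trans (sym (M.rest z z≢x z≢w)) o) q e))
  ih = leaf-walk rots L₁
  S₂ = proj₁ ih
  sts = proj₁ (proj₂ ih)
  module Sh = Shifted (proj₂ (proj₂ ih))
  off′ : x ≢ y → S₂ x ≡ false
  off′ x≢y = trans (Sh.rest x x≢w x≢y) M.off
  rest′ : ∀ z → z ≢ x → z ≢ y → S₂ z ≡ S z
  rest′ z z≢x z≢y with z ≟ w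
  ... | yes refl = trans (Sh.off z≢y) (sym off-k)
  ... | no z≢w = trans (Sh.rest z z≢w z≢y) (M.rest z z≢x z≢w)

full-inc : ∀ {i j k} → Perm i j k → ∀ t → full t ≡ inc i (inc j (inc k t))
full-inc wes t = refl
full-inc wse t = refl
full-inc ews t = refl
full-inc esw t = refl
full-inc swe t = refl
full-inc sew t = refl

size-full : ∀ t → size (full t) ≡ suc (suc (suc (size t)))
size-full t = cong suc (trans (size-inc east (inc south t)) (cong suc (size-inc south t)))

full-interior : ∀ t → Interior (full t)
full-interior t west ()
full-interior t east ()
full-interior t south ()

-- The six edges at an interior vertex are covered by the three opposite triangles that meet there.
joins-full : ∀ z {t q} → Joins z (full t) q → ∃[ l ] ∃[ r ] ∃[ k ] Perm l r k × z ≡ edge (opp (inc k t)) l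
joins-full (t′ , l) {t} e with joins-inv {t′} {l} e
... | r , k , π , p , _ = l , r , k , rotate (rotate π) ,
  cong (_, l) (inc-injective r (trans (sym p) (full-inc (swap₂₃ π) t)))

-- An isolated interior vertex would not be connected to any side vertex.
black-touched : ∀ {m S} → Grove (suc (suc m)) S → ∀ t → suc (size t) ≡ m →
                ∃[ l ] ∃[ r ] ∃[ k ] Perm l r k × S (edge (opp (inc k t)) l) ≡ true
black-touched {m} {S} G t st with Grove.covers G (full t) (trans (size-full t) (cong (λ s → suc (suc s)) st))
... | y , k , _ , e , c with conn-first c (λ { refl → full-interior t k e })
... | z , (_ , o) , q , jz with joins-full z jz
... | l , r , k′ , π , refl = l , r , k′ , π , o

-- There is no edge at `full t` in the triangle of `inc j t` by assumption, and none in that of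
-- `inc i t` because the bit there is off. So all its edges lie in the triangle of `inc k t`; once
-- the tree there is changed to make `full t` a leaf, it can be turned into the triangle of
-- `inc i t`.
black-move : ∀ {m S h t i j k} → Grove (suc (suc m)) S → Upper m S h → suc (size t) ≡ m → Perm i j k →
             h (inc k t , k) ≡ true → h (inc i t , i) ≡ false →
             (∀ l → l ≢ j → S (edge (opp (inc j t)) l) ≡ false) →
             ∃[ S′ ] ∃[ h′ ] Star (Step (suc (suc m))) S S′ × Upper m S′ h′ ×
                             Moved h h′ (inc k t , k) (inc i t , i)
black-move {m} {S} {h} {t} {i} {j} {k} G U st π on-k off-i empty-j = go (black-touched G t st)
  where
  sz : ∀ l → size (inc l t) ≡ m
  sz l = trans (size-inc l t) st
  c c″ : Cell
  c = inc k t
  c″ = inc i t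
  c≢c″ : c ≢ c″
  c≢c″ = inc-≢ (rotate (rotate π))
  lv : ∀ l → level (opp (inc l t)) ≡ suc (suc m)
  lv l = cong (λ s → suc (suc s)) (sz l)
  Result = ∃[ S′ ] ∃[ h′ ] Star (Step (suc (suc m))) S S′ × Upper m S′ h′ × Moved h h′ (inc k t , k) (inc i t , i)
  module U = Upper U
  off-c″ : ∀ {l r} → Perm l r i → S (edge (opp c″) l) ≡ false
  off-c″ ρ = proj₂ (loc-noEdge (U.locIn (sz i) (swap₁₃ ρ)) off-i)
  toward : ∀ {l r} → Perm l r k → Star (Rotation (suc (suc m)) (full t)) (edge (opp c) l) (edge (opp c) i)
  toward {l} ρ with oneOf π l
  ... | fst = ε
  ... | snd = turn (opp c) (rotate π) (lv k) (sym (oppVertex-inc k t)) refl refl ◅ ε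
  ... | thd = ⊥-elim (perm-≢ (swap₂₃ ρ) refl)
  away : ∀ {l r} → Perm l r i → Star (Rotation (suc (suc m)) (full t)) (edge (opp c″) k) (edge (opp c″) l)
  away {l} ρ with oneOf π l
  ... | fst = ⊥-elim (perm-≢ (swap₂₃ ρ) refl)
  ... | snd = turn (opp c″) (rotate (rotate π)) (lv i) (sym (oppVertex-inc i t)) refl refl ◅ ε
  ... | thd = ε
  -- The last edge on the way out of one opposite triangle and the first one in the other are both
  -- edges of the big triangle between them.
  across : Rotation (suc (suc m)) (full t) (edge (opp c) i) (edge (opp c″) k)
  across = turn (big (inc i (inc k t))) π
    (cong suc (trans (size-inc i c) (cong suc (sz k)))) (full-inc (swap₁₂ π) t) refl (cong (_, k) (inc-comm k i t))
  detach : ∀ {l r} → Perm l r k → S (edge (opp c) l) ≡ true → Result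
  detach {l} {r} ρ o =
    -- The star of `inc i t` is nonempty and does not contain `full t`, so it marks another vertex;
    -- the leaf is attached to that one.
    [ finish π , finish (swap₂₃ π) ]′ (loc-other (U.locIn (sz i) π) off-i)
    where
    ρ′ : Perm k r l
    ρ′ = swap₁₃ ρ
    ends = loc-ends (U.locIn (sz k) ρ′) o
    tree = loc-leafTree (U.locIn (sz k) ρ′) (proj₁ ends) (proj₂ ends)
    re = retree U (sz k) ρ′ (proj₂ tree)
    S₀ = proj₁ re
    U₀ = proj₁ (proj₂ (proj₂ re))
    off-r = proj₁ (proj₂ (proj₁ (proj₂ (proj₂ (proj₂ re)))))
    on-l = proj₂ (proj₂ (proj₁ (proj₂ (proj₂ (proj₂ re)))))
    kept = proj₂ (proj₂ (proj₂ (proj₂ re)))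
    only : ∀ {l′ r′ k′} → Perm l′ r′ k′ → S₀ (edge (opp (inc k′ t)) l′) ≡ true → OneOf i j k k′ →
           OneOf k r l l′ → edge (opp (inc k′ t)) l′ ≡ edge (opp c) l
    only {l′} σ o′ fst _ = ⊥-elim (on≢off (trans (sym (kept _ λ q → opp-edge-≢ (λ e → c≢c″ (sym e)) l′ q)) o′) (off-c″ σ))
    only {l′} σ o′ snd _ = ⊥-elim (on≢off (trans (sym (kept _ λ q → opp-edge-≢ (inc-≢ (rotate π)) l′ q)) o′)
                                     (empty-j l′ (perm-≢ (swap₂₃ σ))))
    only σ o′ thd fst = ⊥-elim (perm-≢ (swap₂₃ σ) refl)
    only σ o′ thd snd = ⊥-elim (on≢off o′ off-r)
    only σ o′ thd thd = refl
    leaf₀ : LeafAt S₀ (full t) (edge (opp c) l)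
    leaf₀ = leafAt on-l (full-interior t) free₀
      where
      free₀ : Free S₀ (full t) (edge (opp c) l)
      free₀ z o′ q e with joins-full z e
      ... | l′ , r′ , k′ , σ , refl = only σ o′ (oneOf π k′) (oneOf ρ′ l′)
    finish : ∀ {w l′} → Perm i w l′ → h (c″ , w) ≡ true → Result
    finish {w} {l′} σ on-w = S₁ , proj₁ mv , proj₁ (proj₂ re) ◅◅ proj₁ (proj₂ walk) ,
      upper-move c≢c″ (sz k) (sz i) ρ′ σ U₀ on-l off-r off-i on-w M (proj₂ mv) , proj₂ mv
      where
      walk = leaf-walk (toward ρ ◅◅ across ◅ away (swap₁₃ σ)) leaf₀
      S₁ = proj₁ walk
      module Sh = Shifted (proj₂ (proj₂ walk))
      M : Moved S₀ S₁ (edge (opp c) l) (edge (opp c″) l′)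
      M = record { off = Sh.off (opp-edge-≢ c≢c″ l l′) ; on = Sh.on ; rest = Sh.rest }
      mv = move h (center-≢ c≢c″ k i)
  start : ∀ {l r q} → Perm l r q → S (edge (opp (inc q t)) l) ≡ true → OneOf i j k q → Result
  start ρ o fst = ⊥-elim (on≢off o (off-c″ ρ))
  start {l} ρ o snd = ⊥-elim (on≢off o (empty-j l (perm-≢ (swap₂₃ ρ))))
  start ρ o thd = detach ρ o
  go : _ → Result
  go (l , r , q , ρ , o) = start ρ o (oneOf π q)

-- Adjusting the star graph

record Over (m : ℕ) (S h g : State) : Set where
  constructor over
  field
    grove : Grove (suc (suc m)) S
    upper : Upper m S h
    lower : Lower m h g

loc-single : ∀ {a₁ a₂ a₃ b₁ b₂ b₃} → Loc a₁ a₂ a₃ b₁ b₂ b₃ → a₁ ≡ false → a₂ ≡ false → a₃ ≡ false →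
             (b₁ ≡ true × b₂ ≡ false × b₃ ≡ false) ⊎ (b₂ ≡ true × b₁ ≡ false × b₃ ≡ false) ⊎
             (b₃ ≡ true × b₁ ≡ false × b₂ ≡ false)
loc-single one₁ refl refl refl = inj₁ (refl , refl , refl)
loc-single one₂ refl refl refl = inj₂ (inj₁ (refl , refl , refl))
loc-single one₃ refl refl refl = inj₂ (inj₂ (refl , refl , refl))

loc-onlyEdge : ∀ {a₁ a₂ a₃ b₁ b₂ b₃} → Loc a₁ a₂ a₃ b₁ b₂ b₃ → a₁ ≡ false → a₂ ≡ false → a₃ ≡ true →
               b₁ ≡ true × b₂ ≡ true × b₃ ≡ false
loc-onlyEdge two₃ refl refl refl = refl , refl , refl

loc-alone : ∀ {a₁ a₂ a₃ b₁ b₂ b₃} → Loc a₁ a₂ a₃ b₁ b₂ b₃ → b₁ ≡ false → b₂ ≡ false →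
            a₁ ≡ false × a₂ ≡ false × a₃ ≡ false × b₃ ≡ true
loc-alone one₃ refl refl = refl , refl , refl , refl

loc-turn : ∀ {a₁ a₂ a₃ b₁ b₂ b₃} → Loc a₁ a₂ a₃ b₁ b₂ b₃ → a₁ ≡ true → a₂ ≡ true → Loc false true true b₁ b₂ b₃
loc-turn all₃ refl refl = all₁

Kept : State → State → Cell → Set
Kept h h′ t = ∀ z → (∀ k → z ≢ (inc k t , k)) → h′ z ≡ h z

Adjusted : ℕ → (S h g : State) (t : Cell) (x y w : Corner) → Set
Adjusted m S h g t x y w =
  ∃[ S′ ] ∃[ h′ ] Star (Step (suc (suc m))) S S′ × Over m S′ h′ g × Kept h h′ t ×
                  (h′ (inc x t , x) ≡ true × h′ (inc y t , y) ≡ false × h′ (inc w t , w) ≡ false)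

adjust-from : ∀ {m S h g t x y w} → Over m S h g → suc (size t) ≡ m → Perm x y w → (∀ k → g (t , k) ≡ false) →
              h (inc y t , y) ≡ true → h (inc x t , x) ≡ false → h (inc w t , w) ≡ false →
              Adjusted m S h g t x y w
adjust-from {m} {S} {h} {g} {t} {x} {y} {w} (over G U L) st π none on-y off-x off-w =
  proj₁ bm , h′ , sts , over (steps-grove sts G) (proj₁ (proj₂ (proj₂ (proj₂ bm)))) L′ ,
  (λ z ne → N.rest z (ne y) (ne x)) , bits
  where
  empty : ∀ l → l ≢ w → S (edge (opp (inc w t)) l) ≡ false
  empty l ne with complete ne
  ... | q , ρ = proj₂ (loc-noEdge (Upper.locIn U {inc w t} (trans (size-inc w t) st) (rotate ρ)) off-w)
  bm : ∃[ S′ ] ∃[ h′ ] Star (Step (suc (suc m))) S S′ × Upper m S′ h′ × Moved h h′ (inc y t , y) (inc x t , x)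
  bm = black-move {t = t} G U st (swap₂₃ π) on-y off-x empty
  h′ = proj₁ (proj₂ bm)
  sts = proj₁ (proj₂ (proj₂ bm))
  N : Moved h h′ (inc y t , y) (inc x t , x)
  N = proj₂ (proj₂ (proj₂ (proj₂ bm)))
  module N = Moved N
  bits : h′ (inc x t , x) ≡ true × h′ (inc y t , y) ≡ false × h′ (inc w t , w) ≡ false
  bits = N.on , N.off ,
    trans (N.rest _ (proj₂ opp-separates {t} (perm-≢ (swap₁₂ (rotate π)))) (proj₂ opp-separates {t} (perm-≢ (rotate (rotate π))))) off-w
  L′ : Lower m h′ g
  L′ = lower-change {h = h} {h′} {g} {g} {t} π L (lower-sides {m} {h} {h′} {t} {t} {y} {x} N (Lower.sides L))
         (λ u ne l → refl , N.rest _ (opp-edge-≢ ne l y) (opp-edge-≢ ne l x))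
         (none x , none y , none w) bits one₁

-- A triangle of `g` without edges leaves open which single centre is joined to `full t`. Since the
-- other two triangles there have no edge at `full t`, `black-move` can change the choice.
adjust : ∀ {m S h g t x y w} → Over m S h g → suc (size t) ≡ m → Perm x y w → (∀ k → g (t , k) ≡ false) →
         Adjusted m S h g t x y w
adjust {m} {S} {h} {g} {t} {x} {y} {w} O st π none =
  [ (λ bits → S , h , ε , O , (λ _ _ → refl) , bits)
  , [ (λ (on-y , off-x , off-w) → adjust-from {m} {S} {h} {g} {t} O st π none on-y off-x off-w)
    , (λ (on-w , off-x , off-y) → flip (adjust-from {m} {S} {h} {g} {t} O st (swap₂₃ π) none on-w off-x off-y)) ]′
  ]′ (loc-single (Lower.locIn (Over.lower O) {t} st π) (none x) (none y) (none w))
  where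
  flip : Adjusted m S h g t x w y → Adjusted m S h g t x y w
  flip (S′ , h′ , sts , O′ , kept , p , q , r) = S′ , h′ , sts , O′ , kept , p , r , q

Cleared : ℕ → (S h g : State) (t : Cell) (x y : Corner) → Set
Cleared m S h g t x y =
  ∃[ S′ ] ∃[ h′ ] Star (Step (suc (suc m))) S S′ × Over m S′ h′ g × Kept h h′ t ×
                  (h′ (inc x t , x) ≡ false × h′ (inc y t , y) ≡ true)

clear : ∀ {m S h g t x y w} → Over m S h g → suc (size t) ≡ m → Perm x y w → (∀ k → k ≢ x → g (t , k) ≡ false) →
        Cleared m S h g t x y
clear {m} {S} {h} {g} {t} {x} {y} {w} O st π others = go (g (t , x)) refl
  where
  go : ∀ b → g (t , x) ≡ b → Cleared m S h g t x y
  go true on-x = S , h , ε , O , (λ _ _ → refl) , proj₂ (proj₂ bits) , proj₁ bits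
    where
    bits = loc-onlyEdge (Lower.locIn (Over.lower O) {t} st (rotate π))
             (others y (perm-≢ (swap₁₂ π))) (others w (perm-≢ (rotate (rotate π)))) on-x
  go false off-x = weaken (adjust {m} {S} {h} {g} {t} O st (swap₁₂ π) none)
    where
    none : ∀ k → g (t , k) ≡ false
    none k with k ≟ᶜ x
    ... | yes refl = off-x
    ... | no ne = others k ne
    weaken : Adjusted m S h g t y x w → Cleared m S h g t x y
    weaken (S′ , h′ , sts , O′ , kept , p , q , _) = S′ , h′ , sts , O′ , kept , q , p

stepAt : ∀ {n S S′} τ {i j k x y z} → Perm i j k → level τ ≡ n → x ≡ edge τ i → z ≡ edge τ j → y ≡ edge τ k →
         S x ≡ true → S z ≡ true → S y ≡ false → Moved S S′ x y → Step n S S′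
stepAt τ π lv refl refl refl on-x on-z off-y M = step τ π lv on-x off-y M (inj₁ on-z)

-- The hexagon of centres and interior black vertices around `full c` has five of its six
-- edges; the missing one moves from centre x to centre y.
hex-move : ∀ {m S h c x y z u v u′ v′} → Upper m S h → suc (suc (size c)) ≡ m →
           Perm x y z → Perm u v x → Perm u′ v′ y →
           h (oppVertex x c , u) ≡ false → h (oppVertex x c , v) ≡ true →
           h (oppVertex y c , u′) ≡ true → h (oppVertex y c , v′) ≡ true →
           h (oppVertex z c , x) ≡ true → h (oppVertex z c , y) ≡ true →
           ∃[ S′ ] ∃[ h′ ] Star (Step (suc (suc m))) S S′ × Upper m S′ h′ ×
                           Moved h h′ (oppVertex y c , u′) (oppVertex x c , u)
hex-move {m} {S} {h} {c} {x} {y} {z} {u} {v} {u′} {v′} U sc π ρ ρ′ off-u on-v on-u′ on-v′ on-x on-y =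
  S′ , h′ , proj₁ (proj₂ re₁) ◅◅ proj₁ (proj₂ re₂) ◅◅ st ◅ ε ,
  upper-move y≢x (sz y) (sz x) ρ′ ρ U₂ on-y₂ off-v₂ off-u on-v M N , N
  where
  sz : ∀ k → size (oppVertex k c) ≡ m
  sz k = trans (vertex-size (opp c) k) sc
  re₁ = retree {c = oppVertex y c} U (sz y) ρ′
          (proj₂ (loc-leafTree (Upper.locIn U {oppVertex y c} (sz y) ρ′) on-u′ on-v′))
  U₁ = proj₁ (proj₂ (proj₂ re₁))
  edges₁ = proj₁ (proj₂ (proj₂ (proj₂ re₁)))
  re₂ = retree {c = oppVertex z c} U₁ (sz z) π
          (proj₂ (loc-leafTree (Upper.locIn U₁ {oppVertex z c} (sz z) π) on-x on-y))
  S₂ = proj₁ re₂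
  U₂ = proj₁ (proj₂ (proj₂ re₂))
  on-z = proj₂ (proj₂ (proj₁ (proj₂ (proj₂ (proj₂ re₂)))))
  kept₂ = proj₂ (proj₂ (proj₂ (proj₂ re₂)))
  y≢x : oppVertex y c ≢ oppVertex x c
  y≢x = vertex-≢ (opp c) (swap₁₂ π)
  y≢z : oppVertex y c ≢ oppVertex z c
  y≢z = vertex-≢ (opp c) (rotate π)
  on-y₂ : S₂ (edge (opp (oppVertex y c)) y) ≡ true
  on-y₂ = trans (kept₂ _ λ l → opp-edge-≢ y≢z y l) (proj₂ (proj₂ edges₁))
  off-v₂ : S₂ (edge (opp (oppVertex y c)) v′) ≡ false
  off-v₂ = trans (kept₂ _ λ l → opp-edge-≢ y≢z v′ l) (proj₁ (proj₂ edges₁))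
  off-x : S₂ (edge (opp (oppVertex x c)) x) ≡ false
  off-x = proj₂ (loc-noEdge (Upper.locIn U₂ (sz x) ρ) off-u)
  mv = move S₂ (opp-edge-≢ y≢x y x)
  S′ = proj₁ mv
  M = proj₂ mv
  nv = move h (center-≢ y≢x u′ u)
  h′ = proj₁ nv
  N = proj₂ nv
  -- In the triangles of the three centres, the edges facing the middle of the hexagon are the edges
  -- of `big (full c)`. After the two changes of trees, edges `y` and `z` of this triangle are
  -- present, and edge `x` is absent because of the missing spoke.
  slot : ∀ k → edge (opp (oppVertex k c)) k ≡ edge (big (full c)) k
  slot k = cong (_, k) (inc-oppVertex k c)
  st : Step (suc (suc m)) S₂ S′
  st = stepAt (big (full c)) (rotate π) (cong suc (trans (size-full c) (cong suc sc)))
         (slot y) (slot z) (slot x) on-y₂ on-z off-x M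

moved-trans : ∀ {h h₁ h₂ x y z} → Moved h h₁ y z → Moved h₁ h₂ x y → h y ≡ true → x ≢ z → y ≢ z → Moved h h₂ x z
moved-trans {h} {h₁} {h₂} {x} {y} {z} M N hy x≢z y≢z = record
  { off = N.off
  ; on = trans (N.rest z (λ e → x≢z (sym e)) (λ e → y≢z (sym e))) M.on
  ; rest = rest }
  where
  module M = Moved M
  module N = Moved N
  rest : ∀ w → w ≢ x → w ≢ z → h₂ w ≡ h w
  rest w w≢x w≢z with w ≟ y
  ... | yes refl = trans N.on (sym hy)
  ... | no w≢y = trans (N.rest w w≢x w≢y) (M.rest w w≢y w≢z)

-- Lifting moves from size m to size m + 2

loc-notAll : ∀ {a₁ a₂ a₃ b₁ b₂ b₃} → Loc a₁ a₂ a₃ b₁ b₂ b₃ → a₁ ≡ true → a₃ ≡ true → a₂ ≡ false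
loc-notAll all₂ refl refl = refl

Lifted : ℕ → (S g′ : State) → Set
Lifted m S g′ = ∃[ S′ ] ∃[ h′ ] Star (Step (suc (suc m))) S S′ × Over m S′ h′ g′

-- Two edges of `g` in `big t` mean that all three centres are joined to `full t`, and the star
-- graph does not tell the three trees apart.
lift-big-swap : ∀ {m S h g g′ t i j k} → Over m S h g → suc (size t) ≡ m → Perm i j k →
                g (t , i) ≡ true → g (t , j) ≡ true → Moved g g′ (t , i) (t , k) → Lifted m S g′
lift-big-swap {m} {S} {h} {g} {g′} {t} {i} {j} {k} (over G U L) st π on-i on-j M =
  S , h , ε , over G U (lower-change {h = h} {h} {g} {g′} {t} π L (Lower.sides L)
    (λ x ne l → M.rest _ (center-≢ ne l i) (center-≢ ne l k) , refl)
    (M.off , trans (M.rest _ (edge-≢ (big t) (swap₁₂ π)) (edge-≢ (big t) (rotate π))) on-j , M.on)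
    (refl , refl , refl) (loc-turn (Lower.locIn L {t} st π) on-i on-j))
  where
  module M = Moved M

free-other : ∀ {g p x₀ x y s} → Free g p x₀ → p ≡ inc x s → y ≢ x → (s , y) ≢ x₀ → g (s , y) ≡ false
free-other {g} {p} {x₀} {x} {y} {s} free refl y≢x ne = go (g (s , y)) refl
  where
  go : ∀ b → g (s , y) ≡ b → g (s , y) ≡ false
  go false e = e
  go true e = ⊥-elim (ne (free (s , y) e _ (joins-perm (rotate (proj₂ (complete y≢x))) s)))

size-shared : ∀ {x y s t} → inc x s ≡ inc y t → size s ≡ size t
size-shared {x} {y} {s} {t} e = suc-injective (trans (sym (size-inc x s)) (trans (cong size e) (size-inc y t)))

shared-≢ : ∀ {x y w s t p} → Perm x y w → p ≡ inc x s → p ≡ inc y t → s ≢ t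
shared-≢ {x} π e e′ refl = inc-≢ π (trans (sym e) e′)

-- Being interior, `inc j t` is a centre with two interior black neighbours besides `full t`.
-- Clearing both spokes leaves it a star with one leg, hence no edge of `S` in its triangle, and
-- `black-move` can take `full t` from `inc k t` to `inc i t`.
lift-big-leaf : ∀ {m S h g g′ t i j k} → Over m S h g → suc (size t) ≡ m → Perm i j k →
                g (t , i) ≡ true → g (t , j) ≡ false → g (t , k) ≡ false → Moved g g′ (t , i) (t , k) →
                Interior (inc j t) → Free g (inc j t) (t , i) → Lifted m S g′
lift-big-leaf {m} {S} {h} {g} {g′} {t} {i} {j} {k} O st π on-i off-j off-k M int free =
  stage₁ (clear {t = s₁} O (trans (cong suc (size-shared (sym e₁))) st) π
           (λ y ne → free-other free e₁ ne (λ e → shared-≢ π e₁ refl (cong proj₁ e))))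
  where
  module M = Moved M
  p = inc j t
  v₁ = dec-view i p (int i)
  v₂ = dec-view k p (int k)
  s₁ s₂ : Cell
  s₁ = proj₁ v₁
  s₂ = proj₁ v₂
  e₁ : p ≡ inc i s₁
  e₁ = proj₂ v₁
  e₂ : p ≡ inc k s₂
  e₂ = proj₂ v₂
  stage₂ : ∀ {S₁ h₁} → Star (Step (suc (suc m))) S S₁ → h₁ (inc i s₁ , i) ≡ false →
           Cleared m S₁ h₁ g s₂ k i → Lifted m S g′
  stage₂ {S₁} {h₁} sts₁ off₁ (S₂ , h₂ , sts₂ , over G₂ U₂ L₂ , kept₂ , off₂ , _) =
    finish (black-move {t = t} G₂ U₂ st π (proj₁ (proj₂ bits)) (proj₂ (proj₂ bits)) empty)
    where
    p-i : h₂ (p , i) ≡ false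
    p-i = trans (cong (λ q → h₂ (q , i)) e₁)
            (trans (kept₂ _ λ l → opp-edge-≢ (shared-≢ (swap₂₃ π) e₁ e₂) i l) off₁)
    p-k : h₂ (p , k) ≡ false
    p-k = trans (cong (λ q → h₂ (q , k)) e₂) off₂
    alone = loc-alone (Upper.locIn U₂ {p} (trans (size-inc j t) st) (swap₂₃ π)) p-i p-k
    empty : ∀ l → l ≢ j → S₂ (edge (opp p) l) ≡ false
    empty l ne with oneOf π l
    ... | fst = proj₁ alone
    ... | snd = ⊥-elim (ne refl)
    ... | thd = proj₁ (proj₂ alone)
    bits = loc-onlyEdge (Lower.locIn L₂ {t} st (rotate π)) off-j off-k on-i
    finish : (∃[ S′ ] ∃[ h′ ] Star (Step (suc (suc m))) S₂ S′ × Upper m S′ h′ × Moved h₂ h′ (inc k t , k) (inc i t , i)) →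
             Lifted m S g′
    finish (S′ , h′ , sts , U′ , N) = S′ , h′ , sts₁ ◅◅ sts₂ ◅◅ sts , over (steps-grove sts G₂) U′
      (lower-change {h = h₂} {h′} {g} {g′} {t} π L₂ (lower-sides {m} {h₂} {h′} {t} {t} {k} {i} N (Lower.sides L₂))
        (λ x ne l → M.rest _ (center-≢ ne l i) (center-≢ ne l k) , N.rest _ (opp-edge-≢ ne l k) (opp-edge-≢ ne l i))
        (M.off , trans (M.rest _ (edge-≢ (big t) (swap₁₂ π)) (edge-≢ (big t) (rotate π))) off-j , M.on)
        (N.on , trans (N.rest _ (edge-≢ (opp t) (rotate π)) (edge-≢ (opp t) (swap₁₂ π))) (proj₁ bits) , N.off) two₃)
      where
      module N = Moved N
  stage₁ : Cleared m S h g s₁ i j → Lifted m S g′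
  stage₁ (S₁ , h₁ , sts₁ , O₁ , kept₁ , off₁ , _) =
    stage₂ sts₁ off₁ (clear {t = s₂} O₁ (trans (cong suc (size-shared (sym e₂))) st) (rotate (rotate π))
      (λ y ne → free-other free e₂ ne (λ e → shared-≢ (swap₁₃ π) e₂ refl (cong proj₁ e))))

-- Once two spokes of the centre `oppVertex j c` are cleared, its triangle has no edge of `S`. Its
-- only spoke can then be redirected to another black vertex without changing `S`: the final move
-- takes place in `h` and `g` alone.
lift-opp-leaf : ∀ {m S h g g′ c i j k} → Over m S h g → suc (suc (size c)) ≡ m → Perm i j k →
                g (edge (opp c) i) ≡ true → Moved g g′ (edge (opp c) i) (edge (opp c) k) →
                Interior (oppVertex j c) → Free g (oppVertex j c) (edge (opp c) i) → Lifted m S g′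
lift-opp-leaf {m} {S} {h} {g} {g′} {c} {i} {j} {k} O sc π on-i M int free =
  stage₁ (clear {t = t₂} O st₂ (swap₁₂ π) (λ y ne → free-other free e₂ ne (λ e → t₂≢t₁ (cong proj₁ e))))
  where
  p t₁ t₂ t₃ : Cell
  p = oppVertex j c
  t₁ = inc i c
  t₃ = inc k c
  v₂ = dec-view j p (int j)
  t₂ = proj₁ v₂
  e₁ : p ≡ inc k t₁
  e₁ = oppVertex-perm (rotate (rotate π)) c
  e₂ : p ≡ inc j t₂
  e₂ = proj₂ v₂
  e₃ : p ≡ inc i t₃
  e₃ = oppVertex-perm (swap₂₃ π) c
  st₁ : suc (size t₁) ≡ m
  st₁ = trans (cong suc (size-inc i c)) sc
  st₂ : suc (size t₂) ≡ m
  st₂ = trans (cong suc (size-shared (trans (sym e₂) e₁))) st₁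
  st₃ : suc (size t₃) ≡ m
  st₃ = trans (cong suc (size-inc k c)) sc
  t₂≢t₁ : t₂ ≢ t₁
  t₂≢t₁ = shared-≢ (rotate π) e₂ e₁
  t₂≢t₃ : t₂ ≢ t₃
  t₂≢t₃ = shared-≢ (swap₁₂ π) e₂ e₃
  t₁≢t₃ : t₁ ≢ t₃
  t₁≢t₃ = inc-≢ (swap₂₃ π)
  stage₂ : ∀ {S₁ h₁} → Star (Step (suc (suc m))) S S₁ → h₁ (inc j t₂ , j) ≡ false →
           Cleared m S₁ h₁ g t₃ i j → Lifted m S g′
  stage₂ {S₁} {h₁} sts₁ off₁ (S₂ , h₂ , sts₂ , over G₂ U₂ L₂ , kept₂ , off₂ , on₂) =
    S₂ , h₃ , sts₁ ◅◅ sts₂ , over G₂ U₃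
      (lower-move {h = h₂} {h₃} {g} {g′} {t₁} {t₃} t₁≢t₃ st₁ st₃ (swap₁₃ π) π L₂ on-i off-j off₂ on₂ M N)
    where
    p-j : h₂ (p , j) ≡ false
    p-j = trans (cong (λ q → h₂ (q , j)) e₂) (trans (kept₂ _ λ l → opp-edge-≢ t₂≢t₃ j l) off₁)
    p-i : h₂ (p , i) ≡ false
    p-i = trans (cong (λ q → h₂ (q , i)) e₃) off₂
    alone = loc-alone (Upper.locIn U₂ {p} (trans (vertex-size (opp c) j) sc) π) p-i p-j
    off-j : g (t₁ , j) ≡ false
    off-j = free-other free e₁ (perm-≢ (rotate π)) (λ e → perm-≢ (swap₁₂ π) (cong proj₂ e))
    mv = move h₂ (opp-edge-≢ t₁≢t₃ k i)
    h₃ = proj₁ mv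
    N : Moved h₂ h₃ (inc k t₁ , k) (inc i t₃ , i)
    N = proj₂ mv
    N′ : Moved h₂ h₃ (p , k) (p , i)
    N′ = subst₂ (Moved h₂ h₃) (cong (_, k) (sym e₁)) (cong (_, i) (sym e₃)) N
    module N′ = Moved N′
    locs : ∀ x → size x ≡ m → LocAt (λ l → S₂ (edge (opp x) l)) (λ l → h₃ (x , l))
    locs x sx with x ≟ᶠ p
    ... | yes refl = loc-pack {a = λ l → S₂ (edge (opp p) l)} {b = λ l → h₃ (p , l)} π
      (loc-≡ (proj₁ alone) (proj₁ (proj₂ alone)) (proj₁ (proj₂ (proj₂ alone)))
        N′.on (trans (N′.rest _ (edge-≢ (big p) (rotate π)) (edge-≢ (big p) (swap₁₂ π))) p-j) N′.off one₁)
    ... | no ne = locAt-≡ (λ l → refl {x = S₂ (edge (opp x) l)})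
      (λ l → N′.rest _ (center-≢ ne l k) (center-≢ ne l i)) (Upper.loc U₂ x sx)
    U₃ : Upper m S₂ h₃
    U₃ = record { loc = locs ; sides = Upper.sides U₂ }
  stage₁ : Cleared m S h g t₂ j i → Lifted m S g′
  stage₁ (S₁ , h₁ , sts₁ , O₁ , kept₁ , off₁ , _) =
    stage₂ sts₁ off₁ (clear {t = t₃} O₁ st₃ π
      (λ y ne → free-other free e₃ ne (λ e → t₁≢t₃ (sym (cong proj₁ e)))))

-- In the star graph `opp c` unfolds to a hexagon with centres `oppVertex l c` and black vertices
-- `full (inc l c)`. Edges `i` and `j` of `g` supply four of its edges. The exchange trades a spoke
-- of `full (inc i c)` for a missing spoke of `full (inc k c)`.
module _ {m g g′ c i j k} (Gg : Grove m g) (sc : suc (suc (size c)) ≡ m) (π : Perm i j k)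
         (on-i : g (edge (opp c) i) ≡ true) (on-j : g (edge (opp c) j) ≡ true)
         (off-k : g (edge (opp c) k) ≡ false) (M : Moved g g′ (edge (opp c) i) (edge (opp c) k)) where
  private
    tᵢ tⱼ tₖ : Cell
    tᵢ = inc i c
    tⱼ = inc j c
    tₖ = inc k c

    sz : ∀ l → suc (size (inc l c)) ≡ m
    sz l = trans (cong suc (size-inc l c)) sc

    Hexed : (S h : State) → Corner → Corner → Set
    Hexed S h r s = ∃[ S′ ] ∃[ h′ ] Star (Step (suc (suc m))) S S′ × Upper m S′ h′ ×
                                    Moved h h′ (inc r tᵢ , r) (inc s tₖ , s)

    -- The end `r` of the removed edge `i` must be a leaf of the tree in `big tᵢ`; the only other
    -- edge there that could end at it is `q`. The new edge `k` joins the newly attached `s` to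
    -- `s′`, which is attached already.
    assemble : ∀ {S h r q s s′} → Over m S h g → Perm r q i → Perm s s′ k → g (tᵢ , q) ≡ false →
               h (inc s tₖ , s) ≡ false → h (inc s′ tₖ , s′) ≡ true → Hexed S h r s → Lifted m S g′
    assemble {S} {h} (over G U L) ρ σ off-q off-s on-s′ (S′ , h′ , sts , U′ , N) =
      S′ , h′ , sts , over (steps-grove sts G) U′
        (lower-move {h = h} {h′} {g} {g′} {tᵢ} {tₖ} (inc-≢ (swap₂₃ π)) (sz i) (sz k) ρ σ L on-i off-q off-s on-s′ M N)

    module Hexagon {S h} (O : Over m S h g) where
      open Over O
      at : ∀ {a b d v} → Perm b a d → h (inc b (inc a c) , b) ≡ v → h (oppVertex d c , b) ≡ v
      at {b = b} ρ = trans (cong (λ q → h (q , b)) (oppVertex-perm ρ c))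
      bitsᵢ = loc-ends (Lower.locIn lower {tᵢ} (sz i) (rotate π)) on-i
      bitsⱼ = loc-ends (Lower.locIn lower {tⱼ} (sz j) (swap₂₃ π)) on-j
      kj : h (oppVertex k c , j) ≡ true
      kj = at (swap₁₂ π) (proj₁ bitsᵢ)
      jk : h (oppVertex j c , k) ≡ true
      jk = at (rotate (rotate π)) (proj₂ bitsᵢ)
      ki : h (oppVertex k c , i) ≡ true
      ki = at π (proj₁ bitsⱼ)
      ik : h (oppVertex i c , k) ≡ true
      ik = at (swap₁₃ π) (proj₂ bitsⱼ)

      back : ∀ {r s q s′} → Perm r i q → Perm s k s′ →
             (∃[ S′ ] ∃[ h′ ] Star (Step (suc (suc m))) S S′ × Upper m S′ h′ ×
                              Moved h h′ (oppVertex q c , r) (oppVertex s′ c , s)) → Hexed S h r s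
      back {r} {s} ρ σ (S′ , h′ , sts , U′ , N) = S′ , h′ , sts , U′ ,
        subst₂ (Moved h h′) (cong (_, r) (oppVertex-perm ρ c)) (cong (_, s) (oppVertex-perm σ c)) N

      fromV : h (inc i tₖ , i) ≡ true → h (inc j tₖ , j) ≡ false → Lifted m S g′
      fromV on off = choose (g (tᵢ , k)) refl
        where
        ji = at (swap₂₃ π) on
        ij = at (rotate π) off
        choose : ∀ b → g (tᵢ , k) ≡ b → Lifted m S g′
        choose false e = assemble O (rotate π) (swap₁₂ π) e off on
          (back (swap₁₂ π) (rotate π)
            (hex-move {c = c} upper sc (swap₂₃ π) (rotate π) (swap₁₂ π) ij ik kj ki ji jk))
        choose true e = assemble O (swap₁₃ π) (swap₁₂ π)
          (loc-notAll (Lower.locIn lower {tᵢ} (sz i) π) on-i e) off on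
          (back (rotate (rotate π)) (rotate π)
            (hex-move {c = c} upper sc π (rotate π) (rotate (rotate π)) ij ik jk ji ki kj))

      fromP : h (inc i tₖ , i) ≡ false → h (inc j tₖ , j) ≡ true → Lifted m S g′
      fromP off on = choose (g (tᵢ , k)) refl
        where
        ji = at (swap₂₃ π) off
        ij = at (rotate π) on
        first = hex-move {c = c} upper sc (rotate π) (swap₂₃ π) (swap₁₂ π) ji jk kj ki ij ik
        -- Here the missing spoke and the one to be removed belong to the same centre, and a single
        -- `hex-move` changes two different centres. The gap is therefore passed on by way of
        -- `oppVertex k c`.
        again : (∃[ S′ ] ∃[ h′ ] Star (Step (suc (suc m))) S S′ × Upper m S′ h′ ×
                                 Moved h h′ (oppVertex k c , j) (oppVertex j c , i)) →
                (∃[ S′ ] ∃[ h′ ] Star (Step (suc (suc m))) S S′ × Upper m S′ h′ ×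
                                 Moved h h′ (oppVertex j c , k) (oppVertex j c , i))
        again (S₁ , h₁ , sts₁ , U₁ , N₁) = extend
          (hex-move {c = c} U₁ sc (swap₁₃ π) (swap₁₂ π) (rotate (rotate π)) N₁.off
            (keep (λ e → perm-≢ π (cong proj₂ e)) (center-≢ k≢j i i) ki)
            (keep (center-≢ (λ e → k≢j (sym e)) k j) (λ e → perm-≢ (rotate (rotate π)) (cong proj₂ e)) jk)
            N₁.on
            (keep (center-≢ i≢k k j) (center-≢ i≢j k i) ik)
            (keep (center-≢ i≢k j j) (center-≢ i≢j j i) ij))
          where
          module N₁ = Moved N₁
          k≢j : oppVertex k c ≢ oppVertex j c
          k≢j = vertex-≢ (opp c) (swap₁₂ (rotate π))
          i≢k : oppVertex i c ≢ oppVertex k c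
          i≢k = vertex-≢ (opp c) (swap₂₃ π)
          i≢j : oppVertex i c ≢ oppVertex j c
          i≢j = vertex-≢ (opp c) π
          keep : ∀ {z} → z ≢ (oppVertex k c , j) → z ≢ (oppVertex j c , i) → h z ≡ true → h₁ z ≡ true
          keep ne ne′ e = trans (N₁.rest _ ne ne′) e
          extend : (∃[ S′ ] ∃[ h′ ] Star (Step (suc (suc m))) S₁ S′ × Upper m S′ h′ ×
                                    Moved h₁ h′ (oppVertex j c , k) (oppVertex k c , j)) → _
          extend (S₂ , h₂ , sts₂ , U₂ , N₂) = S₂ , h₂ , sts₁ ◅◅ sts₂ , U₂ ,
            moved-trans N₁ N₂ kj (λ e → perm-≢ (rotate (rotate π)) (cong proj₂ e)) (center-≢ k≢j j i)
        choose : ∀ b → g (tᵢ , k) ≡ b → Lifted m S g′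
        choose false e = assemble O (rotate π) π e off on (back (swap₁₂ π) (swap₂₃ π) first)
        choose true e = assemble O (swap₁₃ π) π
          (loc-notAll (Lower.locIn lower {tᵢ} (sz i) π) on-i e) off on
          (back (rotate (rotate π)) (swap₂₃ π) (again first))

    -- These two edges would form a cycle of length four with edges `i` and `j` of `opp c`.
    noCycle : g (tₖ , i) ≡ true → g (tₖ , j) ≡ true → ⊥
    noCycle on-i′ on-j′ = bridge (Grove.forest Gg) (sz k , on-i′) (joins-perm (rotate π) tₖ)
      (conn-edge (edge (opp c) j) ((sz j , on-j) , λ e → perm-≢ (swap₁₂ π) (cong proj₂ e))
         (subst₂ (Joins (edge (opp c) j)) (oppVertex-perm (rotate π) c) refl (edge-joins (opp c) (swap₂₃ π))) ◅◅
       conn-edge (edge (opp c) i) ((sz i , on-i) , λ e → inc-≢ (swap₂₃ π) (cong proj₁ e))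
         (subst₂ (Joins (edge (opp c) i)) refl (oppVertex-perm (swap₂₃ π) c) (edge-joins (opp c) (swap₁₂ (rotate π)))) ◅◅
       conn-edge (tₖ , j) ((sz k , on-j′) , λ e → perm-≢ (swap₁₂ π) (cong proj₂ e)) (joins-perm (swap₂₃ π) tₖ))

  lift-opp-swap : ∀ {S h} → Over m S h g → Lifted m S g′
  lift-opp-swap {S} {h} O = go (g (tₖ , i)) (g (tₖ , j)) refl refl
    where
    L = Over.lower O
    go : ∀ a b → g (tₖ , i) ≡ a → g (tₖ , j) ≡ b → Lifted m S g′
    go true true p q = ⊥-elim (noCycle p q)
    go true false p q = Hexagon.fromP O (proj₂ (proj₂ bits)) (proj₁ bits)
      where
      bits = loc-onlyEdge (Lower.locIn L {tₖ} (sz k) (rotate π)) q off-k p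
    go false true p q = Hexagon.fromV O (proj₁ bits) (proj₂ (proj₂ bits))
      where
      bits = loc-onlyEdge (Lower.locIn L {tₖ} (sz k) (swap₂₃ π)) p off-k q
    go false false p q = resume (adjust {m} {S} {h} {g} {tₖ} O (sz k) π none)
      where
      none : ∀ l → g (tₖ , l) ≡ false
      none l with oneOf π l
      ... | fst = p
      ... | snd = q
      ... | thd = off-k
      resume : Adjusted m S h g tₖ i j k → Lifted m S g′
      resume (S₁ , h₁ , sts₁ , O₁ , _ , on , off , _) = prepend (Hexagon.fromV O₁ on off)
        where
        prepend : Lifted m S₁ g′ → Lifted m S g′
        prepend (S₂ , h₂ , sts₂ , O₂) = S₂ , h₂ , sts₁ ◅◅ sts₂ , O₂

lift-step : ∀ {m S h g g′} → Over m S h g → Grove m g → Step m g g′ → Lifted m S g′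
lift-step O Gg (step (big t) π lv on-i off-k M (inj₁ on-j)) = lift-big-swap {t = t} O lv π on-i on-j M
lift-step {g = g} O Gg (step (big t) {i} {j} {k} π lv on-i off-k M (inj₂ (int , free))) = go (g (t , j)) refl
  where
  go : ∀ b → g (t , j) ≡ b → _
  go true on-j = lift-big-swap {t = t} O lv π on-i on-j M
  go false off-j = lift-big-leaf {t = t} O lv π on-i off-j off-k M int free
lift-step O Gg (step (opp c) π lv on-i off-k M (inj₁ on-j)) = lift-opp-swap {c = c} Gg lv π on-i on-j off-k M O
lift-step O Gg (step (opp c) π lv on-i off-k M (inj₂ (int , free))) = lift-opp-leaf {c = c} O lv π on-i M int free

lift-steps : ∀ {m S h g g′} → Over m S h g → Grove m g → Star (Step m) g g′ → Lifted m S g′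
lift-steps {S = S} {h} O Gg ε = S , h , ε , O
lift-steps {m} {S} {g′ = g′} O Gg (_◅_ {j = g₁} st sts) = continue (lift-step O Gg st)
  where
  continue : Lifted m S g₁ → Lifted m S g′
  continue (S₁ , h₁ , sts₁ , O₁) = prepend (lift-steps O₁ (step-grove st Gg) sts)
    where
    prepend : Lifted m S₁ g′ → Lifted m S g′
    prepend (S₂ , h₂ , sts₂ , O₂) = S₂ , h₂ , sts₁ ◅◅ sts₂ , O₂

-- The grove of size m below a grove of size m + 2

data Vertex : Set where
  black center : Cell → Vertex

star-src star-tgt : Slot → Vertex
star-src (c , _) = center c
star-tgt (c , k) = black (oppVertex k c)

module H = MultiGraph star-src star-tgt _≟_

OnH : ℕ → State → Slot → Set
OnH m h (c , k) = size c ≡ m × h (c , k) ≡ true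

loc-leafEnd : ∀ {a₁ a₂ a₃ b₁ b₂ b₃} → Loc a₁ a₂ a₃ b₁ b₂ b₃ → a₃ ≡ true → a₁ ≡ false ⊎ a₂ ≡ false
loc-leafEnd two₃ refl = inj₁ refl
loc-leafEnd all₁ refl = inj₁ refl
loc-leafEnd all₂ refl = inj₂ refl

loc-nonempty : ∀ {a₁ a₂ a₃ b₁ b₂ b₃} → Loc a₁ a₂ a₃ b₁ b₂ b₃ → b₁ ≡ true ⊎ b₂ ≡ true ⊎ b₃ ≡ true
loc-nonempty one₁ = inj₁ refl
loc-nonempty one₂ = inj₂ (inj₁ refl)
loc-nonempty one₃ = inj₂ (inj₂ refl)
loc-nonempty two₁ = inj₂ (inj₁ refl)
loc-nonempty two₂ = inj₁ refl
loc-nonempty two₃ = inj₁ refl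
loc-nonempty all₁ = inj₁ refl
loc-nonempty all₂ = inj₁ refl
loc-nonempty all₃ = inj₁ refl

shared-black : ∀ {k k′ l c c′} → Perm k k′ l → oppVertex k c ≡ oppVertex k′ c′ → ∃[ t ] c ≡ inc k t × c′ ≡ inc k′ t
shared-black wes refl = _ , refl , refl
shared-black wse refl = _ , refl , refl
shared-black ews refl = _ , refl , refl
shared-black esw refl = _ , refl , refl
shared-black swe refl = _ , refl , refl
shared-black sew refl = _ , refl , refl

coord-oppVertex : ∀ k c → coord k (oppVertex k c) ≡ coord k c
coord-oppVertex west c = refl
coord-oppVertex east c = refl
coord-oppVertex south c = refl

coord-oppVertex-≢0 : ∀ {k l} → k ≢ l → ∀ c → coord k (oppVertex l c) ≢ 0
coord-oppVertex-≢0 {west} {west} ne c = ⊥-elim (ne refl)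
coord-oppVertex-≢0 {west} {east} ne c ()
coord-oppVertex-≢0 {west} {south} ne c ()
coord-oppVertex-≢0 {east} {west} ne c ()
coord-oppVertex-≢0 {east} {east} ne c = ⊥-elim (ne refl)
coord-oppVertex-≢0 {east} {south} ne c ()
coord-oppVertex-≢0 {south} {west} ne c ()
coord-oppVertex-≢0 {south} {east} ne c ()
coord-oppVertex-≢0 {south} {south} ne c = ⊥-elim (ne refl)

oppVertex-cell : ∀ {i j k} (π : Perm i j k) a b → oppVertex j (cell π a 0 b) ≡ cell π (suc a) 0 (suc b) ×
                                                  oppVertex k (cell π a b 0) ≡ cell π (suc a) (suc b) 0
oppVertex-cell wes a b = refl , refl
oppVertex-cell wse a b = refl , refl
oppVertex-cell ews a b = refl , refl
oppVertex-cell esw a b = refl , refl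
oppVertex-cell swe a b = refl , refl
oppVertex-cell sew a b = refl , refl

cell-η : ∀ {i j k} (π : Perm i j k) x → x ≡ cell π (coord i x) (coord j x) (coord k x)
cell-η wes x = refl
cell-η wse x = refl
cell-η ews x = refl
cell-η esw x = refl
cell-η swe x = refl
cell-η sew x = refl

size-cell : ∀ {i j k} (π : Perm i j k) a b c → size (cell π a b c) ≡ a ℕ.+ b ℕ.+ c
size-cell wes a b c = refl
size-cell wse a b c = solve 3 (λ a b c → a :+ c :+ b := a :+ b :+ c) refl a b c
  where open ℕ.+-*-Solver
size-cell ews a b c = solve 3 (λ a b c → b :+ a :+ c := a :+ b :+ c) refl a b c
  where open ℕ.+-*-Solver
size-cell esw a b c = solve 3 (λ a b c → c :+ a :+ b := a :+ b :+ c) refl a b c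
  where open ℕ.+-*-Solver
size-cell swe a b c = solve 3 (λ a b c → b :+ c :+ a := a :+ b :+ c) refl a b c
  where open ℕ.+-*-Solver
size-cell sew a b c = solve 3 (λ a b c → c :+ b :+ a := a :+ b :+ c) refl a b c
  where open ℕ.+-*-Solver

module _ {m S h} (G : Grove (suc (suc m)) S) (U : Upper m S h) where
  open Grove G

  on-opp : ∀ {t k} → On (suc (suc m)) S (t , k) → ∃[ c ] t ≡ inc k c × size c ≡ m
  on-opp {t} {k} (st , o) with coord k t ℕ.≟ 0
  ... | yes e = ⊥-elim (on≢off o (Upper.sides U t k st e))
  ... | no ne with dec-view k t ne
  ...   | c , refl = c , refl , suc-injective (suc-injective (trans (cong suc (sym (size-inc k c))) st))

  linked : ∀ {P : Slot → Set} {c i j k} → size c ≡ m → Perm i j k →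
           (∀ l → S (edge (opp c) l) ≡ true → P (edge (opp c) l)) →
           h (c , i) ≡ true → h (c , j) ≡ true → Conn P (oppVertex i c) (oppVertex j c)
  linked {c = c} {i} {j} {k} sc π ok on-i on-j with loc-linked (Upper.locIn U {c} sc π) on-i on-j
  ... | inj₁ e = conn-edge (edge (opp c) k) (ok k e) (edge-joins (opp c) π)
  ... | inj₂ (e , e′) = conn-edge (edge (opp c) j) (ok j e′) (edge-joins (opp c) (swap₂₃ π)) ◅◅
                        conn-edge (edge (opp c) i) (ok i e) (edge-joins (opp c) (swap₁₂ (rotate π)))

  -- `Bad` marks centres whose triangles must not be used: none when connectivity is transferred,
  -- the centre of the tested spoke when cycles are excluded.
  module _ {P Q : Slot → Set} {Bad : Cell → Set} (bad? : ∀ c → Dec (Bad c)) (Q⊆ : ∀ z → Q z → OnH m h z)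
           (ok : ∀ c l → ¬ Bad c → size c ≡ m → S (edge (opp c) l) ≡ true → P (edge (opp c) l)) {w : Cell} where
    Exits : Set
    Exits = ∃[ c ] ∃[ i ] Bad c × Q (c , i) × Conn P (oppVertex i c) w

    Good : Vertex → Set
    Good (black x) = Conn P x w
    Good (center c) = ¬ Bad c × ∃[ i ] OnH m h (c , i) × Conn P (oppVertex i c) w

    -- Following the path from its end, it is traced in P until it last leaves a bad centre.
    trace : ∀ {X} → H.Conn Q X (black w) → Exits ⊎ Good X
    trace ε = inj₂ ε
    trace (((c , i) , q , e) ◅ p) with trace p
    ... | inj₁ x = inj₁ x
    trace (((c , i) , q , inj₁ (refl , refl)) ◅ p) | inj₂ gd with bad? c
    ... | yes b = inj₁ (c , i , b , q , gd)
    ... | no nb = inj₂ (nb , i , Q⊆ _ q , gd)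
    trace (((c , i) , q , inj₂ (refl , refl)) ◅ p) | inj₂ (nb , j , (sc , on-j) , conn) with i ≟ᶜ j
    ... | yes refl = inj₂ conn
    ... | no ne = inj₂ (linked sc (proj₂ (complete ne)) (λ l → ok c l nb sc) (proj₂ (Q⊆ _ q)) on-j ◅◅ conn)

  star⇒triangle : ∀ {x y} → H.Conn (OnH m h) (black x) (black y) → Conn (On (suc (suc m)) S) x y
  star⇒triangle p with trace {P = On (suc (suc m)) S} {Bad = λ _ → ⊥} (λ _ → no λ ()) (λ _ q → q)
                         (λ c l _ sc o → edge-on {S = S} (opp c) l (cong (λ s → suc (suc s)) sc) o) p
  ... | inj₂ conn = conn

  triangle⇒star : ∀ {x y} → Conn (On (suc (suc m)) S) x y → H.Conn (OnH m h) (black x) (black y)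
  triangle⇒star ε = ε
  triangle⇒star (((t , k) , o , e) ◅ p) with on-opp o | joins-inv {t} {k} e
  ... | c , refl , sc | i , j , π , refl , refl =
    H.conn-edge (c , j) (sc , proj₂ bits) (inj₂ (cong black (sym (oppVertex-perm (swap₂₃ π) c)) , refl)) ◅◅
    H.conn-edge (c , i) (sc , proj₁ bits) (inj₁ (refl , cong black (sym (oppVertex-perm (rotate π) c)))) ◅◅
    triangle⇒star p
    where
    bits = loc-ends (Upper.locIn U {c} sc π) (proj₂ o)

  -- A detour around the spoke `(c , k)` leaves `c` for the last time by some other spoke `(c , i)`.
  -- From there its trace in `S` avoids the triangle of `c`, so the tree inside that triangle closes
  -- a cycle.
  star-forest : H.Forest (OnH m h)
  star-forest (c , k) on-k p with trace {P = λ z → On (suc (suc m)) S z × (∀ l → z ≢ edge (opp c) l)} {Bad = _≡ c}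
      (_≟ᶠ c) (λ _ → proj₁)
      (λ c′ l ne sc o → edge-on {S = S} (opp c′) l (cong (λ s → suc (suc s)) sc) o , λ l′ → opp-edge-≢ ne l l′) p
  ... | inj₂ (ne , _) = ne refl
  ... | inj₁ (_ , i , refl , (on-i , ne) , conn) = contra (complete (λ { refl → ne refl }))
    where
    lv = cong (λ s → suc (suc s)) (proj₁ on-k)
    contra : ∃[ j ] Perm i k j → ⊥
    contra (j , π) with loc-linked (Upper.locIn U {c} (proj₁ on-k) π) (proj₂ on-i) (proj₂ on-k)
    ... | inj₁ e = bridge forest (edge-on {S = S} (opp c) j lv e) (edge-joins (opp c) π)
      (conn-mono (λ z (o , ne) → o , ne j) conn)
    ... | inj₂ (e , e′) = bridge forest (edge-on {S = S} (opp c) k lv e′) (edge-joins (opp c) (swap₂₃ π))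
      (conn-mono (λ z (o , ne) → o , ne k) conn ◅◅
       conn-edge (edge (opp c) i) (edge-on {S = S} (opp c) i lv e , edge-≢ (opp c) π) (edge-joins (opp c) (rotate π)))

  -- A vertex on the side facing `l` lies in at most one opposite triangle, and there it is vertex
  -- `l`; every edge of `S` lies in an opposite triangle.
  side-attached : ∀ {z y q l} → On (suc (suc m)) S z → Joins z y q → coord l y ≡ 0 →
                  ∃[ c ] y ≡ oppVertex l c × OnH m h (c , l) × coord l c ≡ 0
  side-attached {t , k} {l = l} o e cy with on-opp o | joins-inv {t} {k} e
  ... | c , refl , sc | i , j , π , refl , _ with oneOf π l
  ...   | fst = ⊥-elim (coord-inc-≢0 i _ cy)
  ...   | snd = c , sym (oppVertex-perm (swap₂₃ π) c) , (sc , proj₂ (loc-ends (Upper.locIn U {c} sc π) (proj₂ o))) ,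
                trans (sym (trans (coord-inc (swap₁₂ π) (inc k c)) (coord-inc (rotate π) c))) cy
  ...   | thd = ⊥-elim (coord-inc-≢0 k c (trans (sym (coord-inc (rotate (rotate π)) (inc k c))) cy))

module _ {m h g} (L : Lower m h g) where

  -- Kept general in `P` and `Q`, because `triangle-forest` applies it to connections that avoid one
  -- edge and need to avoid one spoke.
  triangle⇒star′ : ∀ {P Q : Slot → Set} → (∀ t k → P (t , k) → ∀ {i j} → Perm i j k → Q (inc i t , i)) →
                   ∀ {x y} → Conn P x y → H.Conn Q (center x) (center y)
  triangle⇒star′ f ε = ε
  triangle⇒star′ f (((t , k) , p , e) ◅ w) with joins-inv {t} {k} e
  ... | i , j , π , refl , refl =
    H.conn-edge (inc i t , i) (f t k p π) (inj₁ (refl , cong black (sym (oppVertex-inc i t)))) ◅◅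
    H.conn-edge (inc j t , j) (f t k p (swap₁₂ π)) (inj₂ (cong black (sym (oppVertex-inc j t)) , refl)) ◅◅
    triangle⇒star′ f w

  attached : ∀ t k → On m g (t , k) → ∀ {i j} → Perm i j k → OnH m h (inc i t , i)
  attached t k (st , o) {i} π = trans (size-inc i t) st , proj₁ (loc-ends (Lower.locIn L {t} st π) o)

  linked′ : ∀ {t i j k} → suc (size t) ≡ m → Perm i j k → h (inc i t , i) ≡ true → h (inc j t , j) ≡ true →
            Conn (On m g) (inc i t) (inc j t)
  linked′ {t} {i} {j} {k} st π on-i on-j with loc-linked (Lower.locIn L {t} st π) on-i on-j
  ... | inj₁ e = conn-edge (t , k) (st , e) (joins-perm π t)
  ... | inj₂ (e , e′) = conn-edge (t , j) (st , e′) (joins-perm (swap₂₃ π) t) ◅◅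
                        conn-edge (t , i) (st , e) (joins-perm (swap₁₂ (rotate π)) t)

  Good′ : Cell → Vertex → Set
  Good′ w (center x) = Conn (On m g) x w
  Good′ w (black y) = ∃[ c ] ∃[ k ] oppVertex k c ≡ y × OnH m h (c , k) × Conn (On m g) c w

  trace′ : ∀ {X w} → H.Conn (OnH m h) X (center w) → Good′ w X
  trace′ ε = ε
  trace′ (((c , k) , o , inj₂ (refl , refl)) ◅ p) = c , k , refl , o , trace′ p
  trace′ (((c , k) , (sc , o) , inj₁ (refl , refl)) ◅ p) with trace′ p
  ... | c′ , k′ , e , (_ , o′) , conn with k ≟ᶜ k′
  ...   | yes refl = subst (λ x → Conn (On m g) x _) (oppVertex-injective k e) conn
  ...   | no ne with shared-black (proj₂ (complete ne)) (sym e)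
  ...     | t , refl , refl = linked′ {t} (trans (sym (size-inc k t)) sc) (proj₂ (complete ne)) o o′ ◅◅ conn

  -- One end of `(t , k)` is a leaf of the tree in `big t`. The spoke from that end to `full t`
  -- serves no other edge of `g`, so a detour around the edge turns into a detour around the spoke.
  triangle-forest : H.Forest (OnH m h) → Forest (On m g)
  triangle-forest F (t , k) (st , on-k) p = start (completeTo k)
    where
    cut : ∀ {i j} → Perm i j k → g (t , j) ≡ false → Conn (Without (On m g) (t , k)) (inc i t) (inc j t) → ⊥
    cut {i} {j} π off-j p = F (inc i t , i) (attached t k (st , on-k) π)
      (triangle⇒star′ avoid p ◅◅
       H.conn-edge (inc j t , j) (attached t k (st , on-k) (swap₁₂ π) , λ e → perm-≢ (swap₁₂ π) (cong proj₂ e))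
         (inj₁ (refl , cong black (trans (oppVertex-inc i t) (sym (oppVertex-inc j t))))))
      where
      other : ∀ {k′ j′} → Perm i j′ k′ → On m g (t , k′) → (t , k′) ≢ (t , k) → OneOf i j k k′ → ⊥
      other ρ _ _ fst = perm-≢ (swap₂₃ ρ) refl
      other ρ (_ , o) _ snd = on≢off o off-j
      other ρ _ ne thd = ne refl
      avoid : ∀ t′ k′ → Without (On m g) (t , k) (t′ , k′) → ∀ {i′ j′} → Perm i′ j′ k′ →
              H.Without (OnH m h) (inc i t , i) (inc i′ t′ , i′)
      avoid t′ k′ (o , ne) {i′} ρ = attached t′ k′ o ρ , bad
        where
        bad : (inc i′ t′ , i′) ≢ (inc i t , i)
        bad e with t′ ≟ᶠ t
        ... | no t′≢t = opp-edge-≢ t′≢t i′ i e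
        bad e | yes refl with cong proj₂ e
        ... | refl = other ρ o ne (oneOf π k′)
    orient : ∀ {i j} → Joins (t , k) (inc i t) (inc j t) → Conn (Without (On m g) (t , k)) (inc i t) (inc j t)
    orient (inj₁ (e , e′)) = subst₂ (Conn _) (sym e) (sym e′) p
    orient (inj₂ (e , e′)) = subst₂ (Conn _) (sym e) (sym e′) (conn-sym p)
    start : ∃[ i ] ∃[ j ] Perm i j k → ⊥
    start (i , j , π) with loc-leafEnd (Lower.locIn L {t} st π) on-k
    ... | inj₂ off-j = cut π off-j (orient (joins-perm π t))
    ... | inj₁ off-i = cut (swap₁₂ π) off-i (orient (joins-perm (swap₁₂ π) t))

-- A centre on a side is always joined to the side vertex next to it, and `oppVertex` carries mirror
-- images in a median to mirror images. So pairing and separation come from the side vertices of the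
-- larger region that are not corners.
over-grove : ∀ {m S h g} → Over m S h g → Grove m g
over-grove {m} {S} {h} {g} (over G U L) = record
  { forest = triangle-forest L (star-forest G U)
  ; paired = paired′
  ; separated = separated′
  ; covers = covers′ }
  where
  open Grove G
  spoke : ∀ c k → OnH m h (c , k) → H.Conn (OnH m h) (center c) (black (oppVertex k c))
  spoke c k o = H.conn-edge (c , k) o (inj₁ (refl , refl))
  rim : ∀ {c c′} k k′ → OnH m h (c , k) → OnH m h (c′ , k′) →
        Conn (On (suc (suc m)) S) (oppVertex k c) (oppVertex k′ c′) → Conn (On m g) c c′
  rim {c} {c′} k k′ o o′ p = trace′ L (spoke c k o ◅◅ triangle⇒star G U p ◅◅ H.conn-sym (spoke c′ k′ o′))
  paired′ : ∀ {i j k} (π : Perm i j k) a d → d ≤ a → d ℕ.+ a ≡ m → Conn (On m g) (cell π a 0 d) (cell π a d 0)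
  paired′ {i} {j} {k} π a d d≤a e = rim j k
    (s₁ , Lower.sides L _ j s₁ (proj₁ (cell-coord π a 0 d)))
    (s₂ , Lower.sides L _ k s₂ (proj₂ (cell-coord π a d 0)))
    (subst₂ (Conn _) (sym (proj₁ (oppVertex-cell π a d))) (sym (proj₂ (oppVertex-cell π a d)))
      (paired π (suc a) (suc d) (s≤s d≤a) (cong suc (trans (ℕ.+-suc d a) (cong suc e)))))
    where
    s₁ : size (cell π a 0 d) ≡ m
    s₁ = trans (size-cell π a 0 d) (trans (cong (ℕ._+ d) (ℕ.+-identityʳ a)) (trans (ℕ.+-comm a d) e))
    s₂ : size (cell π a d 0) ≡ m
    s₂ = trans (size-cell π a d 0) (trans (ℕ.+-identityʳ (a ℕ.+ d)) (trans (ℕ.+-comm a d) e))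
  separated′ : ∀ k x y → size x ≡ m → size y ≡ m → coord k x ≡ 0 → coord k y ≡ 0 → Conn (On m g) x y → x ≡ y
  separated′ k x y sx sy cx cy p = oppVertex-injective k (separated k _ _
    (trans (vertex-size (opp x) k) (cong (λ s → suc (suc s)) sx))
    (trans (vertex-size (opp y) k) (cong (λ s → suc (suc s)) sy))
    (trans (coord-oppVertex k x) cx) (trans (coord-oppVertex k y) cy)
    (star⇒triangle G U (H.conn-sym (spoke x k (sx , Lower.sides L x k sx cx)) ◅◅
      triangle⇒star′ L (attached L) p ◅◅ spoke y k (sy , Lower.sides L y k sy cy))))
  fromBit : ∀ c k → OnH m h (c , k) → ∃[ y ] ∃[ l ] size y ≡ m × coord l y ≡ 0 × Conn (On m g) c y
  fromBit c k o with covers (oppVertex k c) (trans (vertex-size (opp c) k) (cong (λ s → suc (suc s)) (proj₁ o)))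
  ... | y , l , sy , cy , p with oppVertex k c ≟ᶠ y
  ...   | no ne with conn-first (conn-sym p) (λ e → ne (sym e))
  ...     | z , on-z , q , e with side-attached G U {z} {l = l} on-z e cy
  ...       | c′ , refl , o′ , cc′ = c′ , l , proj₁ o′ , cc′ , rim k l o o′ p
  fromBit c k o | y , l , sy , cy , p | yes refl with k ≟ᶜ l
  ... | yes refl = c , k , proj₁ o , trans (sym (coord-oppVertex k c)) cy , ε
  ... | no ne = ⊥-elim (coord-oppVertex-≢0 (λ e → ne (sym e)) c cy)
  covers′ : ∀ x → size x ≡ m → ∃[ y ] ∃[ l ] size y ≡ m × coord l y ≡ 0 × Conn (On m g) x y
  covers′ x sx with loc-nonempty (Upper.loc U x sx)
  ... | inj₁ o = fromBit x west (sx , o)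
  ... | inj₂ (inj₁ o) = fromBit x east (sx , o)
  ... | inj₂ (inj₂ o) = fromBit x south (sx , o)

-- In a triangle without edges any single vertex could be marked; `not a₁` selects the western one.
mark : (a₁ a₂ a₃ : Bool) → Corner → Bool
mark a₁ a₂ a₃ west  = a₂ ∨ a₃ ∨ not a₁
mark a₁ a₂ a₃ east  = a₁ ∨ a₃
mark a₁ a₂ a₃ south = a₁ ∨ a₂

mark-loc : ∀ a₁ a₂ a₃ → ¬ (a₁ ≡ true × a₂ ≡ true × a₃ ≡ true) →
           Loc a₁ a₂ a₃ (mark a₁ a₂ a₃ west) (mark a₁ a₂ a₃ east) (mark a₁ a₂ a₃ south)
mark-loc true  true  true  na = ⊥-elim (na (refl , refl , refl))
mark-loc true  true  false na = all₃
mark-loc true  false true  na = all₂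
mark-loc true  false false na = two₁
mark-loc false true  true  na = all₁
mark-loc false true  false na = two₂
mark-loc false false true  na = two₃
mark-loc false false false na = one₁

-- When all three bits are set, any of three trees would do; `not b₁` drops the western edge.
span : (b₁ b₂ b₃ : Bool) → Corner → Bool
span b₁ b₂ b₃ west  = b₂ ∧ b₃ ∧ not b₁
span b₁ b₂ b₃ east  = b₁ ∧ b₃
span b₁ b₂ b₃ south = b₁ ∧ b₂

span-loc : ∀ b₁ b₂ b₃ → ¬ (b₁ ≡ false × b₂ ≡ false × b₃ ≡ false) →
           Loc (span b₁ b₂ b₃ west) (span b₁ b₂ b₃ east) (span b₁ b₂ b₃ south) b₁ b₂ b₃
span-loc true  true  true  ne = all₁
span-loc true  true  false ne = two₃
span-loc true  false true  ne = two₂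
span-loc true  false false ne = one₁
span-loc false true  true  ne = two₁
span-loc false true  false ne = one₂
span-loc false false true  ne = one₃
span-loc false false false ne = ⊥-elim (ne (refl , refl , refl))

-- Such an edge would connect two distinct vertices of one side.
sides-off : ∀ {n S} → Grove n S → ∀ t k → suc (size t) ≡ n → coord k t ≡ 0 → S (t , k) ≡ false
sides-off {n} {S} G t k st ct = go (S (t , k)) refl (completeTo k)
  where
  go : ∀ b → S (t , k) ≡ b → ∃[ i ] ∃[ j ] Perm i j k → S (t , k) ≡ false
  go false e _ = e
  go true e (i , j , π) = ⊥-elim (inc-≢ π (Grove.separated G k (inc i t) (inc j t)
    (trans (size-inc i t) st) (trans (size-inc j t) st)
    (trans (coord-inc (rotate (rotate π)) t) ct) (trans (coord-inc (swap₁₂ (rotate π)) t) ct)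
    (conn-edge (t , k) (st , e) (joins-perm π t))))

-- The vertex `oppVertex k c` is on a side but not at a corner, so it has a partner on another side.
-- Comparing its two other coordinates tells around which corner the pair lies.
side-moves : ∀ {m S} → Grove (suc (suc m)) S → ∀ c k → size c ≡ m → coord k c ≡ 0 →
             ∃[ y ] oppVertex k c ≢ y × Conn (On (suc (suc m)) S) (oppVertex k c) y
side-moves {m} {S} G c k sc cc = choose (completeTo k)
  where
  Result = ∃[ y ] oppVertex k c ≢ y × Conn (On (suc (suc m)) S) (oppVertex k c) y
  go : ∀ {i j} → Perm i k j → coord j c ≤ coord i c → Result
  go {i} {j} π le = cell π (suc a) (suc d) 0 , ne ,
    subst (λ x → Conn (On (suc (suc m)) S) x (cell π (suc a) (suc d) 0)) (sym v≡) (Grove.paired G π (suc a) (suc d) (s≤s le) (cong suc (trans (ℕ.+-suc d a) (cong suc sum))))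
    where
    a = coord i c
    d = coord j c
    c≡ : c ≡ cell π a 0 d
    c≡ = trans (cell-η π c) (cong (λ x → cell π a x d) cc)
    v≡ : oppVertex k c ≡ cell π (suc a) 0 (suc d)
    v≡ = trans (cong (oppVertex k) c≡) (proj₁ (oppVertex-cell π a d))
    sum : d ℕ.+ a ≡ m
    sum = trans (ℕ.+-comm d a) (trans (cong (ℕ._+ d) (sym (ℕ.+-identityʳ a)))
            (trans (sym (size-cell π a 0 d)) (trans (cong size (sym c≡)) sc)))
    ne : oppVertex k c ≢ cell π (suc a) (suc d) 0
    ne e with trans (sym (proj₁ (cell-coord π (suc a) (suc d) 0)))
                (trans (cong (coord k) (sym e)) (trans (coord-oppVertex k c) cc))
    ... | ()
  choose : ∃[ i ] ∃[ j ] Perm i j k → Result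
  choose (i , j , π) = [ go (swap₂₃ π) , go (swap₂₃ (swap₁₂ π)) ]′ (≤-total (coord j c) (coord i c))

descend : ∀ {m S} → Grove (suc (suc m)) S → ∃[ h ] ∃[ g ] Over m S h g
descend {m} {S} G = h , g , over G U L
  where
  h g : State
  h (c , k) = mark (S (edge (opp c) west)) (S (edge (opp c) east)) (S (edge (opp c) south)) k
  g (t , k) = span (h (inc west t , west)) (h (inc east t , east)) (h (inc south t , south)) k
  notFull : ∀ c → size c ≡ m →
            ¬ (S (edge (opp c) west) ≡ true × S (edge (opp c) east) ≡ true × S (edge (opp c) south) ≡ true)
  notFull c sc (w , e , s) = bridge (Grove.forest G) (edge-on {S = S} (opp c) south lv s) (edge-joins (opp c) wes)
    (conn-edge (edge (opp c) east) (edge-on {S = S} (opp c) east lv e , λ ()) (edge-joins (opp c) wse) ◅◅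
     conn-edge (edge (opp c) west) (edge-on {S = S} (opp c) west lv w , λ ()) (edge-joins (opp c) sew))
    where
    lv = cong (λ s → suc (suc s)) sc
  U : Upper m S h
  U = record { loc = λ c sc → mark-loc _ _ _ (notFull c sc) ; sides = sides-off G }
  nonempty : ∀ t → suc (size t) ≡ m →
             ¬ (h (inc west t , west) ≡ false × h (inc east t , east) ≡ false × h (inc south t , south) ≡ false)
  nonempty t st (w , e , s) with black-touched G t st
  ... | l , r , k , π , o = on≢off
    (proj₂ (loc-ends (Upper.locIn U {inc k t} (trans (size-inc k t) st) (rotate π)) o)) (off k)
    where
    off : ∀ k → h (inc k t , k) ≡ false
    off west = w
    off east = e
    off south = s
  L : Lower m h g
  L = record
    { loc = λ t st → span-loc _ _ _ (nonempty t st)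
    ; sides = sides′ }
    where
    sides′ : ∀ c k → size c ≡ m → coord k c ≡ 0 → h (c , k) ≡ true
    sides′ c k sc cc with side-moves G c k sc cc
    ... | y , ne , p with conn-first p ne
    ... | z , o , q , e with side-attached G U {z} {l = k} o e (trans (coord-oppVertex k c) cc)
    ... | c′ , e′ , (_ , on) , _ = subst (λ x → h (x , k) ≡ true) (sym (oppVertex-injective k e′)) on

-- Reaching the target

-- Above the median from the western corner the edges parallel to the left side, below it the
-- horizontal ones.
target : State
target (_ , west) = false
target (⟨ _ , b , c ⟩ , east) = c <ᵇ b
target (⟨ _ , b , c ⟩ , south) = b <ᵇ c

-- The star graph through which the target of size m + 2 lies over that of size m; `target-upper`
-- and `target-lower` verify this triangle by triangle. All entries depend only on how `b` and `c`
-- compare, so one formula serves every size.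
targetBits : State
targetBits (_ , west) = true
targetBits (⟨ _ , b , c ⟩ , east) = b <ᵇ suc c
targetBits (⟨ _ , b , c ⟩ , south) = c <ᵇ suc b

target-upper : ∀ b c → Loc false (c <ᵇ suc b) (b <ᵇ suc c) true (b <ᵇ suc c) (c <ᵇ suc b)
target-upper zero zero = all₁
target-upper zero (suc c) = two₃
target-upper (suc b) zero = two₂
target-upper (suc b) (suc c) = target-upper b c

target-lower : ∀ b c → Loc false (c <ᵇ b) (b <ᵇ c) true (b <ᵇ c) (c <ᵇ b)
target-lower zero zero = one₁
target-lower zero (suc c) = two₃
target-lower (suc b) zero = two₂
target-lower (suc b) (suc c) = target-lower b c

-- As soon as a tree has an edge, its marked vertices are the ends of its edges.
loc-bits : ∀ {a₁ a₂ a₃ b₁ b₂ b₃ b₁′ b₂′ b₃′} → Loc a₁ a₂ a₃ b₁ b₂ b₃ → Loc a₁ a₂ a₃ b₁′ b₂′ b₃′ →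
           (a₁ ≡ false × a₂ ≡ false × a₃ ≡ false) ⊎ (b₁ ≡ b₁′ × b₂ ≡ b₂′ × b₃ ≡ b₃′)
loc-bits one₁ _ = inj₁ (refl , refl , refl)
loc-bits one₂ _ = inj₁ (refl , refl , refl)
loc-bits one₃ _ = inj₁ (refl , refl , refl)
loc-bits two₁ two₁ = inj₂ (refl , refl , refl)
loc-bits two₂ two₂ = inj₂ (refl , refl , refl)
loc-bits two₃ two₃ = inj₂ (refl , refl , refl)
loc-bits all₁ all₁ = inj₂ (refl , refl , refl)
loc-bits all₂ all₂ = inj₂ (refl , refl , refl)
loc-bits all₃ all₃ = inj₂ (refl , refl , refl)

cells : ℕ → List Cell
cells n = cartesianProductWith (λ a (b , c) → ⟨ a , b , c ⟩) (upTo (suc n))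
            (cartesianProductWith _,_ (upTo (suc n)) (upTo (suc n)))

∈-cells : ∀ x → x ∈ cells (size x)
∈-cells ⟨ a , b , c ⟩ = ∈-cartesianProductWith⁺ _ (bound (ℕ.≤-trans (ℕ.m≤m+n a b) (ℕ.m≤m+n (a ℕ.+ b) c)))
  (∈-cartesianProductWith⁺ _,_ (bound (ℕ.≤-trans (ℕ.m≤n+m b a) (ℕ.m≤m+n (a ℕ.+ b) c))) (bound (ℕ.m≤n+m c (a ℕ.+ b))))
  where
  bound : ∀ {k} → k ≤ a ℕ.+ b ℕ.+ c → k ∈ upTo (suc (a ℕ.+ b ℕ.+ c))
  bound le = ∈-upTo⁺ (s≤s le)

-- Since a repair at one cell spoils no cell already repaired, a single pass in any order suffices.
-- It serves both for the black vertices and for the centres.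
sweep : ∀ {A : Set} (_⟶_ : A → A → Set) → (∀ {s} → s ⟶ s) → (∀ {s t u} → s ⟶ t → t ⟶ u → s ⟶ u) →
        (Done : Cell → A → Set) →
        (∀ x s → ∃[ s′ ] s ⟶ s′ × Done x s′ × (∀ y → Done y s → Done y s′)) →
        ∀ xs s → ∃[ s′ ] s ⟶ s′ × (∀ x → x ∈ xs → Done x s′)
sweep {A} _⟶_ rfl trn Done fix xs s = let s′ , r , d , _ = go xs s in s′ , r , d
  where
  go : ∀ xs s → ∃[ s′ ] s ⟶ s′ × (∀ x → x ∈ xs → Done x s′) × (∀ y → Done y s → Done y s′)
  go [] s = s , rfl , (λ _ ()) , λ _ d → d
  go (x ∷ xs) s with fix x s
  ... | s₁ , r₁ , d₁ , keep₁ with go xs s₁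
  ... | s₂ , r₂ , d₂ , keep₂ = s₂ , trn r₁ r₂ ,
    (λ { y (here refl) → keep₂ y d₁ ; y (there i) → d₂ y i }) , λ y d → keep₂ y (keep₁ y d)

module _ {m : ℕ} {g : State} (isTarget : ∀ t k → suc (size t) ≡ m → g (t , k) ≡ target (t , k)) where

  Fixed : State → Cell → Set
  Fixed h t = suc (size t) ≡ m → ∀ k → h (inc k t , k) ≡ targetBits (inc k t , k)

  Stage : Set
  Stage = ∃[ S ] ∃[ h ] Over m S h g

  -- If the target has an edge in `big t`, then `loc-bits` shows the bits to be right already.
  -- Otherwise the single spoke of `full t` is turned to the western centre.
  fixBlack : ∀ t (s : Stage) →
             ∃[ s′ ] Star (Step (suc (suc m))) (proj₁ s) (proj₁ s′) × Fixed (proj₁ (proj₂ s′)) t ×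
                     (∀ y → Fixed (proj₁ (proj₂ s)) y → Fixed (proj₁ (proj₂ s′)) y)
  fixBlack t@(⟨ a , b , c ⟩) s@(S , h , O) = skip (suc (size t) ℕ.≟ m)
    where
    Result = ∃[ s′ ] Star (Step (suc (suc m))) S (proj₁ s′) × Fixed (proj₁ (proj₂ s′)) t ×
                     (∀ y → Fixed h y → Fixed (proj₁ (proj₂ s′)) y)
    module _ (st : suc (size t) ≡ m) where
      wanted : Loc (g (t , west)) (g (t , east)) (g (t , south)) true (b <ᵇ c) (c <ᵇ b)
      wanted = loc-≡ (isTarget t west st) (isTarget t east st) (isTarget t south st) refl refl refl (target-lower b c)
      adjusted : (∀ k → g (t , k) ≡ false) → (b <ᵇ c) ≡ false → (c <ᵇ b) ≡ false → Adjusted m S h g t west east south → Result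
      adjusted none off-e off-s (S′ , h′ , sts , O′ , kept , on , off , off′) =
        (S′ , h′ , O′) , sts , (λ _ → now) , keep
        where
        now : ∀ k → h′ (inc k t , k) ≡ targetBits (inc k t , k)
        now west = on
        now east = trans off (sym off-e)
        now south = trans off′ (sym off-s)
        keep : ∀ y → Fixed h y → Fixed h′ y
        keep y d sy k with y ≟ᶠ t
        ... | yes refl = now k
        ... | no ne = trans (kept _ (λ l → opp-edge-≢ ne k l)) (d sy k)
      single : (b₁ b₂ b₃ : Bool) → b₁ ≡ true →
               (b₁ ≡ true × b₂ ≡ false × b₃ ≡ false) ⊎ (b₂ ≡ true × b₁ ≡ false × b₃ ≡ false) ⊎
               (b₃ ≡ true × b₁ ≡ false × b₂ ≡ false) → b₂ ≡ false × b₃ ≡ false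
      single _ _ _ refl (inj₁ (_ , p , q)) = p , q
      single _ _ _ refl (inj₂ (inj₁ (_ , () , _)))
      single _ _ _ refl (inj₂ (inj₂ (_ , () , _)))
      go : _ → Result
      go (inj₂ (p , q , r)) = s , ε , (λ _ → corners p q r) , λ _ d → d
      go (inj₁ (p , q , r)) = let e , e′ = single true _ _ refl (loc-single wanted p q r) in
        adjusted (corners p q r) e e′ (adjust {m} {S} {h} {g} {t} O st wes (corners p q r))
    skip : Dec (suc (size t) ≡ m) → Result
    skip (no ne) = s , ε , (λ st → ⊥-elim (ne st)) , λ _ d → d
    skip (yes st) = go st (loc-bits (Lower.loc (Over.lower O) t st) (wanted st))

  bits-fixed : ∀ {S h} → Over m S h g → (∀ t → Fixed h t) → ∀ c k → size c ≡ m → h (c , k) ≡ targetBits (c , k)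
  bits-fixed {S} {h} O fixed c k sc with coord k c ℕ.≟ 0
  ... | yes e = trans (Lower.sides (Over.lower O) c k sc e) (sym (side k c e))
    where
    side : ∀ k c → coord k c ≡ 0 → targetBits (c , k) ≡ true
    side west c e = refl
    side east ⟨ _ , zero , _ ⟩ e = refl
    side south ⟨ _ , _ , zero ⟩ e = refl
  ... | no ne with dec-view k c ne
  ...   | t , refl = fixed t (trans (sym (size-inc k t)) sc) k

  Settled : Cell → State → Set
  Settled c S = size c ≡ m → ∀ k → S (edge (opp c) k) ≡ target (edge (opp c) k)

  module _ {h : State} (bits : ∀ c k → size c ≡ m → h (c , k) ≡ targetBits (c , k)) where

    fixCenter : ∀ c (s : ∃[ S ] Upper m S h) →
                ∃[ s′ ] Star (Step (suc (suc m))) (proj₁ s) (proj₁ s′) × Settled c (proj₁ s′) ×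
                        (∀ y → Settled y (proj₁ s) → Settled y (proj₁ s′))
    fixCenter c@(⟨ x , y , z ⟩) s@(S , U) = skip (size c ℕ.≟ m)
      where
      Result = ∃[ s′ ] Star (Step (suc (suc m))) S (proj₁ s′) × Settled c (proj₁ s′) ×
                        (∀ y → Settled y S → Settled y (proj₁ s′))
      finish : (∃[ S′ ] Star (Step (suc (suc m))) S S′ × Upper m S′ h ×
                 (S′ (edge (opp c) west) ≡ false × S′ (edge (opp c) east) ≡ (z <ᵇ suc y) × S′ (edge (opp c) south) ≡ (y <ᵇ suc z)) ×
                 (∀ w → (∀ l → w ≢ edge (opp c) l) → S′ w ≡ S w)) → Result
      finish (S′ , sts , U′ , (p , q , r) , kept) = (S′ , U′) , sts , (λ _ → corners p q r) , keep
        where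
        keep : ∀ y → Settled y S → Settled y S′
        keep u d su k with u ≟ᶠ c
        ... | yes refl = corners {λ k → S′ (edge (opp c) k) ≡ target (edge (opp c) k)} p q r k
        ... | no ne = trans (kept _ (λ l → opp-edge-≢ ne k l)) (d su k)
      skip : Dec (size c ≡ m) → Result
      skip (no ne) = s , ε , (λ sc → ⊥-elim (ne sc)) , λ _ d → d
      skip (yes sc) = finish (retree {c = c} U sc wes
        (loc-≡ refl refl refl (bits c west sc) (bits c east sc) (bits c south sc) (target-upper y z)))

    settle : ∀ {S} → Upper m S h → ∃[ S′ ] Star (Step (suc (suc m))) S S′ ×
             (∀ t k → suc (size t) ≡ suc (suc m) → S′ (t , k) ≡ target (t , k))
    settle {S} U = finish (sweep (λ s s′ → Star (Step (suc (suc m))) (proj₁ s) (proj₁ s′)) ε _◅◅_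
                            (λ c s → Settled c (proj₁ s)) fixCenter (cells m) (S , U))
      where
      finish : ∃[ s′ ] Star (Step (suc (suc m))) S (proj₁ s′) × (∀ c → c ∈ cells m → Settled c (proj₁ s′)) → _
      finish ((S′ , U′) , sts , done) = S′ , sts , agree
        where
        side : ∀ k t → coord k t ≡ 0 → target (t , k) ≡ false
        side west t e = refl
        side east ⟨ _ , zero , zero ⟩ e = refl
        side east ⟨ _ , zero , suc _ ⟩ e = refl
        side south ⟨ _ , zero , zero ⟩ e = refl
        side south ⟨ _ , suc _ , zero ⟩ e = refl
        agree : ∀ t k → suc (size t) ≡ suc (suc m) → S′ (t , k) ≡ target (t , k)
        agree t k st with coord k t ℕ.≟ 0
        ... | yes e = trans (Upper.sides U′ t k st e) (sym (side k t e))
        ... | no ne with dec-view k t ne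
        ...   | c , refl = done c (subst (λ n → c ∈ cells n) sc (∈-cells c)) sc k
          where
          sc : size c ≡ m
          sc = suc-injective (suc-injective (trans (cong suc (sym (size-inc k c))) st))

  over-target : ∀ {S h} → Over m S h g → ∃[ S′ ] Star (Step (suc (suc m))) S S′ ×
                (∀ t k → suc (size t) ≡ suc (suc m) → S′ (t , k) ≡ target (t , k))
  over-target {S} {h} O = finish (sweep (λ s s′ → Star (Step (suc (suc m))) (proj₁ s) (proj₁ s′)) ε _◅◅_
                            (λ t s → Fixed (proj₁ (proj₂ s)) t) fixBlack (cells (pred m)) (S , h , O))
    where
    finish : ∃[ s′ ] Star (Step (suc (suc m))) S (proj₁ s′) × (∀ t → t ∈ cells (pred m) → Fixed (proj₁ (proj₂ s′)) t) →
             ∃[ S′ ] Star (Step (suc (suc m))) S S′ × (∀ t k → suc (size t) ≡ suc (suc m) → S′ (t , k) ≡ target (t , k))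
    finish ((S₁ , h₁ , O₁) , sts₁ , done) =
      let S₂ , sts₂ , agree = settle (bits-fixed O₁ fixed) (Over.upper O₁) in S₂ , sts₁ ◅◅ sts₂ , agree
      where
      fixed : ∀ t → Fixed h₁ t
      fixed t st = done t (subst (λ n → t ∈ cells n) (cong pred st) (∈-cells t)) st

-- The size drops by two, hence two base cases: size 0 has no edges, and in size 1 all three edges
-- run along sides and are absent.
reach-target : ∀ n S → Grove n S → ∃[ S′ ] Star (Step n) S S′ × (∀ t k → suc (size t) ≡ n → S′ (t , k) ≡ target (t , k))
reach-target zero S G = S , ε , λ _ _ ()
reach-target (suc zero) S G = S , ε , λ { ⟨ zero , zero , zero ⟩ k st → trans (sides-off G _ k st (zeros k)) (sym (off k)) }
  where
  zeros : ∀ k → coord k ⟨ 0 , 0 , 0 ⟩ ≡ 0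
  zeros = corners refl refl refl
  off : ∀ k → target (⟨ 0 , 0 , 0 ⟩ , k) ≡ false
  off = corners refl refl refl
reach-target (suc (suc m)) S G =
  let h , g , O = descend G
      g′ , sts , isTarget = reach-target m g (over-grove O)
      S₁ , h₁ , sts₁ , O₁ = lift-steps O (over-grove O) sts
      S₂ , sts₂ , agree = over-target isTarget O₁
  in S₂ , sts₁ ◅◅ sts₂ , agree

-- Coordinates in the plane

pos : Cell → Point
pos ⟨ a , b , c ⟩ = + b - + a , - + c

shift : Corner → Point
shift west  = pt (- + 1) (+ 0)
shift east  = pt (+ 1) (+ 0)
shift south = pt (+ 0) (- + 1)

pos-inc : ∀ k x → pos (inc k x) ≡ pos x ⊕ shift k
pos-inc west ⟨ a , b , c ⟩ = cong₂ _,_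
  (solve 2 (λ a b → b :- (con (+ 1) :+ a) := b :- a :+ con (- + 1)) refl (+ a) (+ b)) (sym (ℤ.+-identityʳ (- + c)))
  where open +-*-Solver
pos-inc east ⟨ a , b , c ⟩ = cong₂ _,_
  (solve 2 (λ a b → (con (+ 1) :+ b) :- a := b :- a :+ con (+ 1)) refl (+ a) (+ b)) (sym (ℤ.+-identityʳ (- + c)))
  where open +-*-Solver
pos-inc south ⟨ a , b , c ⟩ = cong₂ _,_ (sym (ℤ.+-identityʳ (+ b - + a)))
  (solve 1 (λ c → :- (con (+ 1) :+ c) := :- c :+ con (- + 1)) refl (+ c))
  where open +-*-Solver

-- A position determines `c` and `b - a`; the size then gives `a + b`, and halving yields `b`.
pos-injective : ∀ x y → size x ≡ size y → pos x ≡ pos y → x ≡ y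
pos-injective ⟨ a , b , c ⟩ ⟨ a′ , b′ , c′ ⟩ s e = build a≡ b≡ c≡
  where
  build : a ≡ a′ → b ≡ b′ → c ≡ c′ → ⟨ a , b , c ⟩ ≡ ⟨ a′ , b′ , c′ ⟩
  build refl refl refl = refl
  c≡ : c ≡ c′
  c≡ = ℤ.+-injective (ℤ.neg-injective (cong proj₂ e))
  sum : a ℕ.+ b ≡ a′ ℕ.+ b′
  sum = ℕ.+-cancelʳ-≡ c _ _ (trans s (cong (a′ ℕ.+ b′ ℕ.+_) (sym c≡)))
  double : + b + + b ≡ + b′ + + b′
  double = trans (solve 2 (λ a b → b :+ b := b :- a :+ (a :+ b)) refl (+ a) (+ b))
    (trans (cong₂ _+_ (cong proj₁ e) (cong +_ sum))
      (solve 2 (λ a b → b :- a :+ (a :+ b) := b :+ b) refl (+ a′) (+ b′)))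
    where open +-*-Solver
  halve : ∀ m n → m ℕ.+ m ≡ n ℕ.+ n → m ≡ n
  halve zero zero _ = refl
  halve (suc m) (suc n) p = cong suc (halve m n (suc-injective (trans (sym (ℕ.+-suc m m)) (trans (suc-injective p) (ℕ.+-suc n n)))))
  b≡ : b ≡ b′
  b≡ = halve b b′ (ℤ.+-injective double)
  a≡ : a ≡ a′
  a≡ = ℕ.+-cancelʳ-≡ b a a′ (trans sum (cong (a′ ℕ.+_) (sym b≡)))

pos-InV : ∀ {n} x → size x ≡ n → InV n (pos x)
pos-InV {n} ⟨ a , b , c ⟩ refl = bound , ℤ.neg-≤-pos {c} {0} , parity
  where
  bound : ∣ + b - + a ∣ ℕ.+ ∣ - + c ∣ ℕ.≤ a ℕ.+ b ℕ.+ c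
  bound = ℕ.+-mono-≤ (subst (∣ + b - + a ∣ ℕ.≤_) (ℕ.+-comm b a) (ℤ.∣i-j∣≤∣i∣+∣j∣ (+ b) (+ a))) (ℕ.≤-reflexive (ℤ.∣-i∣≡∣i∣ (+ c)))
  parity : + 2 ℤD.∣ (+ b - + a) + (- + c) - + (a ℕ.+ b ℕ.+ c)
  parity = subst (+ 2 ℤD.∣_) (sym (solve 3 (λ a b c → (b :- a) :+ (:- c) :- (a :+ b :+ c) := :- (con (+ 2) :* (a :+ c))) refl (+ a) (+ b) (+ c)))
    (subst (2 ℕD.∣_) (sym (trans (ℤ.∣-i∣≡∣i∣ (+ 2 ℤ.* + (a ℕ.+ c))) (ℤ.abs-* (+ 2) (+ (a ℕ.+ c))))) (ℕD.m∣m*n (a ℕ.+ c)))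
    where open +-*-Solver

even-part : ∀ e w z → + 2 ℤD.∣ w → + e ≡ - w - + 2 ℤ.* z → ∃[ q ] e ≡ q ℕ.* 2
even-part e w z even eq with ∣⇒∣ᵤ (subst (+ 2 ∣_) (sym eq)
    (∣m∣n⇒∣m-n (∣m⇒∣-m (∣ᵤ⇒∣ {+ 2} {w} even)) (∣m⇒∣m*n z ∣-refl)))
... | ℕD.divides q p = q , p

-- The slack `e` in the bound on the absolute values is even by the parity condition. Half of it is
-- the smaller of the distances from the western and eastern sides.
pos-surjective : ∀ {n} P → InV n P → ∃[ x ] size x ≡ n × pos x ≡ P
pos-surjective {n} (i , j) (le , neg , even) = start j neg le even
  where
  open +-*-Solver
  open ℕ.+-*-Solver using () renaming (solve to solveₙ; _:+_ to _:+ₙ_; _:*_ to _:*ₙ_; _:=_ to _:=ₙ_; con to conₙ)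
  excess⁺ : ∀ k c e → + e ≡ - (+ k + - + c - + (k ℕ.+ c ℕ.+ e)) - + 2 ℤ.* + c
  excess⁺ k c e = solve 3 (λ k c e → e := :- (k :+ (:- c) :- (k :+ c :+ e)) :- con (+ 2) :* c) refl (+ k) (+ c) (+ e)
  excess⁻ : ∀ k c e → + e ≡ - (- + k + - + c - + (k ℕ.+ c ℕ.+ e)) - + 2 ℤ.* (+ k + + c)
  excess⁻ k c e = solve 3 (λ k c e → e := :- (:- k :+ (:- c) :- (k :+ c :+ e)) :- con (+ 2) :* (k :+ c)) refl (+ k) (+ c) (+ e)
  right : ∀ k c e → ∃[ q ] e ≡ q ℕ.* 2 → ∃[ x ] size x ≡ k ℕ.+ c ℕ.+ e × pos x ≡ (+ k , - + c)
  right k c _ (q , refl) = ⟨ q , q ℕ.+ k , c ⟩ ,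
    solveₙ 3 (λ q k c → q :+ₙ (q :+ₙ k) :+ₙ c :=ₙ k :+ₙ c :+ₙ q :*ₙ conₙ 2) refl q k c ,
    cong (_, - + c) (solve 2 (λ q k → (q :+ k) :- q := k) refl (+ q) (+ k))
  left : ∀ k c e → ∃[ q ] e ≡ q ℕ.* 2 → ∃[ x ] size x ≡ k ℕ.+ c ℕ.+ e × pos x ≡ (- + k , - + c)
  left k c _ (q , refl) = ⟨ q ℕ.+ k , q , c ⟩ ,
    solveₙ 3 (λ q k c → (q :+ₙ k) :+ₙ q :+ₙ c :=ₙ k :+ₙ c :+ₙ q :*ₙ conₙ 2) refl q k c ,
    cong (_, - + c) (solve 2 (λ q k → q :- (q :+ k) := :- k) refl (+ q) (+ k))
  go : ∀ i c e → ∣ i ∣ ℕ.+ c ℕ.+ e ≡ n → + 2 ℤD.∣ (i + - + c - + n) → ∃[ x ] size x ≡ n × pos x ≡ (i , - + c)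
  go (+ k) c e refl even = right k c e (even-part e (+ k + - + c - + n) (+ c) even (excess⁺ k c e))
  go -[1+ k ] c e refl even = left (suc k) c e (even-part e (- + suc k + - + c - + n) (+ suc k + + c) even (excess⁻ (suc k) c e))
  start : ∀ j → j ℤ.≤ + 0 → ∣ i ∣ ℕ.+ ∣ j ∣ ℕ.≤ n → + 2 ℤD.∣ (i + j - + n) → ∃[ x ] size x ≡ n × pos x ≡ (i , j)
  start (+ zero) _ le even = go i 0 _ (ℕ.m+[n∸m]≡n le) even
  start (+ suc _) (ℤ.+≤+ ()) _ _
  start -[1+ c ] _ le even = go i (suc c) _ (ℕ.m+[n∸m]≡n le) even

meet : ∀ {i j k x y} → Perm i j k → inc i x ≡ inc j y → ∃[ t ] x ≡ inc j t × y ≡ inc i t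
meet wes refl = _ , refl , refl
meet wse refl = _ , refl , refl
meet ews refl = _ , refl , refl
meet esw refl = _ , refl , refl
meet swe refl = _ , refl , refl
meet sew refl = _ , refl , refl

dir : ∀ {i j k} → Perm i j k → Dir
dir wes = Dir.R
dir wse = Dir.DR
dir ews = Dir.L
dir esw = Dir.DL
dir swe = Dir.UL
dir sew = Dir.UR

shift-dir : ∀ {i j k} (π : Perm i j k) → shift j ≡ shift i ⊕ offset (dir π)
shift-dir wes = refl
shift-dir wse = refl
shift-dir ews = refl
shift-dir esw = refl
shift-dir swe = refl
shift-dir sew = refl

⊕-assoc : ∀ p q r → (p ⊕ q) ⊕ r ≡ p ⊕ (q ⊕ r)
⊕-assoc (a , b) (c , d) (e , f) = cong₂ _,_ (ℤ.+-assoc a c e) (ℤ.+-assoc b d f)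

pos-dir : ∀ {i j k} (π : Perm i j k) t → pos (inc j t) ≡ pos (inc i t) ⊕ offset (dir π)
pos-dir {i} {j} π t = trans (pos-inc j t) (trans (cong (pos t ⊕_) (shift-dir π))
  (trans (sym (⊕-assoc (pos t) (shift i) _)) (cong (_⊕ offset (dir π)) (sym (pos-inc i t)))))

dir-step : ∀ {i j k} (π : Perm i j k) → LatticeStep (proj₁ (offset (dir π))) (proj₂ (offset (dir π)))
dir-step wes = LatticeStep.r
dir-step wse = LatticeStep.dr
dir-step ews = LatticeStep.l
dir-step esw = LatticeStep.dl
dir-step swe = LatticeStep.ul
dir-step sew = LatticeStep.ur

step-dir : ∀ {dx dy} → LatticeStep dx dy → ∃[ i ] ∃[ j ] ∃[ k ] Σ (Perm i j k) λ π → (dx , dy) ≡ offset (dir π)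
step-dir LatticeStep.r = _ , _ , _ , wes , refl
step-dir LatticeStep.l = _ , _ , _ , ews , refl
step-dir LatticeStep.ur = _ , _ , _ , sew , refl
step-dir LatticeStep.ul = _ , _ , _ , swe , refl
step-dir LatticeStep.dr = _ , _ , _ , wse , refl
step-dir LatticeStep.dl = _ , _ , _ , esw , refl

cancel : ∀ p q → (p + q) - p ≡ q
cancel = solve 2 (λ p q → (p :+ q) :- p := q) refl
  where open +-*-Solver

restore : ∀ p q → p + (q - p) ≡ q
restore = solve 2 (λ p q → p :+ (q :- p) := q) refl
  where open +-*-Solver

joins-lattice : ∀ {n z x y} → suc (size (proj₁ z)) ≡ n → Joins z x y → LatticeEdge n (pos x) (pos y)
joins-lattice {n} {t , k} st e with joins-inv {t} {k} e
... | i , j , π , refl , refl = pos-InV (inc i t) (trans (size-inc i t) st) , pos-InV (inc j t) (trans (size-inc j t) st) ,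
  subst (λ q → LatticeStep (proj₁ q - proj₁ (pos (inc i t))) (proj₂ q - proj₂ (pos (inc i t)))) (sym (pos-dir π t))
    (subst₂ LatticeStep (sym (cancel (proj₁ (pos (inc i t))) _)) (sym (cancel (proj₂ (pos (inc i t))) _)) (dir-step π))

-- A step in the direction from corner `i` to corner `j` means that `inc j x` and `inc i y` have the
-- same position one size up, hence are equal; `meet` then produces the big triangle containing both
-- cells.
lattice-joins : ∀ {n x y} → size x ≡ n → size y ≡ n →
                LatticeStep (proj₁ (pos y) - proj₁ (pos x)) (proj₂ (pos y) - proj₂ (pos x)) →
                ∃[ z ] suc (size (proj₁ z)) ≡ n × Joins z x y
lattice-joins {n} {x} {y} sx sy st with step-dir st
... | i , j , k , π , e with meet (swap₁₂ π) (pos-injective (inc j x) (inc i y) sizes (trans (pos-inc j x) (trans shifted (sym (pos-inc i y)))))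
  where
  sizes : size (inc j x) ≡ size (inc i y)
  sizes = trans (size-inc j x) (trans (cong suc (trans sx (sym sy))) (sym (size-inc i y)))
  y≡ : pos y ≡ pos x ⊕ offset (dir π)
  y≡ = trans (sym (cong₂ _,_ (restore (proj₁ (pos x)) (proj₁ (pos y))) (restore (proj₂ (pos x)) (proj₂ (pos y)))))
         (cong (pos x ⊕_) e)
  comm : ∀ p q → p ⊕ q ≡ q ⊕ p
  comm (a , b) (c , d) = cong₂ _,_ (ℤ.+-comm a c) (ℤ.+-comm b d)
  shifted : pos x ⊕ shift j ≡ pos y ⊕ shift i
  shifted = trans (cong (pos x ⊕_) (trans (shift-dir π) (comm (shift i) (offset (dir π)))))
    (trans (sym (⊕-assoc (pos x) (offset (dir π)) (shift i))) (cong (_⊕ shift i) (sym y≡)))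
... | t , refl , refl = (t , k) , trans (sym (size-inc i t)) sx , joins-perm π t

consecutive : ∀ τ {i j k} → Perm i j k → Consecutive (pos (vertex τ j)) (pos (vertex τ k)) (pos (vertex τ i))
consecutive (big t) π = dir (rotate π) , dir (swap₁₂ π) , next π , pos-dir (rotate π) t , pos-dir (swap₁₂ π) t
  where
  next : ∀ {i j k} (π : Perm i j k) → NextDir (dir (rotate π)) (dir (swap₁₂ π)) ⊎ NextDir (dir (swap₁₂ π)) (dir (rotate π))
  next wes = inj₁ DL→L
  next wse = inj₂ UL→UR
  next ews = inj₂ R→DR
  next esw = inj₁ UL→UR
  next swe = inj₁ R→DR
  next sew = inj₂ DL→L
consecutive (opp c) {i} {j} {k} π = dir (swap₁₃ π) , dir π , next π ,
  subst₂ (λ p q → pos q ≡ pos p ⊕ offset (dir (swap₁₃ π))) (sym (oppVertex-perm (rotate (rotate π)) c)) (sym (oppVertex-perm (swap₁₂ π) c)) (pos-dir (swap₁₃ π) (inc i c)) ,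
  subst₂ (λ p q → pos q ≡ pos p ⊕ offset (dir π)) (sym (oppVertex-perm (swap₂₃ π) c)) (sym (oppVertex-perm (rotate π) c)) (pos-dir π (inc k c))
  where
  next : ∀ {i j k} (π : Perm i j k) → NextDir (dir (swap₁₃ π)) (dir π) ⊎ NextDir (dir π) (dir (swap₁₃ π))
  next wes = inj₁ UR→R
  next wse = inj₂ DR→DL
  next ews = inj₂ L→UL
  next esw = inj₁ DR→DL
  next swe = inj₁ L→UL
  next sew = inj₂ UR→R

slot-unique : ∀ {t t′ i j k i′ j′ k′} → Perm i j k → Perm i′ j′ k′ →
              inc i t ≡ inc i′ t′ → inc j t ≡ inc j′ t′ → (t , k) ≡ (t′ , k′)
slot-unique wes wes refl refl = refl
slot-unique wes wse refl ()
slot-unique wes ews refl ()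
slot-unique wes esw refl ()
slot-unique wes swe refl ()
slot-unique wes sew refl ()
slot-unique wse wes refl ()
slot-unique wse wse refl refl = refl
slot-unique wse ews refl ()
slot-unique wse esw refl ()
slot-unique wse swe refl ()
slot-unique wse sew refl ()
slot-unique ews wes refl ()
slot-unique ews wse refl ()
slot-unique ews ews refl refl = refl
slot-unique ews esw refl ()
slot-unique ews swe refl ()
slot-unique ews sew refl ()
slot-unique esw wes refl ()
slot-unique esw wse refl ()
slot-unique esw ews refl ()
slot-unique esw esw refl refl = refl
slot-unique esw swe refl ()
slot-unique esw sew refl ()
slot-unique swe wes refl ()
slot-unique swe wse refl ()
slot-unique swe ews refl ()
slot-unique swe esw refl ()
slot-unique swe swe refl refl = refl
slot-unique swe sew refl ()
slot-unique sew wes refl ()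
slot-unique sew wse refl ()
slot-unique sew ews refl ()
slot-unique sew esw refl ()
slot-unique sew swe refl ()
slot-unique sew sew refl refl = refl

-- Representing plane graphs by states

open Equivalence using (to; from)

_≟ₚ_ : DecidableEquality Point
_≟ₚ_ = ≡-dec ℤ._≟_ ℤ._≟_

module _ {R : Point → Point → Set} where

  data Walk : Point → List Point → Point → Set where
    stop : ∀ {x} → Walk x [] x
    hop  : ∀ {x y z vs} → R x y → Walk y vs z → Walk x (y ∷ vs) z

  walk-from : ∀ {x w vs y} → Walk w vs y → Unique (w ∷ vs) → x ∈ (w ∷ vs) → ∃[ us ] Walk x us y × Unique (x ∷ us)
  walk-from p u (here refl) = _ , p , u
  walk-from (hop r p) (_ ∷ u) (there i) = walk-from p u i

  simplePath : ∀ {x y} → Star R x y → ∃[ vs ] Walk x vs y × Unique (x ∷ vs)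
  simplePath ε = [] , stop , [] ∷ []
  simplePath {x} (r ◅ s) with simplePath s
  ... | vs , p , u with any? (x ≟ₚ_) (_ ∷ vs)
  ...   | yes i = walk-from p u i
  ...   | no ¬i = _ , hop r p , ¬Any⇒All¬ _ ¬i ∷ u

walk-chain : ∀ {R} {G : Graph} → (∀ {P Q} → R P Q → Edge G P Q) → ∀ {x vs y w} → Walk {R} x vs y → Edge G y w →
             Chain G (x ∷ vs ++ [ w ])
walk-chain f stop e = e , tt
walk-chain f (hop r stop) e = f r , e , tt
walk-chain f (hop r p@(hop _ _)) e = f r , walk-chain f p e

Avoiding : Graph → Point → Point → Point → Point → Set
Avoiding G x y a b = Edge G a b × ¬ SamePair a b x y

-- A simple path avoiding the edge has at least two edges, so closing it yields a list of the form
-- demanded by `HasCycle`.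
detour-cycle : ∀ {G x y} → x ≢ y → Edge G y x → Star (Avoiding G x y) x y → HasCycle G
detour-cycle {G} {x} {y} x≢y e s with simplePath s
... | [] , stop , _ = ⊥-elim (x≢y refl)
... | (_ ∷ []) , hop (_ , ne) stop , _ = ⊥-elim (ne (inj₁ (refl , refl)))
... | (v ∷ w ∷ vs) , p , u = x , v ∷ w ∷ vs , s≤s (s≤s z≤n) , u , walk-chain proj₁ p e

cycle-detour : ∀ {G} → HasCycle G → ∃[ x ] ∃[ y ] Edge G x y × Star (Avoiding G x y) y x
cycle-detour (x , [] , () , _)
cycle-detour (x , y ∷ [] , s≤s () , _)
cycle-detour {G} (x , y ∷ w ∷ vs , _ , (x∉ ∷ (y∉ ∷ _)) , (e , ch)) = x , y , e , follow y (w ∷ vs) x∉ y∉ (inj₂ λ ()) ch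
  where
  -- The alternative ensures that the closing edge is not the avoided one: at the start `a` is `y`
  -- but vertices remain, and afterwards `a` differs from `y`.
  follow : ∀ a as → All (x ≢_) (a ∷ as) → All (y ≢_) as → (y ≢ a ⊎ as ≢ []) → Chain G (a ∷ as ++ [ x ]) →
           Star (Avoiding G x y) a x
  follow a [] (x≢a ∷ _) _ (inj₁ y≢a) (e , _) =
    (e , λ { (inj₁ (p , _)) → x≢a (sym p) ; (inj₂ (p , _)) → y≢a (sym p) }) ◅ ε
  follow a [] _ _ (inj₂ ne) _ = ⊥-elim (ne refl)
  follow a (b ∷ bs) (x≢a ∷ x∉@(x≢b ∷ _)) (y≢b ∷ y∉) _ (e , ch) =
    (e , λ { (inj₁ (p , _)) → x≢a (sym p) ; (inj₂ (_ , p)) → x≢b (sym p) }) ◅ follow b bs x∉ y∉ (inj₁ y≢b) ch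

EdgeOf : (Slot → Set) → Point → Point → Set
EdgeOf P A B = ∃[ x ] ∃[ y ] Adj P x y × A ≡ pos x × B ≡ pos y

Rep : ℕ → Graph → State → Set
Rep n G S = ∀ A B → Edge G A B ⇔ EdgeOf (On n S) A B

joins-size : ∀ z {x y n} → suc (size (proj₁ z)) ≡ n → Joins z x y → size x ≡ n × size y ≡ n
joins-size (t , k) st e with joins-inv {t} {k} e
... | i , j , π , refl , refl = trans (size-inc i t) st , trans (size-inc j t) st

joins-unique : ∀ z z′ {x y} → Joins z x y → Joins z′ x y → z ≡ z′
joins-unique (t , k) (t′ , k′) e e′ with joins-inv {t} {k} e | joins-inv {t′} {k′} e′
... | i , j , π , refl , refl | i′ , j′ , π′ , p , q = slot-unique π π′ p q

samePair-slot : ∀ {n} z z′ {x y x′ y′} → suc (size (proj₁ z)) ≡ n → suc (size (proj₁ z′)) ≡ n →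
                Joins z x y → Joins z′ x′ y′ → SamePair (pos x) (pos y) (pos x′) (pos y′) → z ≡ z′
samePair-slot z z′ {x} {y} {x′} {y′} st st′ e e′ same with joins-size z st e | joins-size z′ st′ e′ | same
... | sx , sy | sx′ , sy′ | inj₁ (p , q) with pos-injective x x′ (trans sx (sym sx′)) p | pos-injective y y′ (trans sy (sym sy′)) q
...   | refl | refl = joins-unique z z′ e e′
samePair-slot z z′ {x} {y} {x′} {y′} st st′ e e′ same | sx , sy | sx′ , sy′ | inj₂ (p , q)
  with pos-injective x y′ (trans sx (sym sy′)) p | pos-injective y x′ (trans sy (sym sx′)) q
... | refl | refl = joins-unique z z′ e (joins-sym {i = z′} e′)

slot-samePair : ∀ z {x y x′ y′} → Joins z x y → Joins z x′ y′ → SamePair (pos x) (pos y) (pos x′) (pos y′)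
slot-samePair z (inj₁ (refl , refl)) (inj₁ (refl , refl)) = inj₁ (refl , refl)
slot-samePair z (inj₁ (refl , refl)) (inj₂ (refl , refl)) = inj₂ (refl , refl)
slot-samePair z (inj₂ (refl , refl)) (inj₁ (refl , refl)) = inj₂ (refl , refl)
slot-samePair z (inj₂ (refl , refl)) (inj₂ (refl , refl)) = inj₁ (refl , refl)

pos-conn : ∀ {n} {P : Slot → Set} {R : Point → Point → Set} → (∀ z → P z → suc (size (proj₁ z)) ≡ n) →
           (∀ {A B} → R A B → EdgeOf P A B) →
           ∀ {x y} → size x ≡ n → size y ≡ n → Star R (pos x) (pos y) → Conn P x y
pos-conn {n} {P} {R} lev f sx sy s = walk sx sy refl refl s
  where
  walk : ∀ {x y A B} → size x ≡ n → size y ≡ n → A ≡ pos x → B ≡ pos y → Star R A B → Conn P x y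
  walk {x} {y} sx sy a b ε with pos-injective x y (trans sx (sym sy)) (trans (sym a) b)
  ... | refl = ε
  walk {x} sx sy a b (r ◅ s) with f r
  ... | x′ , w , (z , p , e) , a′ , c with joins-size z (lev z p) e
  ...   | sx′ , sw with pos-injective x x′ (trans sx (sym sx′)) (trans (sym a) a′)
  ...     | refl = (z , p , e) ◅ walk sw sy c b s

module _ {n G S} (rep : Rep n G S) where

  conn⇒connected : ∀ {x y} → Conn (On n S) x y → Connected G (pos x) (pos y)
  conn⇒connected = gmap pos λ a → from (rep _ _) (_ , _ , a , refl , refl)

  connected⇒conn : ∀ {x y} → size x ≡ n → size y ≡ n → Connected G (pos x) (pos y) → Conn (On n S) x y
  connected⇒conn = pos-conn (λ _ → proj₁) (to (rep _ _))

  edge-slot : ∀ z {x y} → On n S z → Joins z x y → Edge G (pos x) (pos y)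
  edge-slot z o e = from (rep _ _) (_ , _ , (z , o , e) , refl , refl)

  acyclic⇒forest : ¬ HasCycle G → Forest (On n S)
  acyclic⇒forest ac z o p = ac (detour-cycle x≢y (edge-slot z o (inj₂ (refl , refl))) (gmap pos convert p))
    where
    sizes = joins-size z {source z} {sink z} (proj₁ o) (inj₁ (refl , refl))
    source≢target : ∀ z → source z ≢ sink z
    source≢target (t , west) ()
    source≢target (t , east) ()
    source≢target (t , south) ()
    x≢y : pos (source z) ≢ pos (sink z)
    x≢y e = source≢target z (pos-injective _ _ (trans (proj₁ sizes) (sym (proj₂ sizes))) e)
    convert : ∀ {a b} → Adj (Without (On n S) z) a b → Avoiding G (pos (source z)) (pos (sink z)) (pos a) (pos b)
    convert (z′ , (o′ , ne) , e) = edge-slot z′ o′ e ,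
      λ same → ne (samePair-slot z′ z (proj₁ o′) (proj₁ o) e (inj₁ (refl , refl)) same)

  forest⇒acyclic : Forest (On n S) → ¬ HasCycle G
  forest⇒acyclic F cyc with cycle-detour cyc
  ... | A , B , e , s with to (rep A B) e
  ... | x , y , (z , o , jz) , refl , refl with joins-size z (proj₁ o) jz
  ... | sx , sy = bridge F o (joins-sym {i = z} jz)
    (pos-conn {P = Without (On n S) z} (λ _ (o , _) → proj₁ o) convert sy sx s)
    where
    convert : ∀ {A B} → Avoiding G (pos x) (pos y) A B → EdgeOf (Without (On n S) z) A B
    convert {A} {B} (e , ne) with to (rep A B) e
    ... | x′ , y′ , (z′ , o′ , jz′) , refl , refl =
      x′ , y′ , (z′ , (o′ , λ { refl → ne (slot-samePair z jz′ jz) }) , jz′) , refl , refl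

-- Turning a state back into a plane graph

Hit : ℕ → State → Point → Point → Slot → Set
Hit n S A B z = (suc (size (proj₁ z)) ≡ n × S z ≡ true) ×
  ((A ≡ pos (source z) × B ≡ pos (sink z)) ⊎ (A ≡ pos (sink z) × B ≡ pos (source z)))

hit? : ∀ n S A B z → Dec (Hit n S A B z)
hit? n S A B z = ((suc (size (proj₁ z)) ℕ.≟ n) ×-dec (S z Bool.≟ true)) ×-dec
  (((A ≟ₚ pos (source z)) ×-dec (B ≟ₚ pos (sink z))) ⊎-dec ((A ≟ₚ pos (sink z)) ×-dec (B ≟ₚ pos (source z))))

slots : ℕ → List Slot
slots n = cartesianProductWith _,_ (cells (pred n)) (west ∷ east ∷ south ∷ [])

∈-slots : ∀ {n} z → suc (size (proj₁ z)) ≡ n → z ∈ slots n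
∈-slots (t , k) refl = ∈-cartesianProductWith⁺ _,_ (∈-cells t) (∈-corners k)
  where
  ∈-corners : ∀ k → k ∈ (west ∷ east ∷ south ∷ [])
  ∈-corners west = here refl
  ∈-corners east = there (here refl)
  ∈-corners south = there (there (here refl))

does-true : ∀ {P : Set} (P? : Dec P) → does P? ≡ true → P
does-true (yes p) _ = p

abstract
  represent : ∀ n S → ∃[ G ] Rep n G S
  represent n S = (λ A B → does (present? A B)) , λ A B → mk⇔ (forth A B) (back A B)
    where
    present? : ∀ A B → Dec (Any (Hit n S A B) (slots n))
    present? A B = any? (hit? n S A B) (slots n)
    forth : ∀ A B → does (present? A B) ≡ true → EdgeOf (On n S) A B
    forth A B e with find (does-true (present? A B) e)
    ... | z , _ , o , inj₁ (p , q) = _ , _ , (z , o , inj₁ (refl , refl)) , p , q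
    ... | z , _ , o , inj₂ (p , q) = _ , _ , (z , o , inj₂ (refl , refl)) , p , q
    back : ∀ A B → EdgeOf (On n S) A B → does (present? A B) ≡ true
    back A B (x , y , (z , o , inj₁ (refl , refl)) , p , q) =
      dec-true (present? A B) (lose (∈-slots z (proj₁ o)) (o , inj₁ (p , q)))
    back A B (x , y , (z , o , inj₂ (refl , refl)) , p , q) =
      dec-true (present? A B) (lose (∈-slots z (proj₁ o)) (o , inj₂ (p , q)))

-- Moves are spins

-- By `apart`, a boundary set has at most one member on each side. Combined with `setsSeparated`
-- this gives the field `separated` of `Grove`.
record BoundaryCells (n : ℕ) (T : List Point) : Set where
  field
    members : List Cell
    image   : T ≡ map pos members
    sizes   : All (λ b → size b ≡ n) members
    onSide  : All (λ b → ∃[ k ] coord k b ≡ 0) members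
    apart   : 1 ℕ.≤ n → ∀ k {a b} → a ∈ members → b ∈ members → coord k a ≡ 0 → coord k b ≡ 0 → a ≡ b

Apart : Cell → Cell → Set
Apart a b = ∀ k → coord k a ≡ 0 → coord k b ≡ 0 → ⊥

apart₁ : ∀ {x k a b} → a ∈ (x ∷ []) → b ∈ (x ∷ []) → coord k a ≡ 0 → coord k b ≡ 0 → a ≡ b
apart₁ (here refl) (here refl) _ _ = refl

apart₂ : ∀ {x y} → Apart x y → ∀ k {a b} → a ∈ (x ∷ y ∷ []) → b ∈ (x ∷ y ∷ []) → coord k a ≡ 0 → coord k b ≡ 0 → a ≡ b
apart₂ xy k (here refl) (here refl) _ _ = refl
apart₂ xy k (here refl) (there (here refl)) p q = ⊥-elim (xy k p q)
apart₂ xy k (there (here refl)) (here refl) p q = ⊥-elim (xy k q p)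
apart₂ xy k (there (here refl)) (there (here refl)) _ _ = refl

apart₃ : ∀ {x y z} → Apart x y → Apart x z → Apart y z → ∀ k {a b} →
         a ∈ (x ∷ y ∷ z ∷ []) → b ∈ (x ∷ y ∷ z ∷ []) → coord k a ≡ 0 → coord k b ≡ 0 → a ≡ b
apart₃ xy xz yz k (here refl) (here refl) _ _ = refl
apart₃ xy xz yz k (here refl) (there (here refl)) p q = ⊥-elim (xy k p q)
apart₃ xy xz yz k (here refl) (there (there (here refl))) p q = ⊥-elim (xz k p q)
apart₃ xy xz yz k (there (here refl)) (here refl) p q = ⊥-elim (xy k q p)
apart₃ xy xz yz k (there (there (here refl))) (here refl) p q = ⊥-elim (xz k q p)
apart₃ xy xz yz k (there i) (there j) p q = apart₂ yz k i j p q

minus-sum : ∀ a b → + a - + (b ℕ.+ a) ≡ - + b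
minus-sum a b = solve 2 (λ a b → a :- (b :+ a) := :- b) refl (+ a) (+ b)
  where open +-*-Solver

sum-minus : ∀ a b → + (b ℕ.+ a) - + a ≡ + b
sum-minus a b = solve 2 (λ a b → (b :+ a) :- a := b) refl (+ a) (+ b)
  where open +-*-Solver

boundaryCells : ∀ {n T} → BoundarySet n T → BoundaryCells n T
boundaryCells {n} westCorner = record
  { members = ⟨ n , 0 , 0 ⟩ ∷ []
  ; image = cong (λ x → pt x (+ 0) ∷ []) (sym (ℤ.+-identityˡ (- + n)))
  ; sizes = trans (ℕ.+-identityʳ _) (ℕ.+-identityʳ n) ∷ []
  ; onSide = (east , refl) ∷ []
  ; apart = λ _ k → apart₁ {k = k} }
boundaryCells {n} eastCorner = record
  { members = ⟨ 0 , n , 0 ⟩ ∷ []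
  ; image = cong (λ x → pt x (+ 0) ∷ []) (sym (ℤ.+-identityʳ (+ n)))
  ; sizes = ℕ.+-identityʳ n ∷ []
  ; onSide = (west , refl) ∷ []
  ; apart = λ _ k → apart₁ {k = k} }
boundaryCells {n} southCorner = record
  { members = ⟨ 0 , 0 , n ⟩ ∷ []
  ; image = refl
  ; sizes = refl ∷ []
  ; onSide = (west , refl) ∷ []
  ; apart = λ _ k → apart₁ {k = k} }
boundaryCells (westPair (suc i) (suc d) (s≤s z≤n) (s≤s z≤n) refl) = record
  { members = ⟨ suc i ℕ.+ suc d , suc d , 0 ⟩ ∷ ⟨ suc i ℕ.+ suc d , 0 , suc d ⟩ ∷ []
  ; image = cong₂ (λ x y → pt x (+ 0) ∷ pt y (- + suc d) ∷ []) (sym (minus-sum (suc d) (suc i)))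
              (sym (ℤ.+-identityˡ (- + (suc i ℕ.+ suc d))))
  ; sizes = solve 2 (λ i d → (i :+ d) :+ d :+ con 0 := i :+ con 2 :* d) refl (suc i) (suc d) ∷
            solve 2 (λ i d → (i :+ d) :+ con 0 :+ d := i :+ con 2 :* d) refl (suc i) (suc d) ∷ []
  ; onSide = (south , refl) ∷ (east , refl) ∷ []
  ; apart = λ _ → apart₂ λ { west () ; east () ; south _ () } }
  where open ℕ.+-*-Solver
boundaryCells (eastPair (suc i) (suc d) (s≤s z≤n) (s≤s z≤n) refl) = record
  { members = ⟨ suc d , suc i ℕ.+ suc d , 0 ⟩ ∷ ⟨ 0 , suc i ℕ.+ suc d , suc d ⟩ ∷ []
  ; image = cong₂ (λ x y → pt x (+ 0) ∷ pt y (- + suc d) ∷ []) (sym (sum-minus (suc d) (suc i)))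
              (sym (ℤ.+-identityʳ (+ (suc i ℕ.+ suc d))))
  ; sizes = solve 2 (λ i d → d :+ (i :+ d) :+ con 0 := i :+ con 2 :* d) refl (suc i) (suc d) ∷
            solve 2 (λ i d → (i :+ d) :+ d := i :+ con 2 :* d) refl (suc i) (suc d) ∷ []
  ; onSide = (south , refl) ∷ (west , refl) ∷ []
  ; apart = λ _ → apart₂ λ { west () ; east () ; south _ () } }
  where open ℕ.+-*-Solver
boundaryCells {n} (southPair i n<2i i<n) = fromGap (ℕ.m≤n⇒∃[o]m+o≡n i<n)
  where
  fromGap : ∃[ o ] suc i ℕ.+ o ≡ n → BoundaryCells n _
  fromGap (o , refl) = record
    { members = ⟨ suc o , 0 , i ⟩ ∷ ⟨ 0 , suc o , i ⟩ ∷ []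
    ; image = cong₂ (λ x y → pt x (- + i) ∷ pt y (- + i) ∷ [])
        (S.solve 2 (λ i o → i S.:- (S.con (+ 1) S.:+ i S.:+ o) S.:= S.con (+ 0) S.:- (S.con (+ 1) S.:+ o)) refl (+ i) (+ o))
        (S.solve 2 (λ i o → (S.con (+ 1) S.:+ i S.:+ o) S.:- i S.:= (S.con (+ 1) S.:+ o) S.:- S.con (+ 0)) refl (+ i) (+ o))
    ; sizes = solve 2 (λ i o → (con 1 :+ o) :+ con 0 :+ i := con 1 :+ i :+ o) refl i o ∷
              solve 2 (λ i o → (con 1 :+ o) :+ i := con 1 :+ i :+ o) refl i o ∷ []
    ; onSide = (east , refl) ∷ (west , refl) ∷ []
    -- Both members could lie on the upper side only for `i = 0`, which `n < 2 * i` excludes.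
    ; apart = λ _ → apart₂ λ { west () ; east _ () ; south e _ → ℕ.<⇒≱ n<2i (subst (λ j → 2 ℕ.* j ℕ.≤ suc i ℕ.+ o) (sym e) z≤n) } }
    where
    open ℕ.+-*-Solver
    module S = +-*-Solver
boundaryCells (middleTriplet m refl) = record
  { members = ⟨ m , m , 0 ⟩ ∷ ⟨ m , 0 , m ⟩ ∷ ⟨ 0 , m , m ⟩ ∷ []
  ; image = cong₂ (λ x y → pt x (+ 0) ∷ y) (sym (ℤ.+-inverseʳ (+ m)))
      (cong₂ (λ x y → pt x (- + m) ∷ pt y (- + m) ∷ []) (sym (ℤ.+-identityˡ (- + m))) (sym (ℤ.+-identityʳ (+ m))))
  ; sizes = solve 1 (λ m → m :+ m :+ con 0 := con 2 :* m) refl m ∷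
            solve 1 (λ m → m :+ con 0 :+ m := con 2 :* m) refl m ∷
            solve 1 (λ m → m :+ m := con 2 :* m) refl m ∷ []
  ; onSide = (south , refl) ∷ (east , refl) ∷ (west , refl) ∷ []
  ; apart = λ 1≤n → let m≢0 = positive 1≤n in apart₃
      (λ { west p _ → m≢0 p ; east p _ → m≢0 p ; south _ q → m≢0 q })
      (λ { west p _ → m≢0 p ; east p _ → m≢0 p ; south _ q → m≢0 q })
      (λ { west p _ → m≢0 p ; east _ q → m≢0 q ; south p _ → m≢0 p }) }
  where
  open ℕ.+-*-Solver
  positive : 1 ℕ.≤ 2 ℕ.* m → m ≢ 0
  positive () refl

boundary-cell : ∀ {n T A} → BoundarySet n T → A ∈ T → ∃[ b ] A ≡ pos b × size b ≡ n × ∃[ k ] coord k b ≡ 0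
boundary-cell {A = A} bs i with ∈-map⁻ pos (subst (A ∈_) (BoundaryCells.image (boundaryCells bs)) i)
... | b , j , refl = b , refl , All.lookup (BoundaryCells.sizes (boundaryCells bs)) j ,
  All.lookup (BoundaryCells.onSide (boundaryCells bs)) j

bool-ext : ∀ {a b : Bool} → (a ≡ true → b ≡ true) → (b ≡ true → a ≡ true) → a ≡ b
bool-ext {false} {false} f g = refl
bool-ext {false} {true} f g = g refl
bool-ext {true} {b} f g = sym (f refl)

module _ {n G G′ S S′} (sg : IsSimplifiedGrove n G) (rep : Rep n G S) (rep′ : Rep n G′ S′)
         (F : Forest (On n S)) {Moving : Cell → Set} (same : SameConn n S S′ Moving) where
  open IsSimplifiedGrove sg
  open SameConn same renaming (to to forth; from to back)

  private
    still : ∀ k {b} → coord k b ≡ 0 → ¬ Moving b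
    still k e m = interior m k e

  -- Boundary vertices never move, so connections among them carry over in both directions; a turned
  -- leaf is covered through its anchor.
  moved-grove : IsSimplifiedGrove n G′
  moved-grove = record
    { symmetric = λ A B → bool-ext (flip A B) (flip B A)
    ; lattice = lattice′
    ; acyclic = forest⇒acyclic rep′ (forest′ F)
    ; setConnected = connected′
    ; setsSeparated = separated′
    ; covered = covered′ }
    where
    flip : ∀ A B → Edge G′ A B → Edge G′ B A
    flip A B e with to (rep′ A B) e
    ... | x , y , (z , o , j) , p , q = from (rep′ B A) (y , x , (z , o , joins-sym {i = z} j) , q , p)
    lattice′ : ∀ A B → Edge G′ A B → _
    lattice′ A B e with to (rep′ A B) e
    ... | x , y , (z , o , j) , refl , refl = joins-lattice {z = z} (proj₁ o) j
    connected′ : ∀ T → BoundarySet n T → ∀ x y → x ∈ T → y ∈ T → Connected G′ x y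
    connected′ T bs x y i j with boundary-cell bs i | boundary-cell bs j
    ... | a , refl , sa , k , ca | b , refl , sb , l , cb =
      conn⇒connected rep′ (forth (still k ca) (still l cb) (connected⇒conn rep sa sb (setConnected T bs _ _ i j)))
    separated′ : ∀ T T′ → BoundarySet n T → BoundarySet n T′ → ∀ x y → x ∈ T → y ∈ T′ → Connected G′ x y → T ≡ T′
    separated′ T T′ bs bs′ x y i j c with boundary-cell bs i | boundary-cell bs′ j
    ... | a , refl , sa , k , ca | b , refl , sb , l , cb =
      setsSeparated T T′ bs bs′ _ _ i j (conn⇒connected rep (back (still k ca) (still l cb) (connected⇒conn rep′ sa sb c)))
    Covered : Point → Set
    Covered v = ∃[ T ] BoundarySet n T × (∃[ x ] x ∈ T × Connected G′ v x)
    coverStill : ∀ x → size x ≡ n → ¬ Moving x → Covered (pos x)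
    coverStill x sx nm with covered (pos x) (pos-InV x sx)
    ... | T , bs , A , i , c with boundary-cell bs i
    ...   | b , refl , sb , k , cb = T , bs , pos b , i ,
      conn⇒connected rep′ (forth nm (still k cb) (connected⇒conn rep sx sb c))
    covered′ : ∀ v → InV n v → Covered v
    covered′ v inv with pos-surjective v inv
    ... | x , sx , refl with moving? x
    ...   | no nm = coverStill x sx nm
    ...   | yes m with anchor m
    ...     | b , nm , sb , c with coverStill b sb nm
    ...       | T , bs , A , i , c′ = T , bs , A , i , conn⇒connected rep′ c ◅◅ c′

-- The removed and the added edge are the two edges of one triangle at the pivot, so their other
-- ends are consecutive around it.
step-spin : ∀ {n G G′ S S′} → Rep n G S → Rep n G′ S′ → Step n S S′ → SpinOf n G G′
step-spin {n} {G} {G′} {S} {S′} rep rep′ (step τ {i} {j} {k} π lv on-i off-k M _) =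
  pos (vertex τ j) , pos (vertex τ k) , pos (vertex τ i) , inV j , inV k , inV i , consecutive τ π ,
  edge-slot rep (edge τ i) on-x join-x , absent , λ A B → mk⇔ (forth A B) (back A B)
  where
  module M = Moved M
  p u v : Cell
  p = vertex τ j
  u = vertex τ k
  v = vertex τ i
  inV : ∀ l → InV n (pos (vertex τ l))
  inV l = pos-InV (vertex τ l) (trans (vertex-size τ l) lv)
  on-x : On n S (edge τ i)
  on-x = edge-on {S = S} τ i lv on-i
  on-y : On n S′ (edge τ k)
  on-y = edge-on {S = S′} τ k lv M.on
  join-x : Joins (edge τ i) p u
  join-x = edge-joins τ (rotate π)
  join-y : Joins (edge τ k) p v
  join-y = edge-joins τ (swap₁₂ π)
  absent : ¬ Edge G (pos p) (pos v)
  absent e with to (rep _ _) e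
  ... | x , y , (z , o , jz) , q , r
    with samePair-slot (edge τ k) z (proj₁ on-y) (proj₁ o) join-y jz (inj₁ (q , r))
  ...   | refl = on≢off (proj₂ o) off-k
  Spun : Point → Point → Set
  Spun A B = (Edge G A B × ¬ SamePair A B (pos p) (pos u)) ⊎ SamePair A B (pos p) (pos v)
  forth : ∀ A B → Edge G′ A B → Spun A B
  forth A B e with to (rep′ A B) e
  ... | x , y , (z , (st , o) , jz) , refl , refl with z ≟ edge τ k
  ...   | yes refl = inj₂ (slot-samePair z jz join-y)
  ...   | no z≢y = inj₁ (edge-slot rep z (st , trans (sym (M.rest z z≢x z≢y)) o) jz ,
                        λ same → z≢x (samePair-slot z (edge τ i) st (proj₁ on-x) jz join-x same))
    where
    z≢x : z ≢ edge τ i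
    z≢x refl = on≢off o M.off
  back : ∀ A B → Spun A B → Edge G′ A B
  back A B (inj₂ (inj₁ (refl , refl))) = edge-slot rep′ (edge τ k) on-y join-y
  back A B (inj₂ (inj₂ (refl , refl))) = edge-slot rep′ (edge τ k) on-y (joins-sym {i = edge τ k} join-y)
  back A B (inj₁ (e , ne)) with to (rep A B) e
  ... | x , y , (z , (st , o) , jz) , refl , refl = edge-slot rep′ z
    (st , trans (M.rest z (λ { refl → ne (slot-samePair z jz join-x) }) (λ { refl → on≢off o off-k })) o) jz

simulate : ∀ {n G S S′} → IsSimplifiedGrove n G → Rep n G S → Grove n S → Star (Step n) S S′ →
           ∃[ G′ ] Star (SpinStep n) G G′ × Rep n G′ S′
simulate {G = G} sg rep gr ε = G , ε , rep
simulate {n} {G} {S} sg rep gr (_◅_ {j = S₁} st sts) with represent n S₁ | step-conn st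
... | G₁ , rep₁ | _ , same with moved-grove sg rep rep₁ (Grove.forest gr) same
...   | sg₁ with simulate sg₁ rep₁ (step-grove st gr) sts
...     | G₂ , spins , rep₂ = G₂ , (sg , sg₁ , step-spin rep rep₁ st) ◅ spins , rep₂

-- The initial grove and the target grove

fromGraph : Graph → State
fromGraph G z = G (pos (source z)) (pos (sink z))

fromGraph-rep : ∀ {n G} → IsSimplifiedGrove n G → Rep n G (fromGraph G)
fromGraph-rep {n} {G} sg A B = mk⇔ forth back
  where
  open IsSimplifiedGrove sg
  forth : Edge G A B → EdgeOf (On n (fromGraph G)) A B
  forth e with lattice A B e
  ... | inA , inB , st with pos-surjective A inA | pos-surjective B inB
  ...   | x , sx , refl | y , sy , refl with lattice-joins {x = x} {y} sx sy st
  ...     | z , lv , inj₁ (refl , refl) = x , y , (z , (lv , e) , inj₁ (refl , refl)) , refl , refl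
  ...     | z , lv , inj₂ (refl , refl) = x , y , (z , (lv , trans (symmetric _ _) e) , inj₂ (refl , refl)) , refl , refl
  back : EdgeOf (On n (fromGraph G)) A B → Edge G A B
  back (x , y , (z , (_ , e) , inj₁ (refl , refl)) , refl , refl) = e
  back (x , y , (z , (_ , e) , inj₂ (refl , refl)) , refl , refl) = trans (symmetric _ _) e

Together : ℕ → Cell → Cell → Set
Together n x y = ∃[ U ] BoundarySet n U × pos x ∈ U × pos y ∈ U

together-sym : ∀ {n} x y → Together n x y → Together n y x
together-sym x y (U , bs , i , j) = U , bs , j , i

middle : ∀ d → ∃[ U ] BoundarySet (d ℕ.+ d) U × pos ⟨ d , d , 0 ⟩ ∈ U × pos ⟨ d , 0 , d ⟩ ∈ U × pos ⟨ 0 , d , d ⟩ ∈ U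
middle d = _ , middleTriplet d (cong (d ℕ.+_) (sym (ℕ.+-identityʳ d))) ,
  here (cong (_, + 0) (ℤ.+-inverseʳ (+ d))) ,
  there (here (cong (_, - + d) (ℤ.+-identityˡ (- + d)))) ,
  there (there (here (cong (_, - + d) (ℤ.+-identityʳ (+ d)))))

total : ∀ e d → suc e ℕ.+ 2 ℕ.* suc d ≡ suc d ℕ.+ (suc e ℕ.+ suc d)
total e d = solve 2 (λ e d → e :+ con 2 :* d := d :+ (e :+ d)) refl (suc e) (suc d)
  where open ℕ.+-*-Solver

west-together : ∀ e d → Together (d ℕ.+ (e ℕ.+ d)) ⟨ e ℕ.+ d , 0 , d ⟩ ⟨ e ℕ.+ d , d , 0 ⟩
west-together zero d = let U , bs , p , q , _ = middle d in U , bs , q , p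
west-together (suc e) zero = _ , westCorner , here eq , here eq
  where eq = cong (_, + 0) (ℤ.+-identityˡ (- + (suc e ℕ.+ 0)))
west-together (suc e) (suc d) = _ , westPair (suc e) (suc d) (s≤s z≤n) (s≤s z≤n) (total e d) ,
  there (here (cong (_, - + suc d) (ℤ.+-identityˡ (- + (suc e ℕ.+ suc d))))) ,
  here (cong (_, + 0) (minus-sum (suc d) (suc e)))

east-together : ∀ e d → Together (d ℕ.+ (e ℕ.+ d)) ⟨ 0 , e ℕ.+ d , d ⟩ ⟨ d , e ℕ.+ d , 0 ⟩
east-together zero d = let U , bs , p , _ , r = middle d in U , bs , r , p
east-together (suc e) zero = _ , eastCorner , here eq , here eq
  where eq = cong (_, + 0) (ℤ.+-identityʳ (+ (suc e ℕ.+ 0)))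
east-together (suc e) (suc d) = _ , eastPair (suc e) (suc d) (s≤s z≤n) (s≤s z≤n) (total e d) ,
  there (here (cong (_, - + suc d) (ℤ.+-identityʳ (+ (suc e ℕ.+ suc d))))) ,
  here (cong (_, + 0) (sum-minus (suc d) (suc e)))

south-together : ∀ e d → Together (d ℕ.+ (e ℕ.+ d)) ⟨ 0 , d , e ℕ.+ d ⟩ ⟨ d , 0 , e ℕ.+ d ⟩
south-together zero d = let U , bs , _ , q , r = middle d in U , bs , r , q
south-together (suc e) zero = _ , southCorner , here refl , here refl
south-together (suc e) (suc d) = _ , southPair (suc e ℕ.+ suc d) large small ,
  there (here (cong (_, - + (suc e ℕ.+ suc d))
    (solve 2 (λ i d → d :- con (+ 0) := (d :+ i) :- i) refl (+ (suc e ℕ.+ suc d)) (+ suc d)))) ,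
  here (cong (_, - + (suc e ℕ.+ suc d))
    (solve 2 (λ i d → con (+ 0) :- d := i :- (d :+ i)) refl (+ (suc e ℕ.+ suc d)) (+ suc d)))
  where
  open +-*-Solver
  small : suc e ℕ.+ suc d ℕ.< suc d ℕ.+ (suc e ℕ.+ suc d)
  small = s≤s (ℕ.m≤n+m (suc e ℕ.+ suc d) d)
  large : suc d ℕ.+ (suc e ℕ.+ suc d) ℕ.< 2 ℕ.* (suc e ℕ.+ suc d)
  large = subst (suc d ℕ.+ (suc e ℕ.+ suc d) ℕ.<_)
    (cong (suc e ℕ.+ suc d ℕ.+_) (sym (ℕ.+-identityʳ (suc e ℕ.+ suc d))))
    (ℕ.+-monoˡ-< (suc e ℕ.+ suc d) (s≤s (ℕ.m≤n+m (suc d) e)))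

-- The excess `e = m - d` decides which set is meant: the middle triplet for `e = 0`, otherwise a
-- corner for `d = 0` and a pair for `d > 0`.
together : ∀ {n i j k} (π : Perm i j k) m d → d ℕ.≤ m → d ℕ.+ m ≡ n → Together n (cell π m 0 d) (cell π m d 0)
together {n} π m d d≤m eq = split (m ℕ.∸ d) (ℕ.m∸n+n≡m d≤m)
  where
  choose : ∀ {i j k} (π : Perm i j k) e → Together (d ℕ.+ (e ℕ.+ d)) (cell π (e ℕ.+ d) 0 d) (cell π (e ℕ.+ d) d 0)
  choose wes e = west-together e d
  choose wse e = together-sym ⟨ e ℕ.+ d , 0 , d ⟩ ⟨ e ℕ.+ d , d , 0 ⟩ (west-together e d)
  choose ews e = east-together e d
  choose esw e = together-sym ⟨ 0 , e ℕ.+ d , d ⟩ ⟨ d , e ℕ.+ d , 0 ⟩ (east-together e d)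
  choose swe e = south-together e d
  choose sew e = together-sym ⟨ 0 , d , e ℕ.+ d ⟩ ⟨ d , 0 , e ℕ.+ d ⟩ (south-together e d)
  split : ∀ e → e ℕ.+ d ≡ m → Together n (cell π m 0 d) (cell π m d 0)
  split e refl = subst (λ n → Together n (cell π m 0 d) (cell π m d 0)) eq (choose π e)

-- The larger of the two remaining coordinates selects the corner around which the set lies.
side-set : ∀ {n} k x → coord k x ≡ 0 → size x ≡ n → ∃[ U ] BoundarySet n U × pos x ∈ U
side-set {n} k x cx sx = choose (completeTo k)
  where
  go : ∀ {i j} → Perm i k j → coord j x ℕ.≤ coord i x → ∃[ U ] BoundarySet n U × pos x ∈ U
  go {i} {j} π le = let U , bs , p , _ = together π (coord i x) (coord j x) le sum in
    U , bs , subst (λ y → pos y ∈ U) (sym x≡) p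
    where
    x≡ : x ≡ cell π (coord i x) 0 (coord j x)
    x≡ = trans (cell-η π x) (cong (λ y → cell π (coord i x) y (coord j x)) cx)
    sum : coord j x ℕ.+ coord i x ≡ n
    sum = trans (ℕ.+-comm (coord j x) (coord i x)) (trans (cong (ℕ._+ coord j x) (sym (ℕ.+-identityʳ (coord i x))))
            (trans (sym (size-cell π (coord i x) 0 (coord j x))) (trans (cong size (sym x≡)) sx)))
  choose : ∃[ i ] ∃[ j ] Perm i j k → ∃[ U ] BoundarySet n U × pos x ∈ U
  choose (i , j , π) = [ go (swap₂₃ π) , go (swap₂₃ (swap₁₂ π)) ]′ (ℕ.≤-total (coord j x) (coord i x))

initial-grove : ∀ {n G S} → 1 ℕ.≤ n → IsSimplifiedGrove n G → Rep n G S → Grove n S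
initial-grove {n} {G} {S} 1≤n sg rep = record
  { forest = acyclic⇒forest rep acyclic
  ; paired = paired
  ; separated = separated
  ; covers = covers }
  where
  open IsSimplifiedGrove sg
  paired : ∀ {i j k} (π : Perm i j k) m d → d ℕ.≤ m → d ℕ.+ m ≡ n → Conn (On n S) (cell π m 0 d) (cell π m d 0)
  paired π m d d≤m eq = let U , bs , p , q = together π m d d≤m eq in
    connected⇒conn rep
      (trans (size-cell π m 0 d) (trans (cong (ℕ._+ d) (ℕ.+-identityʳ m)) (trans (ℕ.+-comm m d) eq)))
      (trans (size-cell π m d 0) (trans (ℕ.+-identityʳ (m ℕ.+ d)) (trans (ℕ.+-comm m d) eq)))
      (setConnected U bs _ _ p q)
  member : ∀ {U x} (bs : BoundarySet n U) → size x ≡ n → pos x ∈ U → x ∈ BoundaryCells.members (boundaryCells bs)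
  member {x = x} bs sx i with ∈-map⁻ pos (subst (pos x ∈_) (BoundaryCells.image (boundaryCells bs)) i)
  ... | b , j , e with pos-injective x b (trans sx (sym (All.lookup (BoundaryCells.sizes (boundaryCells bs)) j))) e
  ...   | refl = j
  separated : ∀ k x y → size x ≡ n → size y ≡ n → coord k x ≡ 0 → coord k y ≡ 0 → Conn (On n S) x y → x ≡ y
  separated k x y sx sy cx cy c = same (side-set k x cx sx) (side-set k y cy sy)
    where
    same : ∃[ U ] BoundarySet n U × pos x ∈ U → ∃[ U ] BoundarySet n U × pos y ∈ U → x ≡ y
    same (U , bs , p) (U′ , bs′ , q) with setsSeparated U U′ bs bs′ _ _ p q (conn⇒connected rep c)
    ... | refl = BoundaryCells.apart (boundaryCells bs) 1≤n k (member bs sx p) (member bs sy q) cx cy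
  covers : ∀ x → size x ≡ n → ∃[ y ] ∃[ k ] size y ≡ n × coord k y ≡ 0 × Conn (On n S) x y
  covers x sx with covered (pos x) (pos-InV x sx)
  ... | U , bs , A , i , c with boundary-cell bs i
  ...   | b , refl , sb , k , cb = b , k , sb , cb , connected⇒conn rep sx sb c

-- In each family the parameter e is the slack d − t − 1, d − s − 1 or n − i − s − 1.

module _ where
  open +-*-Solver
  private
    one : Polynomial 3
    one = con (+ 1)

  diagW-start : ∀ i e t → pt (+ t - + i) (- + t) ≡ pos ⟨ suc (i ℕ.+ e) , suc (t ℕ.+ e) , t ⟩
  diagW-start i e t = cong (_, - + t)
    (solve 3 (λ i e t → t :- i := (one :+ (t :+ e)) :- (one :+ (i :+ e))) refl (+ i) (+ e) (+ t))

  diagW-end : ∀ i e t → pt (+ (t ℕ.+ 1) - + i) (- + (t ℕ.+ 1)) ≡ pos ⟨ i ℕ.+ e , suc (t ℕ.+ e) , suc t ⟩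
  diagW-end i e t = cong₂ _,_
    (solve 3 (λ i e t → (t :+ one) :- i := (one :+ (t :+ e)) :- (i :+ e)) refl (+ i) (+ e) (+ t))
    (cong (λ x → - + x) (ℕ.+-comm t 1))

  diagE-start : ∀ i e t → pt (+ (i ℕ.+ t)) (- + t) ≡ pos ⟨ suc e , i ℕ.+ suc (t ℕ.+ e) , t ⟩
  diagE-start i e t = cong (_, - + t)
    (solve 3 (λ i e t → i :+ t := (i :+ (one :+ (t :+ e))) :- (one :+ e)) refl (+ i) (+ e) (+ t))

  diagE-end : ∀ i e t → pt (+ (i ℕ.+ t ℕ.+ 1)) (- + (t ℕ.+ 1)) ≡ pos ⟨ e , i ℕ.+ suc (t ℕ.+ e) , suc t ⟩
  diagE-end i e t = cong₂ _,_
    (solve 3 (λ i e t → i :+ t :+ one := (i :+ (one :+ (t :+ e))) :- e) refl (+ i) (+ e) (+ t))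
    (cong (λ x → - + x) (ℕ.+-comm t 1))

  horW-start : ∀ i e s → pt (+ suc (s ℕ.+ e) - + i - + (2 ℕ.* s)) (- + suc (s ℕ.+ e)) ≡ pos ⟨ i ℕ.+ s , suc e , suc (s ℕ.+ e) ⟩
  horW-start i e s = cong (_, - + suc (s ℕ.+ e))
    (solve 3 (λ i e s → (one :+ (s :+ e)) :- i :- (s :+ (s :+ con (+ 0))) := (one :+ e) :- (i :+ s)) refl (+ i) (+ e) (+ s))

  horW-end : ∀ i e s → pt (+ suc (s ℕ.+ e) - + i - + (2 ℕ.* s) - + 2) (- + suc (s ℕ.+ e)) ≡ pos ⟨ suc (i ℕ.+ s) , e , suc (s ℕ.+ e) ⟩
  horW-end i e s = cong (_, - + suc (s ℕ.+ e))
    (solve 3 (λ i e s → (one :+ (s :+ e)) :- i :- (s :+ (s :+ con (+ 0))) :- con (+ 2) := e :- (one :+ (i :+ s))) refl (+ i) (+ e) (+ s))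

  horS-start : ∀ i e s → pt (+ i - + (i ℕ.+ suc (s ℕ.+ e)) + + (2 ℕ.* s)) (- + i) ≡ pos ⟨ suc e , s , i ⟩
  horS-start i e s = cong (_, - + i)
    (solve 3 (λ i e s → i :- (i :+ (one :+ (s :+ e))) :+ (s :+ (s :+ con (+ 0))) := s :- (one :+ e)) refl (+ i) (+ e) (+ s))

  horS-end : ∀ i e s → pt (+ i - + (i ℕ.+ suc (s ℕ.+ e)) + + (2 ℕ.* s) + + 2) (- + i) ≡ pos ⟨ e , suc s , i ⟩
  horS-end i e s = cong (_, - + i)
    (solve 3 (λ i e s → i :- (i :+ (one :+ (s :+ e))) :+ (s :+ (s :+ con (+ 0))) :+ con (+ 2) := (one :+ s) :- e) refl (+ i) (+ e) (+ s))

module _ where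
  open ℕ.+-*-Solver

  diagW-level : ∀ i e t → suc (size ⟨ i ℕ.+ e , suc (t ℕ.+ e) , t ⟩) ≡ i ℕ.+ 2 ℕ.* suc (t ℕ.+ e)
  diagW-level = solve 3 (λ i e t → con 1 :+ ((i :+ e) :+ (con 1 :+ (t :+ e)) :+ t) := i :+ con 2 :* (con 1 :+ (t :+ e))) refl

  diagE-level : ∀ i e t → suc (size ⟨ e , i ℕ.+ suc (t ℕ.+ e) , t ⟩) ≡ i ℕ.+ 2 ℕ.* suc (t ℕ.+ e)
  diagE-level = solve 3 (λ i e t → con 1 :+ (e :+ (i :+ (con 1 :+ (t :+ e))) :+ t) := i :+ con 2 :* (con 1 :+ (t :+ e))) refl

  horW-level : ∀ i e s → suc (size ⟨ i ℕ.+ s , e , suc (s ℕ.+ e) ⟩) ≡ i ℕ.+ 2 ℕ.* suc (s ℕ.+ e)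
  horW-level = solve 3 (λ i e s → con 1 :+ ((i :+ s) :+ e :+ (con 1 :+ (s :+ e))) := i :+ con 2 :* (con 1 :+ (s :+ e))) refl

  horS-level : ∀ i e s → suc (size ⟨ e , s , i ⟩) ≡ i ℕ.+ suc (s ℕ.+ e)
  horS-level = solve 3 (λ i e s → con 1 :+ (e :+ s :+ i) := i :+ (con 1 :+ (s :+ e))) refl

  diagE-coord : ∀ a c f → suc c ℕ.+ (suc a ℕ.+ f) ≡ suc f ℕ.+ suc (c ℕ.+ a)
  diagE-coord = solve 3 (λ a c f → con 1 :+ c :+ (con 1 :+ a :+ f) := con 1 :+ f :+ (con 1 :+ (c :+ a))) refl

-- Comparing the two descriptions of the target

<ᵇ-true : ∀ {m n} → m ℕ.< n → (m <ᵇ n) ≡ true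
<ᵇ-true m<n = Equivalence.to Bool.T-≡ (ℕ.<⇒<ᵇ m<n)

true-<ᵇ : ∀ {m n} → (m <ᵇ n) ≡ true → m ℕ.< n
true-<ᵇ {m} {n} e = ℕ.<ᵇ⇒< m n (Equivalence.from Bool.T-≡ e)

gap : ∀ {m n} → m ℕ.< n → ∃[ e ] n ≡ suc (m ℕ.+ e)
gap m<n = let e , p = ℕ.m≤n⇒∃[o]m+o≡n m<n in e , sym p

-- With `b = c + e + 1`, the diagonal through this edge meets the upper side at abscissa `e - a`;
-- its sign decides between `diagW` and `diagE`.
east-edge : ∀ a b c → c ℕ.< b → TargetEdge′ (suc (size ⟨ a , b , c ⟩)) (pos ⟨ suc a , b , c ⟩) (pos ⟨ a , b , suc c ⟩)
east-edge a b c c<b with gap c<b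
... | e , refl with e ℕ.≤? a
...   | yes e≤a = onDiagonal (a ℕ.∸ e) (ℕ.m∸n+n≡m e≤a)
  where
  onDiagonal : ∀ i → i ℕ.+ e ≡ a → TargetEdge′ (suc (size ⟨ a , b , c ⟩)) (pos ⟨ suc a , b , c ⟩) (pos ⟨ a , b , suc c ⟩)
  onDiagonal i refl = subst₂ (TargetEdge′ _) (diagW-start i e c) (diagW-end i e c)
    (diagW i (suc (c ℕ.+ e)) c (s≤s z≤n) (sym (diagW-level i e c)) (s≤s (ℕ.m≤m+n c e)))
...   | no e≰a with gap (ℕ.≰⇒> e≰a)
...     | f , refl = subst (λ b → TargetEdge′ (suc (size ⟨ a , b , c ⟩)) (pos ⟨ suc a , b , c ⟩) (pos ⟨ a , b , suc c ⟩))
  (sym (diagE-coord a c f))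
  (subst₂ (TargetEdge′ _) (diagE-start (suc f) a c) (diagE-end (suc f) a c)
    (diagE (suc f) (suc (c ℕ.+ a)) c (s≤s z≤n) (s≤s z≤n) (sym (diagE-level (suc f) a c)) (s≤s (ℕ.m≤m+n c a))))

-- With `c = b + s + 1`, the size exceeds `2 * c` by `a - s`. Rows down to half the depth belong to
-- `horW`, which runs from east to west, and deeper ones to `horS`.
south-edge : ∀ a b c → b ℕ.< c → TargetEdge (suc (size ⟨ a , b , c ⟩)) (pos ⟨ suc a , b , c ⟩) (pos ⟨ a , suc b , c ⟩)
south-edge a b c b<c with gap b<c
... | s , refl with s ℕ.≤? a
...   | yes s≤a = onRow (a ℕ.∸ s) (ℕ.m∸n+n≡m s≤a)
  where
  onRow : ∀ i → i ℕ.+ s ≡ a → TargetEdge (suc (size ⟨ a , b , c ⟩)) (pos ⟨ suc a , b , c ⟩) (pos ⟨ a , suc b , c ⟩)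
  onRow i refl = inj₂ (subst (λ x → TargetEdge′ (suc (size ⟨ a , b , x ⟩)) (pos ⟨ a , suc b , x ⟩) (pos ⟨ suc a , b , x ⟩))
    (cong suc (ℕ.+-comm s b))
    (subst₂ (TargetEdge′ _) (horW-start i b s) (horW-end i b s)
      (horW i (suc (s ℕ.+ b)) s (s≤s z≤n) (sym (horW-level i b s)) (s≤s (ℕ.m≤m+n s b)))))
...   | no s≰a = inj₁ (subst (λ n → TargetEdge′ n (pos ⟨ suc a , b , c ⟩) (pos ⟨ a , suc b , c ⟩)) (sym (horS-level c a b))
  (subst₂ (TargetEdge′ _) (horS-start c a b) (horS-end c a b)
    (horS c b large (ℕ.m<m+n c (s≤s z≤n)) (subst (b ℕ.<_) (sym (ℕ.m+n∸m≡n c (suc (b ℕ.+ a)))) (s≤s (ℕ.m≤m+n b a))))))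
  where
  large : c ℕ.+ suc (b ℕ.+ a) ℕ.< 2 ℕ.* c
  large = ℕ.+-monoʳ-< c (subst (suc (b ℕ.+ a) ℕ.<_) (sym (ℕ.+-identityʳ c)) (s≤s (ℕ.+-monoʳ-< b (ℕ.≰⇒> s≰a))))

module _ {n G S} (rep : Rep n G S) (agree : ∀ t k → suc (size t) ≡ n → S (t , k) ≡ target (t , k)) where

  private
    slot-edge : ∀ z {x y A B} → suc (size (proj₁ z)) ≡ n → target z ≡ true → Joins z x y → A ≡ pos x → B ≡ pos y → Edge G A B
    slot-edge (t , k) st o e refl refl = edge-slot rep (t , k) (st , trans (agree t k st) o) e

    edge-back : ∀ {A B} → TargetEdge′ n A B → Edge G A B
    edge-back (diagW i d t _ eq t<d) with gap t<d
    ... | e , refl = slot-edge (⟨ i ℕ.+ e , suc (t ℕ.+ e) , t ⟩ , east) (trans (diagW-level i e t) eq)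
      (<ᵇ-true t<d) (inj₂ (refl , refl)) (diagW-start i e t) (diagW-end i e t)
    edge-back (horW i d s _ eq s<d) with gap s<d
    ... | e , refl = slot-edge (⟨ i ℕ.+ s , e , suc (s ℕ.+ e) ⟩ , south) (trans (horW-level i e s) eq)
      (<ᵇ-true (s≤s (ℕ.m≤n+m e s))) (inj₂ (refl , refl)) (horW-start i e s) (horW-end i e s)
    edge-back (diagE i d t _ _ eq t<d) with gap t<d
    ... | e , refl = slot-edge (⟨ e , i ℕ.+ suc (t ℕ.+ e) , t ⟩ , east) (trans (diagE-level i e t) eq)
      (<ᵇ-true (ℕ.≤-trans t<d (ℕ.m≤n+m _ i))) (inj₂ (refl , refl)) (diagE-start i e t) (diagE-end i e t)
    edge-back (horS i s n<2i i<n s<n∸i) with gap s<n∸i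
    ... | e , p = row (trans (sym (ℕ.m+[n∸m]≡n (ℕ.<⇒≤ i<n))) (cong (i ℕ.+_) p))
      where
      row : n ≡ i ℕ.+ suc (s ℕ.+ e) → _
      row refl = slot-edge (⟨ e , s , i ⟩ , south) (horS-level i e s)
        (<ᵇ-true (ℕ.≤-trans (s≤s (ℕ.≤-trans (ℕ.m≤m+n s e) (ℕ.n≤1+n _))) suc<i))
        (inj₁ (refl , refl)) (horS-start i e s) (horS-end i e s)
        where
        suc<i : suc (s ℕ.+ e) ℕ.< i
        suc<i = subst (suc (s ℕ.+ e) ℕ.<_) (ℕ.+-identityʳ i) (ℕ.+-cancelˡ-< i _ _ n<2i)

    slot-target : ∀ z → suc (size (proj₁ z)) ≡ n → target z ≡ true → TargetEdge n (pos (source z)) (pos (sink z))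
    slot-target (⟨ a , b , c ⟩ , east) refl o = inj₂ (east-edge a b c (true-<ᵇ o))
    slot-target (⟨ a , b , c ⟩ , south) refl o = south-edge a b c (true-<ᵇ o)

  target-graph : IsTargetGrove n G
  target-graph A B = mk⇔ forth [ edge-back , (λ e → flip (edge-back e)) ]′
    where
    forth : Edge G A B → TargetEdge n A B
    forth e with to (rep A B) e
    ... | x , y , ((t , k) , (st , o) , inj₁ (refl , refl)) , refl , refl = slot-target (t , k) st (trans (sym (agree t k st)) o)
    ... | x , y , ((t , k) , (st , o) , inj₂ (refl , refl)) , refl , refl = swap (slot-target (t , k) st (trans (sym (agree t k st)) o))
    flip : ∀ {A B} → Edge G B A → Edge G A B
    flip {A} {B} e with to (rep B A) e
    ... | x , y , (z , o , j) , p , q = from (rep A B) (y , x , (z , o , joins-sym {i = z} j) , q , p)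

theorem3 : (n : ℕ) → 1 ≤ n → (G : Graph) → IsSimplifiedGrove n G →
    ∃[ H ] (Star (SpinStep n) G H × IsTargetGrove n H)
theorem3 n 1≤n G sg =
  let rep = fromGraph-rep sg
      gr = initial-grove 1≤n sg rep
      S , sts , agree = reach-target n (fromGraph G) gr
      H , spins , rep′ = simulate sg rep gr sts
  in H , spins , target-graph rep′ agree
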